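{- Let $\Omega_1,\Omega_2$ be finite sets and $(\Omega_1^k\times\Omega_2^k,\mu)$ a probability space such that the marginal of $\mu$ on any pair of coordinates, one from the $\Omega_1^k$ part and one from the $\Omega_2^k$ part, is a product distribution. Let $\mu_1,\mu_2$ be the marginals of $\mu$ on $\Omega_1^k$ and $\Omega_2^k$. Let $X,Y$ be random $k\times L$ matrices (entries in $\Omega_1$, resp. $\Omega_2$) chosen so that independently for each $i\in[L]$ the pair of $i$-th columns $(x^i,y^i)\in\Omega_1^k\times\Omega_2^k$ is drawn from $\mu$; let $x_j\in\Omega_1^L$, $y_j\in\Omega_2^L$ denote the $j$-th rows. Let $F:\Omega_1^L\to[-1,1]$ and $G:\Omega_2^L\to[-1,1]$ and set $$\tau:=\sqrt{\sum_{i\in[L]}\mathrm{Inf}_i[F]\,\mathrm{Inf}_i[G]},\qquad \Gamma:=\max\Big\{\sqrt{\textstyle\sum_{i\in[L]}\mathrm{Inf}_i[F]},\ \sqrt{\textstyle\sum_{i\in[L]}\mathrm{Inf}_i[G]}\Big\}.$$ Then $$\Big|\mathbb{E}_{(X,Y)\sim\mu^{\otimes L}}\Big[\prod_{j\in[k]}F(x_j)G(y_j)\Big]-\mathbb{E}_{X\sim\mu_1^{\otimes L}}\Big[\prod_{j\in[k]}F(x_j)\Big]\,\mathbb{E}_{Y\sim\mu_2^{\otimes L}}\Big[\prod_{j\in[k]}G(y_j)\Big]\Big|\le 2^{O(k)}\,\Gamma\,\tau,$$ where the $O(\cdot)$ hides an absolute constant.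
   Context: Influences of $F:\Omega_1^L\to\mathbb{R}$ are taken with respect to the product measure on $\Omega_1^L$ whose coordinate marginals are the single-coordinate marginals of $\mu_1$ (and similarly for $G$ with $\mu_2$): $\mathrm{Inf}_i[F]:=\mathbb{E}_{x_{ -i}}\mathrm{Var}_{x_i}[F(x_1,\dots,x_L)]$, equivalently $\sum_{\beta\ni i}\|F_\beta\|_2^2$ for the Efron–Stein decomposition $F=\sum_{\beta\subseteq[L]}F_\beta$. In $X\sim\mu_1^{\otimes L}$ the columns of $X$ are independent samples from $\mu_1$ (and similarly for $Y$). -}

module Defs where

open import Algebra.Bundles using (RawSemiring)
import Algebra.Definitions.RawSemiring as RawSemiringDefs
open import Data.Bool.Base using (if_then_else_)
open import Data.Empty using (⊥; ⊥-elim)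
open import Data.Fin.Base using (Fin)
import Data.Fin.Properties as Fin
import Data.Integer.Base as ℤ
import Data.Integer.Properties as ℤ
open import Data.Nat.Base as ℕ using (ℕ; zero; suc)
open import Data.Nat.Coprimality using (1-coprimeTo; sym)
import Data.Nat.Properties as ℕ
open import Data.Product.Base using (∃; _×_; _,_; proj₁; proj₂)
open import Data.Rational.Base as ℚ using (ℚ; mkℚ; 0ℚ; 1ℚ; ½)
import Data.Rational.Properties as ℚ
open import Data.Rational.Solver using (module +-*-Solver)
open import Data.Sum.Base using (inj₁; inj₂)
open import Data.Vec.Base using (Vec; []; _∷_; lookup; map; insertAt)
open import Function.Base using (_∘_)
open import Function.Bundles using (_↔_; Inverse)
open import Function.Properties.Inverse using (↔⇒↣)
open import Level using (0ℓ)
open import Relation.Binary.Definitions using (DecidableEquality)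
open import Relation.Binary.PropositionalEquality as ≡ using (_≡_; refl; cong; cong₂; subst; subst₂)
open import Relation.Nullary.Decidable using (Dec; yes; no; does; via-injection)

open +-*-Solver using (solve; _:+_; _:*_; _:-_; :-_; _:=_; con)

p≤q⇒0≤q-p : ∀ {p q} → p ℚ.≤ q → 0ℚ ℚ.≤ q ℚ.- p
p≤q⇒0≤q-p {p} {q} p≤q = subst (ℚ._≤ q ℚ.- p) (ℚ.+-inverseʳ p) (ℚ.+-monoˡ-≤ (ℚ.- p) p≤q)

0≤q-p⇒p≤q : ∀ {p q} → 0ℚ ℚ.≤ q ℚ.- p → p ℚ.≤ q
0≤q-p⇒p≤q {p} {q} h = subst₂ ℚ._≤_ (ℚ.+-identityˡ p)
  (solve 2 (λ p q → (q :- p) :+ p := q) refl p q) (ℚ.+-monoˡ-≤ p h)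

0≤* : ∀ {p q} → 0ℚ ℚ.≤ p → 0ℚ ℚ.≤ q → 0ℚ ℚ.≤ p ℚ.* q
0≤* {p} {q} 0≤p 0≤q = subst (ℚ._≤ p ℚ.* q) (ℚ.*-zeroʳ p)
  (ℚ.*-monoˡ-≤-nonNeg p {{ℚ.nonNegative 0≤p}} 0≤q)

0≤+ : ∀ {p q} → 0ℚ ℚ.≤ p → 0ℚ ℚ.≤ q → 0ℚ ℚ.≤ p ℚ.+ q
0≤+ {p} {q} a b = subst (ℚ._≤ p ℚ.+ q) (ℚ.+-identityˡ 0ℚ) (ℚ.+-mono-≤ a b)

*-mono : ∀ {a b c d} → 0ℚ ℚ.≤ c → 0ℚ ℚ.≤ b → a ℚ.≤ b → c ℚ.≤ d → a ℚ.* c ℚ.≤ b ℚ.* d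
*-mono {a} {b} {c} {d} 0≤c 0≤b a≤b c≤d = ℚ.≤-trans
  (ℚ.*-monoʳ-≤-nonNeg c {{ℚ.nonNegative 0≤c}} a≤b)
  (ℚ.*-monoˡ-≤-nonNeg b {{ℚ.nonNegative 0≤b}} c≤d)

²-cancel-< : ∀ {a b} → 0ℚ ℚ.≤ b → a ℚ.* a ℚ.< b ℚ.* b → a ℚ.< b
²-cancel-< {a} {b} 0≤b h with a ℚ.<? b
... | yes a<b = a<b
... | no a≮b = ⊥-elim (ℚ.<-irrefl refl (ℚ.<-≤-trans h
  (*-mono 0≤b (ℚ.≤-trans 0≤b (ℚ.≮⇒≥ a≮b)) (ℚ.≮⇒≥ a≮b) (ℚ.≮⇒≥ a≮b))))

∣∣≤ : ∀ {p q} → p ℚ.≤ q → ℚ.- p ℚ.≤ q → ℚ.∣ p ∣ ℚ.≤ q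
∣∣≤ {p} {q} a b with ℚ.∣p∣≡p∨∣p∣≡-p p
... | inj₁ e = subst (ℚ._≤ q) (≡.sym e) a
... | inj₂ e = subst (ℚ._≤ q) (≡.sym e) b

p≤∣p∣ : ∀ p → p ℚ.≤ ℚ.∣ p ∣
p≤∣p∣ p with ℚ.≤-total 0ℚ p
... | inj₁ 0≤p = ℚ.≤-reflexive (≡.sym (ℚ.0≤p⇒∣p∣≡p 0≤p))
... | inj₂ p≤0 = ℚ.≤-trans p≤0 (ℚ.0≤∣p∣ p)

∣p-q∣≡∣q-p∣ : ∀ p q → ℚ.∣ p ℚ.- q ∣ ≡ ℚ.∣ q ℚ.- p ∣
∣p-q∣≡∣q-p∣ p q = ≡.trans
  (cong ℚ.∣_∣ (solve 2 (λ p q → p :- q := :- (q :- p)) refl p q)) (ℚ.∣-p∣≡∣p∣ (q ℚ.- p))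

p≤q+∣p-q∣ : ∀ p q {ε} → ℚ.∣ p ℚ.- q ∣ ℚ.≤ ε → p ℚ.≤ q ℚ.+ ε
p≤q+∣p-q∣ p q {ε} h = subst (ℚ._≤ q ℚ.+ ε)
  (solve 2 (λ p q → q :+ (p :- q) := p) refl p q)
  (ℚ.+-monoʳ-≤ q (ℚ.≤-trans (p≤∣p∣ (p ℚ.- q)) h))

q≤p+∣p-q∣ : ∀ p q {ε} → ℚ.∣ p ℚ.- q ∣ ℚ.≤ ε → q ℚ.≤ p ℚ.+ ε
q≤p+∣p-q∣ p q h = p≤q+∣p-q∣ q p (subst (ℚ._≤ _) (∣p-q∣≡∣q-p∣ p q) h)

∣-∣-intro : ∀ p q {ε} → p ℚ.≤ q ℚ.+ ε → q ℚ.≤ p ℚ.+ ε → ℚ.∣ p ℚ.- q ∣ ℚ.≤ ε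
∣-∣-intro p q {ε} h k = ∣∣≤
  (subst (p ℚ.- q ℚ.≤_) (solve 2 (λ q ε → (q :+ ε) :- q := ε) refl q ε) (ℚ.+-monoˡ-≤ (ℚ.- q) h))
  (subst₂ ℚ._≤_ (solve 2 (λ p q → q :- p := :- (p :- q)) refl p q)
    (solve 2 (λ q ε → (q :+ ε) :- q := ε) refl p ε) (ℚ.+-monoˡ-≤ (ℚ.- p) k))

½-pos : ∀ {ε} → 0ℚ ℚ.< ε → 0ℚ ℚ.< ½ ℚ.* ε
½-pos {ε} 0<ε = subst (ℚ._< ½ ℚ.* ε) (ℚ.*-zeroʳ ½) (ℚ.*-monoʳ-<-pos ½ 0<ε)

½+½ : ∀ ε → ½ ℚ.* ε ℚ.+ ½ ℚ.* ε ≡ ε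
½+½ ε = ≡.trans (≡.sym (ℚ.*-distribʳ-+ ε ½ ½)) (ℚ.*-identityˡ ε)

∣∣-+-≤ : ∀ {p q δ ε} → ℚ.∣ p ∣ ℚ.≤ δ → ℚ.∣ q ∣ ℚ.≤ ε → ℚ.∣ p ℚ.+ q ∣ ℚ.≤ δ ℚ.+ ε
∣∣-+-≤ {p} {q} h k = ℚ.≤-trans (ℚ.∣p+q∣≤∣p∣+∣q∣ p q) (ℚ.+-mono-≤ h k)

divide : ∀ {B ε} → 0ℚ ℚ.< B → 0ℚ ℚ.< ε → ∃ λ δ → 0ℚ ℚ.< δ × B ℚ.* δ ≡ ε
divide {B} {ε} 0<B 0<ε = r ℚ.* ε
  , subst (ℚ._< r ℚ.* ε) (ℚ.*-zeroʳ r) (ℚ.*-monoʳ-<-pos r 0<ε)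
  , ≡.trans (≡.sym (ℚ.*-assoc B r ε)) (≡.trans (cong (ℚ._* ε) (ℚ.*-inverseʳ B)) (ℚ.*-identityˡ ε))
  where
  instance
    B-pos : ℚ.Positive B
    B-pos = ℚ.positive 0<B
    B-nonZero : ℚ.NonZero B
    B-nonZero = ℚ.pos⇒nonZero B
  r = ℚ.1/ B
  instance
    r-pos : ℚ.Positive r
    r-pos = ℚ.1/pos⇒pos B

-- Real numbers are Cauchy sequences of rationals, up to _≈_.
IsCauchy : (ℕ → ℚ) → Set
IsCauchy f = ∀ ε → 0ℚ ℚ.< ε → ∃ λ N → ∀ m n → N ℕ.≤ m → N ℕ.≤ n → ℚ.∣ f m ℚ.- f n ∣ ℚ.≤ ε

record ℝ : Set where
  constructor mkℝ
  field
    seq    : ℕ → ℚ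
    cauchy : IsCauchy seq

open ℝ public

infix 4 _≈_ _≤_

_≈_ : ℝ → ℝ → Set
x ≈ y = ∀ ε → 0ℚ ℚ.< ε → ∃ λ N → ∀ n → N ℕ.≤ n → ℚ.∣ seq x n ℚ.- seq y n ∣ ℚ.≤ ε

_≤_ : ℝ → ℝ → Set
x ≤ y = ∀ ε → 0ℚ ℚ.< ε → ∃ λ N → ∀ n → N ℕ.≤ n → seq x n ℚ.≤ seq y n ℚ.+ ε

fromℚ : ℚ → ℝ
fromℚ q = mkℝ (λ _ → q) λ ε 0<ε → 0 , λ _ _ _ _ →
  subst (λ r → ℚ.∣ r ∣ ℚ.≤ ε) (≡.sym (ℚ.+-inverseʳ q)) (ℚ.<⇒≤ 0<ε)

fromℕ : ℕ → ℝ
fromℕ n = fromℚ (mkℚ (ℤ.+ n) 0 (sym (1-coprimeTo n)))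

0ℝ 1ℝ : ℝ
0ℝ = fromℚ 0ℚ
1ℝ = fromℚ 1ℚ

infix  8 -_
infixl 7 _*_
infixl 6 _+_ _-_ _⊔_

_+_ : ℝ → ℝ → ℝ
x + y = mkℝ (λ n → seq x n ℚ.+ seq y n) λ ε 0<ε →
  let (M , p) = cauchy x (½ ℚ.* ε) (½-pos 0<ε)
      (N , q) = cauchy y (½ ℚ.* ε) (½-pos 0<ε)
  in M ℕ.⊔ N , λ m n hm hn → subst₂ ℚ._≤_
       (cong ℚ.∣_∣ (solve 4 (λ a b c d → (a :- c) :+ (b :- d) := (a :+ b) :- (c :+ d)) refl
         (seq x m) (seq y m) (seq x n) (seq y n)))
       (½+½ ε)
       (∣∣-+-≤ (p m n (ℕ.m⊔n≤o⇒m≤o M N hm) (ℕ.m⊔n≤o⇒m≤o M N hn))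
               (q m n (ℕ.m⊔n≤o⇒n≤o M N hm) (ℕ.m⊔n≤o⇒n≤o M N hn)))

-_ : ℝ → ℝ
- x = mkℝ (λ n → ℚ.- seq x n) λ ε 0<ε →
  let (N , p) = cauchy x ε 0<ε
  in N , λ m n hm hn → subst (ℚ._≤ ε)
       (cong ℚ.∣_∣ (solve 2 (λ a b → b :- a := :- a :- :- b) refl (seq x m) (seq x n)))
       (p n m hn hm)

_-_ : ℝ → ℝ → ℝ
x - y = x + - y

bounded : ∀ x → ∃ λ B → 0ℚ ℚ.< B × ∃ λ N → ∀ n → N ℕ.≤ n → ℚ.∣ seq x n ∣ ℚ.≤ B
bounded x =
  let (N , p) = cauchy x 1ℚ (ℚ.positive⁻¹ 1ℚ)
      a = seq x N
  in ℚ.∣ a ∣ ℚ.+ 1ℚ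
     , ℚ.+-mono-≤-< (ℚ.0≤∣p∣ a) (ℚ.positive⁻¹ 1ℚ)
     , N
     , λ n hn → subst (λ r → ℚ.∣ r ∣ ℚ.≤ ℚ.∣ a ∣ ℚ.+ 1ℚ)
         (solve 2 (λ a b → a :+ (b :- a) := b) refl a (seq x n))
         (∣∣-+-≤ (ℚ.≤-refl {ℚ.∣ a ∣}) (p n N hn ℕ.≤-refl))

_*_ : ℝ → ℝ → ℝ
x * y = mkℝ (λ n → seq x n ℚ.* seq y n) λ ε 0<ε →
  let (A , 0<A , K , a) = bounded x
      (B , 0<B , L , b) = bounded y
      (δ , 0<δ , eδ)    = divide 0<A (½-pos 0<ε)
      (η , 0<η , eη)    = divide 0<B (½-pos 0<ε)
      (M , p)           = cauchy y δ 0<δ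
      (N , q)           = cauchy x η 0<η
      KM = K ℕ.⊔ M
      LN = L ℕ.⊔ N
  in KM ℕ.⊔ LN , λ m n hm hn →
       let K≤m = ℕ.m⊔n≤o⇒m≤o K M (ℕ.m⊔n≤o⇒m≤o KM LN hm)
           M≤m = ℕ.m⊔n≤o⇒n≤o K M (ℕ.m⊔n≤o⇒m≤o KM LN hm)
           N≤m = ℕ.m⊔n≤o⇒n≤o L N (ℕ.m⊔n≤o⇒n≤o KM LN hm)
           M≤n = ℕ.m⊔n≤o⇒n≤o K M (ℕ.m⊔n≤o⇒m≤o KM LN hn)
           L≤n = ℕ.m⊔n≤o⇒m≤o L N (ℕ.m⊔n≤o⇒n≤o KM LN hn)
           N≤n = ℕ.m⊔n≤o⇒n≤o L N (ℕ.m⊔n≤o⇒n≤o KM LN hn)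
       in subst₂ ℚ._≤_
            (cong ℚ.∣_∣ (solve 4 (λ a b c d → a :* (b :- d) :+ d :* (a :- c) := (a :* b) :- (c :* d)) refl
              (seq x m) (seq y m) (seq x n) (seq y n)))
            (≡.trans (cong₂ ℚ._+_ eδ eη) (½+½ ε))
            (∣∣-+-≤ (∣*∣≤ (seq x m) (seq y m ℚ.- seq y n) 0<A (a m K≤m) (p m n M≤m M≤n))
                    (∣*∣≤ (seq y n) (seq x m ℚ.- seq x n) 0<B (b n L≤n) (q m n N≤m N≤n)))
  where
  ∣*∣≤ : ∀ u v {A δ} → 0ℚ ℚ.< A → ℚ.∣ u ∣ ℚ.≤ A → ℚ.∣ v ∣ ℚ.≤ δ → ℚ.∣ u ℚ.* v ∣ ℚ.≤ A ℚ.* δ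
  ∣*∣≤ u v {A} {δ} 0<A h k = subst (ℚ._≤ A ℚ.* δ) (≡.sym (ℚ.∣p*q∣≡∣p∣*∣q∣ u v))
    (*-mono (ℚ.0≤∣p∣ v) (ℚ.<⇒≤ 0<A) h k)

_⊔_ : ℝ → ℝ → ℝ
x ⊔ y = mkℝ (λ n → seq x n ℚ.⊔ seq y n) λ ε 0<ε →
  let (M , p) = cauchy x ε 0<ε
      (N , q) = cauchy y ε 0<ε
  in M ℕ.⊔ N , λ m n hm hn →
       let pm = p m n (ℕ.m⊔n≤o⇒m≤o M N hm) (ℕ.m⊔n≤o⇒m≤o M N hn)
           qm = q m n (ℕ.m⊔n≤o⇒n≤o M N hm) (ℕ.m⊔n≤o⇒n≤o M N hn)
           a = seq x m
           b = seq y m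
           c = seq x n
           d = seq y n
       in ∣-∣-intro (a ℚ.⊔ b) (c ℚ.⊔ d)
            (⊔-≤ a b c d (p≤q+∣p-q∣ a c pm) (p≤q+∣p-q∣ b d qm))
            (⊔-≤ c d a b (q≤p+∣p-q∣ a c pm) (q≤p+∣p-q∣ b d qm))
  where
  ⊔-≤ : ∀ a b c d {ε} → a ℚ.≤ c ℚ.+ ε → b ℚ.≤ d ℚ.+ ε → a ℚ.⊔ b ℚ.≤ (c ℚ.⊔ d) ℚ.+ ε
  ⊔-≤ a b c d {ε} h k = ℚ.⊔-lub
    (ℚ.≤-trans h (ℚ.+-monoˡ-≤ ε (ℚ.p≤p⊔q c d)))
    (ℚ.≤-trans k (ℚ.+-monoˡ-≤ ε (ℚ.p≤q⊔p c d)))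

∣_∣ : ℝ → ℝ
∣ x ∣ = x ⊔ - x

step : ℕ → ℚ
step n = mkℚ (ℤ.+ 1) n (1-coprimeTo (suc n))

multiple : ℕ → ℚ → ℚ
multiple zero    h = 0ℚ
multiple (suc j) h = multiple j h ℚ.+ h

-- The largest multiple t = i · h with i ≤ j and t ² ≤ q (or 0 if there is none).
search : ℚ → ℚ → ℕ → ℚ
search q h zero    = 0ℚ
search q h (suc j) =
  if does (multiple (suc j) h ℚ.* multiple (suc j) h ℚ.≤? q) then multiple (suc j) h else search q h j

-- The search starts at |numerator of q| + 1, which exceeds the square root of q.
approx : ℕ → ℚ → ℚ
approx n q = search q (step n) (suc ℤ.∣ ℚ.↥ q ∣ ℕ.* suc n)

step-pos : ∀ n → 0ℚ ℚ.< step n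
step-pos n = ℚ.positive⁻¹ (step n)

multiple-+ : ∀ i j h → multiple (i ℕ.+ j) h ≡ multiple i h ℚ.+ multiple j h
multiple-+ zero    j h = ≡.sym (ℚ.+-identityˡ _)
multiple-+ (suc i) j h = ≡.trans (cong (ℚ._+ h) (multiple-+ i j h))
  (solve 3 (λ a b h → (a :+ b) :+ h := (a :+ h) :+ b) refl (multiple i h) (multiple j h) h)

multiple-* : ∀ i j h → multiple (i ℕ.* j) h ≡ multiple i (multiple j h)
multiple-* zero    j h = refl
multiple-* (suc i) j h = ≡.trans (multiple-+ j (i ℕ.* j) h)
  (≡.trans (cong (multiple j h ℚ.+_) (multiple-* i j h)) (ℚ.+-comm (multiple j h) _))

fromℕℚ : ℕ → ℚ
fromℕℚ n = mkℚ (ℤ.+ n) 0 (sym (1-coprimeTo n))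

fromℕℚ-suc : ∀ j → fromℕℚ j ℚ.+ 1ℚ ≡ fromℕℚ (suc j)
fromℕℚ-suc j = ≡.trans (cong₂ (λ a b → (a ℤ.+ b) ℚ./ 1) (ℤ.*-identityʳ (ℤ.+ j)) (ℤ.*-identityʳ (ℤ.+ 1)))
  (≡.trans (cong (λ a → ℤ.+ a ℚ./ 1) (ℕ.+-comm j 1)) (ℚ.↥p/↧p≡p (fromℕℚ (suc j))))

multiple-fromℕ : ∀ j h → multiple j h ≡ fromℕℚ j ℚ.* h
multiple-fromℕ zero    h = ≡.sym (ℚ.*-zeroˡ h)
multiple-fromℕ (suc j) h = ≡.trans (cong (ℚ._+ h) (multiple-fromℕ j h))
  (≡.trans (solve 2 (λ a h → a :* h :+ h := (a :+ con 1ℚ) :* h) refl (fromℕℚ j) h)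
           (cong (ℚ._* h) (fromℕℚ-suc j)))

multiple-step : ∀ n → multiple (suc n) (step n) ≡ 1ℚ
multiple-step n = ≡.trans (multiple-fromℕ (suc n) (step n)) (ℚ.*-inverseʳ (fromℕℚ (suc n)))

q≤∣↥q∣ : ∀ q → q ℚ.≤ fromℕℚ ℤ.∣ ℚ.↥ q ∣
q≤∣↥q∣ q@(mkℚ (ℤ.+ a) d _) = ℚ.*≤* (subst₂ ℤ._≤_ (ℤ.pos-* a 1) (ℤ.pos-* a (suc d))
  (ℤ.+≤+ (ℕ.*-monoʳ-≤ a (ℕ.s≤s ℕ.z≤n))))
q≤∣↥q∣ q@(mkℚ (ℤ.-[1+ a ]) d _) = ℚ.≤-trans (ℚ.<⇒≤ (ℚ.negative⁻¹ q)) (ℚ.nonNegative⁻¹ (fromℕℚ (suc a)))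

record Root (q h s : ℚ) : Set where
  field
    s≥0    : 0ℚ ℚ.≤ s
    s²≤q   : s ℚ.* s ℚ.≤ q
    q<s+h² : q ℚ.< (s ℚ.+ h) ℚ.* (s ℚ.+ h)

multiple≥0 : ∀ j {h} → 0ℚ ℚ.≤ h → 0ℚ ℚ.≤ multiple j h
multiple≥0 zero    0≤h = ℚ.≤-refl
multiple≥0 (suc j) 0≤h = 0≤+ (multiple≥0 j 0≤h) 0≤h

search-root : ∀ {q h} → 0ℚ ℚ.≤ q → 0ℚ ℚ.≤ h → ∀ j →
              q ℚ.< multiple (suc j) h ℚ.* multiple (suc j) h → Root q h (search q h j)
search-root 0≤q 0≤h zero    q< = record { s≥0 = ℚ.≤-refl ; s²≤q = 0≤q ; q<s+h² = q< }
search-root {q} {h} 0≤q 0≤h (suc j) q< = select (t ℚ.* t ℚ.≤? q)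
  where
  t = multiple (suc j) h
  select : (d : Dec (t ℚ.* t ℚ.≤ q)) → Root q h (if does d then t else search q h j)
  select (yes ≤q) = record { s≥0 = multiple≥0 (suc j) 0≤h ; s²≤q = ≤q ; q<s+h² = q< }
  select (no  ≰q) = search-root 0≤q 0≤h j (ℚ.≰⇒> ≰q)

approx-root : ∀ n {q} → 0ℚ ℚ.≤ q → Root q (step n) (approx n q)
approx-root n {q} 0≤q = search-root 0≤q (ℚ.<⇒≤ (step-pos n)) J
  (ℚ.<-≤-trans q<t (ℚ.≤-trans (ℚ.≤-reflexive (≡.sym (ℚ.*-identityˡ t))) (*-mono 0≤t 0≤t 1≤t ℚ.≤-refl)))
  where
  h = step n
  K = ℤ.∣ ℚ.↥ q ∣
  J = suc K ℕ.* suc n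
  t = multiple (suc J) h
  eJ : multiple J h ≡ fromℕℚ (suc K)
  eJ = ≡.trans (multiple-* (suc K) (suc n) h)
    (≡.trans (cong (multiple (suc K)) (multiple-step n))
    (≡.trans (multiple-fromℕ (suc K) 1ℚ) (ℚ.*-identityʳ _)))
  K+1≤t : fromℕℚ K ℚ.+ 1ℚ ℚ.≤ t
  K+1≤t = subst₂ ℚ._≤_
    (≡.trans (ℚ.+-identityʳ _) (≡.trans eJ (≡.sym (fromℕℚ-suc K)))) refl
    (ℚ.+-monoʳ-≤ (multiple J h) (ℚ.<⇒≤ (step-pos n)))
  q<t : q ℚ.< t
  q<t = ℚ.<-≤-trans
    (subst (ℚ._< fromℕℚ K ℚ.+ 1ℚ) (ℚ.+-identityʳ q)
      (ℚ.+-mono-≤-< (q≤∣↥q∣ q) (ℚ.positive⁻¹ 1ℚ)))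
    K+1≤t
  1≤t : 1ℚ ℚ.≤ t
  1≤t = ℚ.≤-trans (subst (ℚ._≤ fromℕℚ K ℚ.+ 1ℚ) (ℚ.+-identityˡ 1ℚ)
    (ℚ.+-monoˡ-≤ 1ℚ (ℚ.nonNegative⁻¹ (fromℕℚ K)))) K+1≤t
  0≤t : 0ℚ ℚ.≤ t
  0≤t = ℚ.≤-trans (ℚ.nonNegative⁻¹ 1ℚ) 1≤t

step≤ : ∀ ε → 0ℚ ℚ.< ε → ∃ λ N → ∀ n → N ℕ.≤ n → step n ℚ.≤ ε
step≤ ε@(mkℚ (ℤ.+ suc a) d _) 0<ε = d , λ n d≤n → ℚ.*≤* (ℤ.+≤+
  (subst (ℕ._≤ suc a ℕ.* suc n) (≡.sym (ℕ.+-identityʳ (suc d)))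
    (ℕ.≤-trans (ℕ.s≤s d≤n) (ℕ.m≤m+n (suc n) (a ℕ.* suc n)))))
step≤ ε@(mkℚ (ℤ.+ 0) d _) 0<ε = ⊥-elim (lemma (ℚ.positive 0<ε))
  where lemma : ℚ.Positive ε → ⊥
        lemma ()
step≤ ε@(mkℚ (ℤ.-[1+ a ]) d _) 0<ε = ⊥-elim (lemma (ℚ.positive 0<ε))
  where lemma : ℚ.Positive ε → ⊥
        lemma ()

-- s ² ≤ p ≤ q + δ ² and q < (t + h) ² give s ≤ t + (h + δ).
root-≤ : ∀ {p q g h s t δ} → Root p g s → Root q h t → 0ℚ ℚ.≤ h → 0ℚ ℚ.≤ δ →
         p ℚ.≤ q ℚ.+ δ ℚ.* δ → s ℚ.≤ t ℚ.+ (h ℚ.+ δ)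
root-≤ {p} {q} {g} {h} {s} {t} {δ} P Q 0≤h 0≤δ p≤ = ℚ.<⇒≤ (²-cancel-<
  (0≤+ (Root.s≥0 Q) (0≤+ 0≤h 0≤δ))
  (ℚ.≤-<-trans (Root.s²≤q P) (ℚ.≤-<-trans p≤ (ℚ.<-≤-trans
    (ℚ.+-monoˡ-< (δ ℚ.* δ) (Root.q<s+h² Q))
    (0≤q-p⇒p≤q (subst (0ℚ ℚ.≤_)
      (solve 3 (λ t h δ → (t :+ h) :* δ :+ (t :+ h) :* δ :=
         (t :+ (h :+ δ)) :* (t :+ (h :+ δ)) :- ((t :+ h) :* (t :+ h) :+ δ :* δ)) refl t h δ)
      (0≤+ X X)))))))
  where
  X : 0ℚ ℚ.≤ (t ℚ.+ h) ℚ.* δ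
  X = 0≤* (0≤+ (Root.s≥0 Q) 0≤h) 0≤δ

infix 8 √_

-- √ x is the square root of the positive part of x; see √-nonneg and √-square.
√_ : ℝ → ℝ
√ x = mkℝ (λ n → approx n (0ℚ ℚ.⊔ seq x n)) λ ε 0<ε →
  let δ = ½ ℚ.* ε
      0<δ = ½-pos 0<ε
      0<δ² = subst (ℚ._< δ ℚ.* δ) (ℚ.*-zeroʳ δ) (ℚ.*-monoʳ-<-pos δ {{ℚ.positive 0<δ}} 0<δ)
      (M , p) = cauchy (0ℝ ⊔ x) (δ ℚ.* δ) 0<δ²
      (N , q) = step≤ δ 0<δ
      close = λ m n hm hn → let pm = p m n (ℕ.m⊔n≤o⇒m≤o M N hm) (ℕ.m⊔n≤o⇒m≤o M N hn) in
        ℚ.≤-trans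
          (root-≤ (root m) (root n) (ℚ.<⇒≤ (step-pos n)) (ℚ.<⇒≤ 0<δ) (p≤q+∣p-q∣ (0ℚ ℚ.⊔ seq x m) (0ℚ ℚ.⊔ seq x n) pm))
          (ℚ.+-monoʳ-≤ (approx n (0ℚ ℚ.⊔ seq x n))
            (subst (step n ℚ.+ δ ℚ.≤_) (½+½ ε) (ℚ.+-monoˡ-≤ δ (q n (ℕ.m⊔n≤o⇒n≤o M N hn)))))
  in M ℕ.⊔ N , λ m n hm hn →
       ∣-∣-intro (approx m (0ℚ ℚ.⊔ seq x m)) (approx n (0ℚ ℚ.⊔ seq x n)) (close m n hm hn) (close n m hn hm)
  where
  root : ∀ n → Root (0ℚ ℚ.⊔ seq x n) (step n) (approx n (0ℚ ℚ.⊔ seq x n))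
  root n = approx-root n (ℚ.p≤p⊔q 0ℚ (seq x n))

√-root : ∀ x n → Root (0ℚ ℚ.⊔ seq x n) (step n) (seq (√ x) n)
√-root x n = approx-root n (ℚ.p≤p⊔q 0ℚ (seq x n))

√-nonneg : ∀ x → 0ℝ ≤ √ x
√-nonneg x ε 0<ε = 0 , λ n _ → 0≤+ (Root.s≥0 (√-root x n)) (ℚ.<⇒≤ 0<ε)

√-square : ∀ x → 0ℝ ≤ x → √ x * √ x ≈ x
√-square x 0≤x ε 0<ε =
  let (B , 0<B , K , b) = bounded (√ x)
      C = B ℚ.+ (B ℚ.+ 1ℚ)
      0<C = ℚ.+-mono-< 0<B (ℚ.+-mono-< 0<B (ℚ.positive⁻¹ 1ℚ))
      (δ , 0<δ , eδ) = divide 0<C 0<ε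
      (M , p) = step≤ δ 0<δ
      (N , q) = 0≤x ε 0<ε
      MN = M ℕ.⊔ N
  in K ℕ.⊔ MN , λ n hn →
    let K≤n = ℕ.m⊔n≤o⇒m≤o K MN hn
        M≤n = ℕ.m⊔n≤o⇒m≤o M N (ℕ.m⊔n≤o⇒n≤o K MN hn)
        N≤n = ℕ.m⊔n≤o⇒n≤o M N (ℕ.m⊔n≤o⇒n≤o K MN hn)
        r = √-root x n
        s = seq (√ x) n
        h = step n
        0≤h = ℚ.<⇒≤ (step-pos n)
        s≤B = ℚ.≤-trans (p≤∣p∣ s) (b n K≤n)
        h≤1 = step≤1 n
        err : (s ℚ.+ (s ℚ.+ h)) ℚ.* h ℚ.≤ ε
        err = subst ((s ℚ.+ (s ℚ.+ h)) ℚ.* h ℚ.≤_) eδ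
          (*-mono 0≤h (ℚ.<⇒≤ 0<C) (ℚ.+-mono-≤ s≤B (ℚ.+-mono-≤ s≤B h≤1)) (p n M≤n))
    in ∣-∣-intro (s ℚ.* s) (seq x n)
         (ℚ.≤-trans (Root.s²≤q r) (ℚ.⊔-lub (q n N≤n) (subst (ℚ._≤ seq x n ℚ.+ ε) (ℚ.+-identityʳ (seq x n))
           (ℚ.+-monoʳ-≤ (seq x n) (ℚ.<⇒≤ 0<ε)))))
         (ℚ.≤-trans (ℚ.p≤q⊔p 0ℚ (seq x n)) (ℚ.≤-trans (ℚ.<⇒≤ (Root.q<s+h² r))
           (subst (ℚ._≤ s ℚ.* s ℚ.+ ε)
             (solve 2 (λ s h → s :* s :+ (s :+ (s :+ h)) :* h := (s :+ h) :* (s :+ h)) refl s h)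
             (ℚ.+-monoʳ-≤ (s ℚ.* s) err))))
  where
  step≤1 : ∀ n → step n ℚ.≤ 1ℚ
  step≤1 n = ℚ.*≤* (ℤ.+≤+ (ℕ.s≤s ℕ.z≤n))

ℝ-rawSemiring : RawSemiring 0ℓ 0ℓ
ℝ-rawSemiring = record
  { Carrier = ℝ ; _≈_ = _≈_ ; _+_ = _+_ ; _*_ = _*_ ; 0# = 0ℝ ; 1# = 1ℝ }

open RawSemiringDefs ℝ-rawSemiring public using (sum; product)

record FiniteSet : Set₁ where
  field
    Carrier : Set
    size    : ℕ
    enum    : Carrier ↔ Fin size

  _≟_ : DecidableEquality Carrier
  _≟_ = via-injection (↔⇒↣ enum) Fin._≟_

open FiniteSet public using (Carrier)

-- A summation operator for A sends f : A → ℝ to the sum of f over all of A.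
Summation : Set → Set
Summation A = (A → ℝ) → ℝ

∑ : (Ω : FiniteSet) → Summation (Carrier Ω)
∑ Ω f = sum (f ∘ Inverse.from (FiniteSet.enum Ω))

∑-× : {A B : Set} → Summation A → Summation B → Summation (A × B)
∑-× ∑A ∑B f = ∑A λ a → ∑B λ b → f (a , b)

∑-Vec : {A : Set} → Summation A → (n : ℕ) → Summation (Vec A n)
∑-Vec ∑A zero    f = f []
∑-Vec ∑A (suc n) f = ∑A λ a → ∑-Vec ∑A n λ v → f (a ∷ v)

-- Measures on a finite set are given by their point masses.
record IsProbability {A : Set} (∑A : Summation A) (p : A → ℝ) : Set where
  field
    nonNegative : ∀ a → 0ℝ ≤ p a
    total       : ∑A p ≈ 1ℝ

𝔼 : {A : Set} → Summation A → (A → ℝ) → (A → ℝ) → ℝ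
𝔼 ∑A p f = ∑A λ a → p a * f a

Var : {A : Set} → Summation A → (A → ℝ) → (A → ℝ) → ℝ
Var ∑A p f = 𝔼 ∑A p λ a → (f a - m) * (f a - m)
  where m = 𝔼 ∑A p f

infix 9 _^⊗_

_^⊗_ : {A : Set} → (A → ℝ) → (n : ℕ) → Vec A n → ℝ
(p ^⊗ n) v = product λ i → p (lookup v i)

-- ν is the law of a single coordinate; x₋ᵢ lists the coordinates other than the i-th.
Inf : (Ω : FiniteSet) (ν : Carrier Ω → ℝ) {L : ℕ} → (Vec (Carrier Ω) L → ℝ) → Fin L → ℝ
Inf Ω ν {suc n} F i =
  𝔼 (∑-Vec (∑ Ω) n) (ν ^⊗ n) λ x₋ᵢ → Var (∑ Ω) ν λ xᵢ → F (insertAt x₋ᵢ i xᵢ)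

𝟙 : {P : Set} → Dec P → ℝ
𝟙 d = if does d then 1ℝ else 0ℝ

-- Matrices are stored by columns.
row : {A : Set} {k L : ℕ} → Fin k → Vec (Vec A k) L → Vec A L
row j M = map (λ column → lookup column j) M

coordinateMarginal : (Ω : FiniteSet) {k : ℕ} → (Vec (Carrier Ω) k → ℝ) → Fin k → Carrier Ω → ℝ
coordinateMarginal Ω {k} p j a = ∑-Vec (∑ Ω) k λ x → 𝟙 (lookup x j ≟ a) * p x
  where open FiniteSet Ω

module CorrelatedSpace (Ω₁ Ω₂ : FiniteSet) (k : ℕ) where

  A₁ A₂ : Set
  A₁ = Carrier Ω₁
  A₂ = Carrier Ω₂

  Point : Set
  Point = Vec A₁ k × Vec A₂ k

  ∑₁ : Summation (Vec A₁ k)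
  ∑₁ = ∑-Vec (∑ Ω₁) k

  ∑₂ : Summation (Vec A₂ k)
  ∑₂ = ∑-Vec (∑ Ω₂) k

  ∑₁₂ : Summation Point
  ∑₁₂ = ∑-× ∑₁ ∑₂

  marginal₁ : (Point → ℝ) → Vec A₁ k → ℝ
  marginal₁ μ x = ∑₂ λ y → μ (x , y)

  marginal₂ : (Point → ℝ) → Vec A₂ k → ℝ
  marginal₂ μ y = ∑₁ λ x → μ (x , y)

  pairMarginal : (Point → ℝ) → Fin k → Fin k → A₁ × A₂ → ℝ
  pairMarginal μ j l (a , b) =
    ∑₁₂ λ (x , y) → 𝟙 (FiniteSet._≟_ Ω₁ (lookup x j) a) * 𝟙 (FiniteSet._≟_ Ω₂ (lookup y l) b) * μ (x , y)

  -- A law on A₁ × A₂ is a product distribution iff it is the product of its own marginals, which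
  -- for the pair (xⱼ , yₗ) are the laws of xⱼ and of yₗ.
  PairwiseProduct : (Point → ℝ) → Set
  PairwiseProduct μ = ∀ j l a b → pairMarginal μ j l (a , b) ≈
    coordinateMarginal Ω₁ (marginal₁ μ) j a * coordinateMarginal Ω₂ (marginal₂ μ) l b

  jointExpectation : (L : ℕ) → (Point → ℝ) → (Vec A₁ L → ℝ) → (Vec A₂ L → ℝ) → ℝ
  jointExpectation L μ F G = 𝔼 (∑-Vec ∑₁₂ L) (μ ^⊗ L) λ XY →
    product λ j → F (row j (map proj₁ XY)) * G (row j (map proj₂ XY))

rowsExpectation : (Ω : FiniteSet) (k L : ℕ) → (Vec (Carrier Ω) k → ℝ) → (Vec (Carrier Ω) L → ℝ) → ℝ
rowsExpectation Ω k L p F = 𝔼 (∑-Vec (∑-Vec (∑ Ω) k) L) (p ^⊗ L) λ X →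
  product λ j → F (row j X)

∈[-1,1] : ℝ → Set
∈[-1,1] x = - 1ℝ ≤ x × x ≤ 1ℝ

{-# OPTIONS --safe #-}

-- Replace the columns drawn from μ by columns drawn from μ₁ ⊗ μ₂ one at a time.  With the other
-- columns fixed, a replacement changes the expectation by the covariance of P = ∏ fⱼ(xⱼ) and
-- Q = ∏ gₗ(yₗ).  Expand P and Q to first order around the means of the factors: the constant terms
-- do not contribute to the covariance, the product of the two linear parts has mean zero because
-- each xⱼ is independent of each yₗ, and what remains is dominated by D D′ D′ + D D D′, where D and
-- D′ are the sums of the deviations |fⱼ - E fⱼ| and |gₗ - E gₗ|.  By 2 (s D D′) (t D′) ≤ (s D D′)² +
-- (t D′)² and pairwise independence, 2 s t times the change of column i is at most
-- poly(k) (s² Inf_i F · Inf_i G + t² (Inf_i F + Inf_i G)).  This bound is linear in the expectations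
-- over the columns already treated, so it can be summed over i; finally s → Γ and t → τ.
module Submission where

open import Algebra.Bundles using (CommutativeRing; Semiring)
open import Algebra.Core using (Op₁; Op₂)
import Algebra.Definitions.RawSemiring as RawSemiringDefs
import Algebra.Properties.Semiring.Sum as SemiringSum
import Algebra.Solver.Ring as RingSolver
open import Algebra.Solver.Ring.AlmostCommutativeRing using (fromCommutativeRing; _-Raw-AlmostCommutative⟶_; Induced-equivalence)
open import Algebra.Structures using (IsCommutativeRing)
open import Data.Empty using (⊥-elim)
open import Data.Fin.Base using (Fin; zero; suc)
open import Data.Maybe.Base using (just; nothing)
open import Data.Nat.Base as ℕ using (ℕ; zero; suc)
import Data.Nat.Properties as ℕ
import Data.Nat.Solver as ℕ-Solvers
open import Data.Product.Base using (∃; _×_; _,_; proj₁; proj₂)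
open import Data.Rational.Base as ℚ using (ℚ; 0ℚ; 1ℚ; ½)
import Data.Rational.Properties as ℚ
open import Data.Rational.Solver using (module +-*-Solver)
open import Data.Sum.Base using (inj₁; inj₂)
open import Data.Vec.Base as Vec using (Vec; []; _∷_; insertAt; lookup)
open import Function.Bundles using (Inverse)
open import Level using (0ℓ)
open import Relation.Binary.Bundles using (Preorder)
open import Relation.Binary.Core using (Rel)
open import Relation.Binary.Definitions using (WeaklyDecidable)
open import Relation.Binary.PropositionalEquality as ≡ using (_≡_; _≢_)
import Relation.Binary.Reasoning.Preorder as PreorderReasoning
open import Relation.Nullary.Decidable using (Dec; yes; no)
open import Relation.Nullary.Negation using (¬_)
open import Defs using (fromℕℚ; fromℕℚ-suc)

-- Ordered ℚ-algebras

-- The entries of a column `x` may depend on each other arbitrarily, and so may those of `y`; the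
-- only mixed expectations under control are those of one function of a single `xⱼ` times one
-- function of a single `yₗ`. Every estimate has to end in sums of such products. For squares this
-- works: `D D ≤ k ∑ⱼ (fⱼ - E fⱼ)²`, so `D D D′ D′` is, up to `k²`, a double sum over pairs
-- `(j , l)`. The cubic terms have no such form, and bounding them by products of square roots would
-- leave roots of conditional influences, which do not average over the other columns; the two free
-- weights `s` and `t` avoid the roots. The sign of a constructive real cannot be decided, so the
-- argument runs in an ordered algebra without case distinctions and without division. This is why
-- the factor `2 s t` stays on the left to the end, and why `s` and `t` are taken slightly above `Γ`
-- and `τ`: these may vanish, while cancelling needs a positive lower bound.

record OrderedAlgebra : Set₁ where
  constructor orderedAlgebra
  infix  4 _≈_ _≤_
  infix  8 -_
  infixl 7 _*_
  infixl 6 _+_ _-_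
  field
    K                 : Set
    _≈_ _≤_           : Rel K 0ℓ
    _+_ _*_           : Op₂ K
    -_ ∣_∣            : Op₁ K
    0# 1#             : K
    ⟦_⟧               : ℚ → K
    isCommutativeRing : IsCommutativeRing _≈_ _+_ _*_ -_ 0# 1#
    +-homo            : ∀ p q → ⟦ p ℚ.+ q ⟧ ≈ ⟦ p ⟧ + ⟦ q ⟧
    *-homo            : ∀ p q → ⟦ p ℚ.* q ⟧ ≈ ⟦ p ⟧ * ⟦ q ⟧
    -‿homo            : ∀ p → ⟦ ℚ.- p ⟧ ≈ - ⟦ p ⟧
    0-homo            : ⟦ 0ℚ ⟧ ≈ 0#
    1-homo            : ⟦ 1ℚ ⟧ ≈ 1#
    ⟦⟧-nonneg         : ∀ {q} → 0ℚ ℚ.≤ q → 0# ≤ ⟦ q ⟧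
    ≤-reflexive       : ∀ {x y} → x ≈ y → x ≤ y
    ≤-trans           : ∀ {x y z} → x ≤ y → y ≤ z → x ≤ z
    +-mono-≤          : ∀ {x y u v} → x ≤ y → u ≤ v → x + u ≤ y + v
    *-nonneg          : ∀ {x y} → 0# ≤ x → 0# ≤ y → 0# ≤ x * y
    x≤∣x∣             : ∀ x → x ≤ ∣ x ∣
    -x≤∣x∣            : ∀ x → - x ≤ ∣ x ∣
    ∣∣-lub            : ∀ {x y} → x ≤ y → - x ≤ y → ∣ x ∣ ≤ y
    -- The order is not assumed total, so this cannot be derived by splitting on the sign of `x`. It
    -- is also the source of `0≤x²`.
    ∣x∣²≤x²           : ∀ x → ∣ x ∣ * ∣ x ∣ ≤ x * x

  commutativeRing : CommutativeRing 0ℓ 0ℓ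
  commutativeRing = record { isCommutativeRing = isCommutativeRing }

  open CommutativeRing commutativeRing public
    hiding (Carrier; _≈_; _+_; _*_; -_; _-_; 0#; 1#; isCommutativeRing; zero)

  _-_ : Op₂ K
  x - y = x + - y

  morphism : ℚ.+-*-rawRing -Raw-AlmostCommutative⟶ fromCommutativeRing commutativeRing
  morphism = record
    { ⟦_⟧ = ⟦_⟧ ; +-homo = +-homo ; *-homo = *-homo ; -‿homo = -‿homo ; 0-homo = 0-homo ; 1-homo = 1-homo }

-- For an expectation `E` this is the expectation over `n` independent draws. No weights occur, so
-- the first draw is split off by mere unfolding.
power : {K A : Set} → ((A → K) → K) → (n : ℕ) → (Vec A n → K) → K
power E zero    f = f []
power E (suc n) f = E λ a → power E n λ v → f (a ∷ v)

module OrderedAlgebraTheory (R : OrderedAlgebra) where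

  open OrderedAlgebra R
  open SemiringSum semiring using (sum; sum-cong-≋; ∑-distrib-+; *-distribˡ-sum; *-distribʳ-sum)
  open RawSemiringDefs (Semiring.rawSemiring semiring) using (product)

  private
    _coeff≟_ : WeaklyDecidable (Induced-equivalence morphism)
    p coeff≟ q with p ℚ.≟ q
    ... | yes ≡.refl = just refl
    ... | no  _      = nothing

  open RingSolver ℚ.+-*-rawRing (fromCommutativeRing commutativeRing) morphism _coeff≟_
    using (solve; _:+_; _:*_; _:-_; :-_; _:=_; con)

  ≤-preorder : Preorder 0ℓ 0ℓ 0ℓ
  ≤-preorder = record
    { _≈_ = _≈_ ; _≲_ = _≤_
    ; isPreorder = record { isEquivalence = isEquivalence ; reflexive = ≤-reflexive ; trans = ≤-trans } }

  open PreorderReasoning ≤-preorder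

  ≤-refl : ∀ {x} → x ≤ x
  ≤-refl = ≤-reflexive refl

  0≤y-x : ∀ {x y} → x ≤ y → 0# ≤ y - x
  0≤y-x {x} {y} h = begin
    0#     ≈⟨ -‿inverseʳ x ⟨
    x - x  ≲⟨ +-mono-≤ h ≤-refl ⟩
    y - x  ∎

  x≤y⇐0≤y-x : ∀ {x y} → 0# ≤ y - x → x ≤ y
  x≤y⇐0≤y-x {x} {y} h = begin
    x            ≈⟨ +-identityˡ x ⟨
    0# + x       ≲⟨ +-mono-≤ h ≤-refl ⟩
    (y - x) + x  ≈⟨ solve 2 (λ x y → (y :- x) :+ x := y) refl x y ⟩
    y            ∎

  +-nonneg : ∀ {x y} → 0# ≤ x → 0# ≤ y → 0# ≤ x + y
  +-nonneg h k = ≤-trans (≤-reflexive (sym (+-identityˡ 0#))) (+-mono-≤ h k)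

  *-monoʳ-≤ : ∀ {x y} z → 0# ≤ z → x ≤ y → z * x ≤ z * y
  *-monoʳ-≤ {x} {y} z 0≤z h = x≤y⇐0≤y-x (≤-trans (*-nonneg 0≤z (0≤y-x h))
    (≤-reflexive (solve 3 (λ x y z → z :* (y :- x) := z :* y :- z :* x) refl x y z)))

  *-monoˡ-≤ : ∀ {x y} z → 0# ≤ z → x ≤ y → x * z ≤ y * z
  *-monoˡ-≤ {x} {y} z 0≤z h =
    ≤-trans (≤-reflexive (*-comm x z)) (≤-trans (*-monoʳ-≤ z 0≤z h) (≤-reflexive (*-comm z y)))

  *-mono-≤ : ∀ {x y u v} → 0# ≤ y → 0# ≤ u → x ≤ y → u ≤ v → x * u ≤ y * v
  *-mono-≤ {y = y} {u = u} 0≤y 0≤u h k = ≤-trans (*-monoˡ-≤ u 0≤u h) (*-monoʳ-≤ y 0≤y k)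

  ½*-nonneg : ∀ {x} → 0# ≤ x + x → 0# ≤ x
  ½*-nonneg {x} h = ≤-trans (*-nonneg (⟦⟧-nonneg (ℚ.nonNegative⁻¹ ½)) h)
    (≤-reflexive (solve 1 (λ x → con ½ :* (x :+ x) := x) refl x))

  0≤∣x∣ : ∀ x → 0# ≤ ∣ x ∣
  0≤∣x∣ x = ½*-nonneg (≤-trans (≤-reflexive (sym (-‿inverseʳ x))) (+-mono-≤ (x≤∣x∣ x) (-x≤∣x∣ x)))

  0≤x² : ∀ x → 0# ≤ x * x
  0≤x² x = ≤-trans (*-nonneg (0≤∣x∣ x) (0≤∣x∣ x)) (∣x∣²≤x² x)

  ∣∣-resp-≈ : ∀ {x y} → x ≈ y → ∣ x ∣ ≤ ∣ y ∣
  ∣∣-resp-≈ {x} {y} h = ∣∣-lub (≤-trans (≤-reflexive h) (x≤∣x∣ y)) (≤-trans (≤-reflexive (-‿cong h)) (-x≤∣x∣ y))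

  ∣x+y∣≤∣x∣+∣y∣ : ∀ x y → ∣ x + y ∣ ≤ ∣ x ∣ + ∣ y ∣
  ∣x+y∣≤∣x∣+∣y∣ x y = ∣∣-lub (+-mono-≤ (x≤∣x∣ x) (x≤∣x∣ y))
    (≤-trans (≤-reflexive (solve 2 (λ x y → :- (x :+ y) := :- x :+ :- y) refl x y)) (+-mono-≤ (-x≤∣x∣ x) (-x≤∣x∣ y)))

  ∣x-y∣≤∣x∣+∣y∣ : ∀ x y → ∣ x - y ∣ ≤ ∣ x ∣ + ∣ y ∣
  ∣x-y∣≤∣x∣+∣y∣ x y = ∣∣-lub (+-mono-≤ (x≤∣x∣ x) (-x≤∣x∣ y))
    (≤-trans (≤-reflexive (solve 2 (λ x y → :- (x :- y) := :- x :+ y) refl x y)) (+-mono-≤ (-x≤∣x∣ x) (x≤∣x∣ y)))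

  -- Replaces the sign analysis: `∣ x ∣ ± x` and `∣ y ∣ ± y` are nonnegative, and two suitable
  -- products of them add up to twice the required difference.
  ∣x*y∣≤∣x∣*∣y∣ : ∀ x y → ∣ x * y ∣ ≤ ∣ x ∣ * ∣ y ∣
  ∣x*y∣≤∣x∣*∣y∣ x y = ∣∣-lub
    (x≤y⇐0≤y-x (½*-nonneg (≤-trans
      (+-nonneg (*-nonneg p₊ q₋) (*-nonneg p₋ q₊))
      (≤-reflexive (solve 4 (λ x y a b → (a :- :- x) :* (b :- y) :+ (a :- x) :* (b :- :- y)
         := (a :* b :- x :* y) :+ (a :* b :- x :* y)) refl x y ∣ x ∣ ∣ y ∣)))))
    (x≤y⇐0≤y-x (½*-nonneg (≤-trans
      (+-nonneg (*-nonneg p₊ q₊) (*-nonneg p₋ q₋))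
      (≤-reflexive (solve 4 (λ x y a b → (a :- :- x) :* (b :- :- y) :+ (a :- x) :* (b :- y)
         := (a :* b :- :- (x :* y)) :+ (a :* b :- :- (x :* y))) refl x y ∣ x ∣ ∣ y ∣)))))
    where
    p₋ = 0≤y-x (x≤∣x∣ x)
    p₊ = 0≤y-x (-x≤∣x∣ x)
    q₋ = 0≤y-x (x≤∣x∣ y)
    q₊ = 0≤y-x (-x≤∣x∣ y)

  ∣x*y∣≤ : ∀ {x y a b} → ∣ x ∣ ≤ a → ∣ y ∣ ≤ b → ∣ x * y ∣ ≤ a * b
  ∣x*y∣≤ {x} {y} h k = ≤-trans (∣x*y∣≤∣x∣*∣y∣ x y) (*-mono-≤ (≤-trans (0≤∣x∣ x) h) (0≤∣x∣ y) h k)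

  ∣x+y∣≤ : ∀ {x y a b} → ∣ x ∣ ≤ a → ∣ y ∣ ≤ b → ∣ x + y ∣ ≤ a + b
  ∣x+y∣≤ {x} {y} h k = ≤-trans (∣x+y∣≤∣x∣+∣y∣ x y) (+-mono-≤ h k)

  0≤1 : 0# ≤ 1#
  0≤1 = ≤-trans (⟦⟧-nonneg (ℚ.nonNegative⁻¹ 1ℚ)) (≤-reflexive 1-homo)

  x≤-by-nonneg : ∀ {x y} z → 0# ≤ z → x + z ≈ y → x ≤ y
  x≤-by-nonneg {x} z 0≤z e = ≤-trans (≤-reflexive (sym (+-identityʳ x))) (≤-trans (+-mono-≤ ≤-refl 0≤z) (≤-reflexive e))

  2xy≤x²+y² : ∀ x y → x * y + x * y ≤ x * x + y * y
  2xy≤x²+y² x y = x≤-by-nonneg ((x - y) * (x - y)) (0≤x² (x - y))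
    (solve 2 (λ x y → x :* y :+ x :* y :+ (x :- y) :* (x :- y) := x :* x :+ y :* y) refl x y)

  sum-mono-≤ : ∀ {n} {f g : Fin n → K} → (∀ i → f i ≤ g i) → sum f ≤ sum g
  sum-mono-≤ {zero}  h = ≤-refl
  sum-mono-≤ {suc n} h = +-mono-≤ (h zero) (sum-mono-≤ (λ i → h (suc i)))

  sum-nonneg : ∀ {n} {f : Fin n → K} → (∀ i → 0# ≤ f i) → 0# ≤ sum f
  sum-nonneg {zero}  h = ≤-refl
  sum-nonneg {suc n} h = +-nonneg (h zero) (sum-nonneg (λ i → h (suc i)))

  cardinal : ℕ → K
  cardinal n = ⟦ fromℕℚ n ⟧

  cardinal-suc : ∀ n → cardinal (suc n) ≈ 1# + cardinal n
  cardinal-suc n = trans (reflexive (≡.cong ⟦_⟧ (≡.sym (fromℕℚ-suc n))))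
    (trans (+-homo (fromℕℚ n) 1ℚ) (trans (+-congˡ 1-homo) (+-comm _ _)))

  sum-const : ∀ n c → sum {n} (λ _ → c) ≈ cardinal n * c
  sum-const zero    c = sym (trans (*-congʳ 0-homo) (zeroˡ c))
  sum-const (suc n) c = begin-equality
    c + sum {n} (λ _ → c)  ≈⟨ +-congˡ (sum-const n c) ⟩
    c + cardinal n * c     ≈⟨ +-congʳ (*-identityˡ c) ⟨
    1# * c + cardinal n * c ≈⟨ distribʳ c 1# (cardinal n) ⟨
    (1# + cardinal n) * c  ≈⟨ *-congʳ (cardinal-suc n) ⟨
    cardinal (suc n) * c   ∎

  0≤cardinal : ∀ n → 0# ≤ cardinal n
  0≤cardinal n = ⟦⟧-nonneg (ℚ.nonNegative⁻¹ (fromℕℚ n))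

  2x∑y≤ : ∀ {n} x (y : Fin n → K) →
          x * sum y + x * sum y ≤ cardinal n * (x * x) + sum (λ i → y i * y i)
  2x∑y≤ {n} x y = begin
    x * sum y + x * sum y                       ≈⟨ +-cong (*-distribˡ-sum x y) (*-distribˡ-sum x y) ⟩
    sum (λ i → x * y i) + sum (λ i → x * y i)   ≈⟨ ∑-distrib-+ (λ i → x * y i) (λ i → x * y i) ⟨
    sum (λ i → x * y i + x * y i)               ≲⟨ sum-mono-≤ (λ i → 2xy≤x²+y² x (y i)) ⟩
    sum (λ i → x * x + y i * y i)               ≈⟨ ∑-distrib-+ (λ _ → x * x) (λ i → y i * y i) ⟩
    sum {n} (λ _ → x * x) + sum (λ i → y i * y i) ≈⟨ +-congʳ (sum-const n (x * x)) ⟩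
    cardinal n * (x * x) + sum (λ i → y i * y i) ∎

  -- Cauchy-Schwarz against the constant vector, by induction: `2x∑y≤` turns the cross term of head
  -- and tail into exactly what the coefficient gains in passing from `n` to `suc n`.
  [∑x]²≤n∑x² : ∀ {n} (x : Fin n → K) → sum x * sum x ≤ cardinal n * sum (λ i → x i * x i)
  [∑x]²≤n∑x² {zero}  x = ≤-reflexive (trans (zeroˡ 0#) (sym (zeroʳ _)))
  [∑x]²≤n∑x² {suc n} x = begin
    (a + S) * (a + S)                            ≈⟨ solve 2 (λ a S → (a :+ S) :* (a :+ S) := a :* a :+ (a :* S :+ a :* S) :+ S :* S) refl a S ⟩
    a * a + (a * S + a * S) + S * S              ≲⟨ +-mono-≤ (+-mono-≤ ≤-refl (2x∑y≤ a (λ i → x (suc i)))) ([∑x]²≤n∑x² (λ i → x (suc i))) ⟩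
    -- The constants of the solver are of the form `⟦ q ⟧`, so `1#` is inserted by hand and passed
    -- to it as an atom `e`.
    a * a + (κ * (a * a) + Q) + κ * Q            ≈⟨ +-congʳ (+-cong (*-identityˡ (a * a)) (+-congˡ (*-identityˡ Q))) ⟨
    1# * (a * a) + (κ * (a * a) + 1# * Q) + κ * Q ≈⟨ solve 4 (λ a Q κ e → e :* (a :* a) :+ (κ :* (a :* a) :+ e :* Q) :+ κ :* Q := (e :+ κ) :* (a :* a :+ Q)) refl a Q κ 1# ⟩
    (1# + κ) * (a * a + Q)                       ≈⟨ *-congʳ (cardinal-suc n) ⟨
    cardinal (suc n) * (a * a + Q)               ∎
    where
    a = x zero
    S = sum (λ i → x (suc i))
    Q = sum (λ i → x (suc i) * x (suc i))
    κ = cardinal n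

  ∣product∣≤1 : ∀ {n} (x : Fin n → K) → (∀ i → ∣ x i ∣ ≤ 1#) → ∣ product x ∣ ≤ 1#
  ∣product∣≤1 {zero}  x h = ∣∣-lub ≤-refl (x≤-by-nonneg (1# + 1#) (+-nonneg 0≤1 0≤1)
    (solve 1 (λ e → :- e :+ (e :+ e) := e) refl 1#))
  ∣product∣≤1 {suc n} x h = ≤-trans (∣x*y∣≤ (h zero) (∣product∣≤1 (λ i → x (suc i)) (λ i → h (suc i))))
    (≤-reflexive (*-identityˡ 1#))

  product-* : ∀ {n} (x y : Fin n → K) → product (λ i → x i * y i) ≈ product x * product y
  product-* {zero}  x y = sym (*-identityˡ 1#)
  product-* {suc n} x y = trans (*-congˡ (product-* (λ i → x (suc i)) (λ i → y (suc i))))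
    (solve 4 (λ a b c d → a :* b :* (c :* d) := a :* c :* (b :* d)) refl _ _ _ _)

  -- Products of numbers in [-1, 1]

  deviation : ∀ {n} (u m : Fin n → K) → K
  deviation u m = sum λ j → ∣ u j - m j ∣

  squaredDeviation : ∀ {n} (u m : Fin n → K) → K
  squaredDeviation u m = sum λ j → (u j - m j) * (u j - m j)

  -- The partial derivative of `product` in the `j`-th variable at `m`. The recursion follows that
  -- of `product`, which makes `linearPart-suc` the Leibniz rule.
  productOthers : ∀ {n} → (Fin n → K) → Fin n → K
  productOthers m zero    = product λ j → m (suc j)
  productOthers m (suc j) = m zero * productOthers (λ j → m (suc j)) j

  -- The linear part of the Taylor expansion of u ↦ product u at m.
  linearPart : ∀ {n} (u m : Fin n → K) → K
  linearPart u m = sum λ j → productOthers m j * (u j - m j)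

  remainder : ∀ {n} (u m : Fin n → K) → K
  remainder u m = (product u - product m) - linearPart u m

  0≤deviation : ∀ {n} (u m : Fin n → K) → 0# ≤ deviation u m
  0≤deviation u m = sum-nonneg λ j → 0≤∣x∣ (u j - m j)

  deviation²≤ : ∀ {n} (u m : Fin n → K) → deviation u m * deviation u m ≤ cardinal n * squaredDeviation u m
  deviation²≤ {n} u m = ≤-trans ([∑x]²≤n∑x² (λ j → ∣ u j - m j ∣))
    (*-monoʳ-≤ (cardinal n) (0≤cardinal n) (sum-mono-≤ λ j → ∣x∣²≤x² (u j - m j)))

  ∣Δproduct∣≤deviation : ∀ {n} (u m : Fin n → K) → (∀ j → ∣ u j ∣ ≤ 1#) → (∀ j → ∣ m j ∣ ≤ 1#) →
                         ∣ product u - product m ∣ ≤ deviation u m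
  ∣Δproduct∣≤deviation {zero}  u m hu hm = ∣∣-lub (≤-reflexive (-‿inverseʳ 1#))
    (≤-reflexive (trans (solve 1 (λ e → :- (e :- e) := con 0ℚ) refl 1#) 0-homo))
  ∣Δproduct∣≤deviation {suc n} u m hu hm = begin
    ∣ u zero * P - m zero * M ∣                    ≲⟨ ∣∣-resp-≈ (solve 4 (λ a b P M → a :* P :- b :* M := (a :- b) :* P :+ b :* (P :- M)) refl (u zero) (m zero) P M) ⟩
    ∣ (u zero - m zero) * P + m zero * (P - M) ∣   ≲⟨ ∣x+y∣≤ (∣x*y∣≤ ≤-refl (∣product∣≤1 _ λ j → hu (suc j)))
                                                            (∣x*y∣≤ (hm zero) (∣Δproduct∣≤deviation _ _ (λ j → hu (suc j)) (λ j → hm (suc j)))) ⟩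
    ∣ u zero - m zero ∣ * 1# + 1# * D              ≈⟨ +-cong (*-identityʳ _) (*-identityˡ _) ⟩
    ∣ u zero - m zero ∣ + D                        ∎
    where
    P = product λ j → u (suc j)
    M = product λ j → m (suc j)
    D = deviation (λ j → u (suc j)) (λ j → m (suc j))

  linearPart-suc : ∀ {n} (u m : Fin (suc n) → K) → linearPart u m ≈
    product (λ j → m (suc j)) * (u zero - m zero) + m zero * linearPart (λ j → u (suc j)) (λ j → m (suc j))
  linearPart-suc {n} u m = +-congˡ (trans
    (sum-cong-≋ {n} λ j → *-assoc (m zero) (productOthers (λ j → m (suc j)) j) (u (suc j) - m (suc j)))
    (sym (*-distribˡ-sum (m zero) λ j → productOthers (λ j → m (suc j)) j * (u (suc j) - m (suc j)))))

  ∣linearPart∣≤deviation : ∀ {n} (u m : Fin n → K) → (∀ j → ∣ m j ∣ ≤ 1#) → ∣ linearPart u m ∣ ≤ deviation u m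
  ∣linearPart∣≤deviation {zero}  u m hm = ∣∣-lub ≤-refl
    (x≤-by-nonneg (0# + 0#) (+-nonneg ≤-refl ≤-refl) (solve 1 (λ e → :- e :+ (e :+ e) := e) refl 0#))
  ∣linearPart∣≤deviation {suc n} u m hm = begin
    ∣ linearPart u m ∣                                ≲⟨ ∣∣-resp-≈ (linearPart-suc u m) ⟩
    ∣ M * (u zero - m zero) + m zero * ℓ ∣            ≲⟨ ∣x+y∣≤ (∣x*y∣≤ (∣product∣≤1 _ λ j → hm (suc j)) ≤-refl)
                                                               (∣x*y∣≤ (hm zero) (∣linearPart∣≤deviation _ _ λ j → hm (suc j))) ⟩
    1# * ∣ u zero - m zero ∣ + 1# * D                 ≈⟨ +-cong (*-identityˡ _) (*-identityˡ _) ⟩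
    ∣ u zero - m zero ∣ + D                           ∎
    where
    M = product λ j → m (suc j)
    D = deviation (λ j → u (suc j)) (λ j → m (suc j))
    ℓ = linearPart (λ j → u (suc j)) (λ j → m (suc j))

  -- With `a`, `b` the heads of `u`, `m` and `P`, `M` the products of the tails, the remainder is
  -- `(a - b) (P - M)` plus `b` times the remainder of the tails. By induction this is at most
  -- `d D + D D`, which fits into `(d + D) (d + D)`.
  ∣remainder∣≤deviation² : ∀ {n} (u m : Fin n → K) → (∀ j → ∣ u j ∣ ≤ 1#) → (∀ j → ∣ m j ∣ ≤ 1#) →
                           ∣ remainder u m ∣ ≤ deviation u m * deviation u m
  ∣remainder∣≤deviation² {zero}  u m hu hm = ∣∣-lub
    (≤-reflexive (trans (solve 2 (λ e o → (e :- e) :- o := :- o) refl 1# 0#) (trans -0≈0 (sym (zeroˡ 0#)))))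
    (≤-reflexive (trans (solve 2 (λ e o → :- ((e :- e) :- o) := o) refl 1# 0#) (sym (zeroˡ 0#))))
    where
    -0≈0 : - 0# ≈ 0#
    -0≈0 = trans (sym (+-identityˡ (- 0#))) (-‿inverseʳ 0#)
  ∣remainder∣≤deviation² {suc n} u m hu hm = begin
    ∣ remainder u m ∣                        ≲⟨ ∣∣-resp-≈ (trans (+-congˡ (-‿cong (linearPart-suc u m)))
                                                  (solve 5 (λ a b P M ℓ → (a :* P :- b :* M) :- (M :* (a :- b) :+ b :* ℓ)
                                                    := (a :- b) :* (P :- M) :+ b :* ((P :- M) :- ℓ)) refl (u zero) (m zero) P M ℓ)) ⟩
    ∣ (u zero - m zero) * (P - M) + m zero * ((P - M) - ℓ) ∣
                                             ≲⟨ ∣x+y∣≤ (∣x*y∣≤ ≤-refl (∣Δproduct∣≤deviation _ _ hu′ hm′))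
                                                       (∣x*y∣≤ (hm zero) (∣remainder∣≤deviation² _ _ hu′ hm′)) ⟩
    d * D + 1# * (D * D)                     ≈⟨ +-congˡ (*-identityˡ _) ⟩
    d * D + D * D                            ≲⟨ x≤-by-nonneg (d * (d + D)) (*-nonneg 0≤d (+-nonneg 0≤d (0≤deviation {n} _ _)))
                                                  (solve 2 (λ d D → d :* D :+ D :* D :+ d :* (d :+ D) := (d :+ D) :* (d :+ D)) refl d D) ⟩
    (d + D) * (d + D)                        ∎
    where
    hu′ = λ j → hu (suc j)
    hm′ = λ j → hm (suc j)
    P = product λ j → u (suc j)
    M = product λ j → m (suc j)
    D = deviation (λ j → u (suc j)) (λ j → m (suc j))
    ℓ = linearPart (λ j → u (suc j)) (λ j → m (suc j))
    d = ∣ u zero - m zero ∣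
    0≤d = 0≤∣x∣ (u zero - m zero)

  -- Expectations as linear functionals

  Functional : Set → Set
  Functional A = (A → K) → K

  record IsLinear {A : Set} (E : Functional A) : Set where
    field
      cong    : ∀ {f g} → (∀ a → f a ≈ g a) → E f ≈ E g
      E-+     : ∀ f g → E (λ a → f a + g a) ≈ E f + E g
      E-*ˡ    : ∀ c f → E (λ a → c * f a) ≈ c * E f

    E-*ʳ : ∀ f c → E (λ a → f a * c) ≈ E f * c
    E-*ʳ f c = trans (cong λ a → *-comm (f a) c) (trans (E-*ˡ c f) (*-comm c (E f)))

    E-0 : E (λ _ → 0#) ≈ 0#
    E-0 = trans (cong λ _ → sym (zeroˡ 0#)) (trans (E-*ˡ 0# λ _ → 0#) (zeroˡ _))

    E-neg : ∀ f → E (λ a → - f a) ≈ - E f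
    E-neg f = begin-equality
      E (λ a → - f a)       ≈⟨ cong (λ a → trans (-‿cong (sym (*-identityˡ (f a)))) (-‿distribˡ 1# (f a))) ⟩
      E (λ a → - 1# * f a)  ≈⟨ E-*ˡ (- 1#) f ⟩
      - 1# * E f            ≈⟨ trans (-‿cong (sym (*-identityˡ (E f)))) (-‿distribˡ 1# (E f)) ⟨
      - E f                 ∎
      where
      -‿distribˡ : ∀ x y → - (x * y) ≈ - x * y
      -‿distribˡ x y = solve 2 (λ x y → :- (x :* y) := :- x :* y) refl x y

    E-- : ∀ f g → E (λ a → f a - g a) ≈ E f - E g
    E-- f g = trans (E-+ f (λ a → - g a)) (+-congˡ (E-neg g))

    E-sum : ∀ {n} (f : Fin n → A → K) → E (λ a → sum λ i → f i a) ≈ sum λ i → E (f i)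
    E-sum {zero}  f = E-0
    E-sum {suc n} f = trans (E-+ (f zero) (λ a → sum λ i → f (suc i) a)) (+-congˡ (E-sum λ i → f (suc i)))

  -- `swap` is Fubini in a one-sided form: a finite sum commutes with anything linear, so of the
  -- other functional only linearity is asked. It is the only trace of finiteness that the later
  -- arguments use.
  record IsSummation {A : Set} (E : Functional A) : Set₁ where
    field
      isLinear : IsLinear E
      mono     : ∀ {f g} → (∀ a → f a ≤ g a) → E f ≤ E g
      swap     : ∀ {B : Set} {E′ : Functional B} → IsLinear E′ → (f : B → A → K) →
                 E′ (λ b → E (f b)) ≈ E (λ a → E′ (λ b → f b a))
    open IsLinear isLinear public

    nonneg : ∀ {f} → (∀ a → 0# ≤ f a) → 0# ≤ E f
    nonneg h = ≤-trans (≤-reflexive (sym E-0)) (mono h)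

    ∣E∣≤ : ∀ f → ∣ E f ∣ ≤ E (λ a → ∣ f a ∣)
    ∣E∣≤ f = ∣∣-lub (mono λ a → x≤∣x∣ (f a)) (≤-trans (≤-reflexive (sym (E-neg f))) (mono λ a → -x≤∣x∣ (f a)))

  record IsExpectation {A : Set} (E : Functional A) : Set₁ where
    field
      isSummation : IsSummation E
      E-1         : E (λ _ → 1#) ≈ 1#
    open IsSummation isSummation public

    E-const : ∀ c → E (λ _ → c) ≈ c
    E-const c = begin-equality
      E (λ _ → c)       ≈⟨ cong (λ _ → sym (*-identityʳ c)) ⟩
      E (λ _ → c * 1#)  ≈⟨ E-*ˡ c (λ _ → 1#) ⟩
      c * E (λ _ → 1#)  ≈⟨ *-congˡ E-1 ⟩
      c * 1#            ≈⟨ *-identityʳ c ⟩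
      c                 ∎

    ∣E∣≤c : ∀ {f c} → (∀ a → ∣ f a ∣ ≤ c) → ∣ E f ∣ ≤ c
    ∣E∣≤c {f} {c} h = ≤-trans (∣E∣≤ f) (≤-trans (mono h) (≤-reflexive (E-const c)))

  point-isLinear : ∀ {A : Set} (a : A) → IsLinear (λ f → f a)
  point-isLinear a = record { cong = λ h → h a ; E-+ = λ _ _ → refl ; E-*ˡ = λ _ _ → refl }

  point-isExpectation : ∀ {A : Set} (a : A) → IsExpectation (λ f → f a)
  point-isExpectation a = record
    { isSummation = record { isLinear = point-isLinear a ; mono = λ h → h a ; swap = λ _ _ → refl }
    ; E-1 = refl }

  module _ {A B C : Set} {S : Functional A} {T : Functional B} (φ : A → B → C) where

    -- Taking `_,_` for `φ` gives functionals on pairs, `_∷_` gives functionals on vectors.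
    iterated : Functional C
    iterated f = S λ a → T λ b → f (φ a b)

    iterated-isLinear : IsLinear S → IsLinear T → IsLinear iterated
    iterated-isLinear s t = record
      { cong = λ h → S.cong λ a → T.cong λ b → h (φ a b)
      ; E-+  = λ f g → trans (S.cong λ a → T.E-+ (λ b → f (φ a b)) (λ b → g (φ a b)))
                             (S.E-+ (λ a → T λ b → f (φ a b)) (λ a → T λ b → g (φ a b)))
      ; E-*ˡ = λ c f → trans (S.cong λ a → T.E-*ˡ c (λ b → f (φ a b))) (S.E-*ˡ c (λ a → T λ b → f (φ a b)))
      }
      where
      module S = IsLinear s
      module T = IsLinear t

    iterated-isSummation : IsSummation S → IsSummation T → IsSummation iterated
    iterated-isSummation s t = record
      { isLinear = iterated-isLinear S.isLinear T.isLinear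
      ; mono = λ h → S.mono λ a → T.mono λ b → h (φ a b)
      ; swap = λ ℓ f → trans (S.swap ℓ λ d a → T λ b → f d (φ a b)) (S.cong λ a → T.swap ℓ λ d b → f d (φ a b))
      }
      where
      module S = IsSummation s
      module T = IsSummation t

    iterated-isExpectation : IsExpectation S → IsExpectation T → IsExpectation iterated
    iterated-isExpectation s t = record
      { isSummation = iterated-isSummation S.isSummation T.isSummation
      ; E-1 = trans (S.cong λ _ → T.E-1) S.E-1
      }
      where
      module S = IsExpectation s
      module T = IsExpectation t

  sum-isSummation : ∀ {A : Set} {n} (e : Fin n → A) → IsSummation (λ f → sum λ i → f (e i))
  sum-isSummation {n = n} e = record
    { isLinear = record
      { cong = λ h → sum-cong-≋ {n} λ i → h (e i)
      ; E-+  = λ f g → ∑-distrib-+ (λ i → f (e i)) (λ i → g (e i))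
      ; E-*ˡ = λ c f → sym (*-distribˡ-sum c λ i → f (e i)) }
    ; mono = λ h → sum-mono-≤ λ i → h (e i)
    ; swap = λ ℓ f → IsLinear.E-sum ℓ λ i b → f b (e i) }

  module _ {A : Set} {S : Functional A} (s : IsSummation S) (p : A → K) where
    private module S = IsSummation s

    weighted : Functional A
    weighted f = S λ a → p a * f a

    weighted-isLinear : IsLinear weighted
    weighted-isLinear = record
      { cong = λ h → S.cong λ a → *-congˡ (h a)
      ; E-+  = λ f g → trans (S.cong λ a → distribˡ (p a) (f a) (g a)) (S.E-+ _ _)
      ; E-*ˡ = λ c f → trans
          (S.cong λ a → solve 3 (λ p c x → p :* (c :* x) := c :* (p :* x)) refl (p a) c (f a)) (S.E-*ˡ c _) }

    weighted-isExpectation : (∀ a → 0# ≤ p a) → S p ≈ 1# → IsExpectation weighted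
    weighted-isExpectation 0≤p total = record
      { isSummation = record
        { isLinear = weighted-isLinear
        ; mono = λ h → S.mono λ a → *-monoʳ-≤ (p a) (0≤p a) (h a)
        ; swap = λ ℓ f → trans (S.swap ℓ λ b a → p a * f b a) (S.cong λ a → IsLinear.E-*ˡ ℓ (p a) λ b → f b a) }
      ; E-1 = trans (S.cong λ a → *-identityʳ (p a)) total }

  -- The kernel δ is the indicator of ξ x ≡ b, given by its action on functions.
  pushforward : ∀ {A B : Set} {S : Functional A} {T : Functional B} → IsSummation S → IsSummation T →
    (ξ : A → B) (δ : A → B → K) → (∀ x (h : B → K) → T (λ b → δ x b * h b) ≈ h (ξ x)) →
    (p : A → K) (q : B → K) → (∀ b → S (λ x → δ x b * p x) ≈ q b) →
    ∀ (h : B → K) → S (λ x → p x * h (ξ x)) ≈ T (λ b → q b * h b)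
  pushforward {S = S} {T} s t ξ δ T-δ p q pq h = begin-equality
    S (λ x → p x * h (ξ x))                  ≈⟨ S.cong (λ x → *-congˡ (T-δ x h)) ⟨
    S (λ x → p x * T (λ b → δ x b * h b))    ≈⟨ S.cong (λ x → T.E-*ˡ (p x) λ b → δ x b * h b) ⟨
    S (λ x → T λ b → p x * (δ x b * h b))    ≈⟨ T.swap S.isLinear (λ x b → p x * (δ x b * h b)) ⟩
    T (λ b → S λ x → p x * (δ x b * h b))    ≈⟨ T.cong (λ b → S.cong λ x → solve 3 (λ p d h → p :* (d :* h) := (d :* p) :* h) refl (p x) (δ x b) (h b)) ⟩
    T (λ b → S λ x → (δ x b * p x) * h b)    ≈⟨ T.cong (λ b → trans (S.E-*ʳ (λ x → δ x b * p x) (h b)) (*-congʳ (pq b))) ⟩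
    T (λ b → q b * h b)                      ∎
    where
    module S = IsSummation s
    module T = IsSummation t

  sum-δ : ∀ {n} (i₀ : Fin n) (δ g : Fin n → K) → δ i₀ ≈ 1# → (∀ i → i ≢ i₀ → δ i ≈ 0#) →
          sum (λ i → δ i * g i) ≈ g i₀
  sum-δ {suc n} zero δ g δ≈1 δ≈0 = begin-equality
    δ zero * g zero + sum (λ i → δ (suc i) * g (suc i))
      ≈⟨ +-cong (trans (*-congʳ δ≈1) (*-identityˡ (g zero)))
                (trans (sum-cong-≋ {n} λ i → trans (*-congʳ (δ≈0 (suc i) λ ())) (zeroˡ (g (suc i))))
                       (trans (sum-const n 0#) (zeroʳ _))) ⟩
    g zero + 0#  ≈⟨ +-identityʳ (g zero) ⟩
    g zero       ∎
  sum-δ {suc n} (suc i₀) δ g δ≈1 δ≈0 = begin-equality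
    δ zero * g zero + sum (λ i → δ (suc i) * g (suc i))
      ≈⟨ +-cong (trans (*-congʳ (δ≈0 zero λ ())) (zeroˡ (g zero)))
                (sum-δ i₀ (λ i → δ (suc i)) (λ i → g (suc i)) δ≈1 λ i i≢ → δ≈0 (suc i) λ { ≡.refl → i≢ ≡.refl }) ⟩
    0# + g (suc i₀)  ≈⟨ +-identityˡ (g (suc i₀)) ⟩
    g (suc i₀)       ∎

  -- The inductive step from product weights to iterated expectations: the weight of `a ∷ v`
  -- factors, and the factor of `a` leaves the inner sum.
  weighted-∷ : ∀ {A : Set} {S E : Functional A} {n} {V W : Functional (Vec A n)} → IsLinear S → IsLinear V →
    (p : A → K) (q : Vec A n → K) (r : Vec A (suc n) → K) → (∀ a v → r (a ∷ v) ≈ p a * q v) →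
    (∀ f → S (λ a → p a * f a) ≈ E f) → (∀ f → V (λ v → q v * f v) ≈ W f) →
    ∀ (f : Vec A (suc n) → K) → S (λ a → V λ v → r (a ∷ v) * f (a ∷ v)) ≈ E (λ a → W λ v → f (a ∷ v))
  weighted-∷ {S = S} {V = V} {W} s v p q r r≈ E≈ W≈ f = trans (IsLinear.cong s λ a → begin-equality
    V (λ v → r (a ∷ v) * f (a ∷ v))      ≈⟨ IsLinear.cong v (λ v → trans (*-congʳ (r≈ a v)) (*-assoc _ _ _)) ⟩
    V (λ v → p a * (q v * f (a ∷ v)))    ≈⟨ IsLinear.E-*ˡ v (p a) _ ⟩
    p a * V (λ v → q v * f (a ∷ v))      ≈⟨ *-congˡ (W≈ λ v → f (a ∷ v)) ⟩
    p a * W (λ v → f (a ∷ v))            ∎) (E≈ _)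

  power-cong : ∀ {A : Set} {E : Functional A} → IsLinear E → ∀ n {f g : Vec A n → K} →
               (∀ v → f v ≈ g v) → power E n f ≈ power E n g
  power-cong ℓ zero    h = h []
  power-cong ℓ (suc n) h = IsLinear.cong ℓ λ a → power-cong ℓ n λ v → h (a ∷ v)

  power-isExpectation : ∀ {A : Set} {E : Functional A} → IsExpectation E → ∀ n → IsExpectation (power E n)
  power-isExpectation e zero    = point-isExpectation []
  power-isExpectation e (suc n) = iterated-isExpectation _∷_ e (power-isExpectation e n)

  -- Influences, random vectors and couplings

  Variance : ∀ {B : Set} → Functional B → (B → K) → K
  Variance N f = N λ a → (f a - N f) * (f a - N f)

  Influence : ∀ {B : Set} → Functional B → ∀ {L} → (Vec B L → K) → Fin L → K
  Influence N {suc n} F i = power N n λ x → Variance N λ a → F (insertAt x i a)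

  -- `insertAt` at `suc i` keeps the head in place and `power` draws the head first, so both sides
  -- unfold to the same term. In the induction over columns this turns influences with a frozen
  -- first entry into influences of the whole function.
  Influence-suc : ∀ {B : Set} (N : Functional B) {L} (F : Vec B (suc L) → K) (i : Fin L) →
                  N (λ a → Influence N (λ v → F (a ∷ v)) i) ≡ Influence N F (suc i)
  Influence-suc N {suc n} F i = ≡.refl

  record RandomVector (k : ℕ) (B : Set) : Set₁ where
    field
      Space         : Set
      𝔼             : Functional Space
      isExpectation : IsExpectation 𝔼
      coordinate    : Fin k → Space → B
      law           : Functional B
      marginal      : ∀ j h → 𝔼 (λ x → h (coordinate j x)) ≈ law h
    open IsExpectation isExpectation public

  open RandomVector using (Space; coordinate; law)

  -- A matrix with independent columns is again a random vector with `k` coordinates, namely its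
  -- rows. Hence statements about couplings also apply to a whole block of columns.
  _^_ : ∀ {k B} → RandomVector k B → (L : ℕ) → RandomVector k (Vec B L)
  X ^ L = record
    { 𝔼             = power X.𝔼 L
    ; isExpectation = power-isExpectation X.isExpectation L
    ; coordinate    = λ j → Vec.map (X.coordinate j)
    ; law           = power X.law L
    ; marginal      = rows L
    }
    where
    module X = RandomVector X
    rows : ∀ L j h → power X.𝔼 L (λ M → h (Vec.map (X.coordinate j) M)) ≈ power X.law L h
    rows zero    j h = refl
    rows (suc L) j h = trans (X.cong λ x → rows L j λ v → h (X.coordinate j x ∷ v))
      (X.marginal j λ a → power X.law L λ v → h (a ∷ v))

  record Coupling {k B₁ B₂} (X : RandomVector k B₁) (Y : RandomVector k B₂)
                  (E : Functional (Space X × Space Y)) : Set₁ where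
    module X = RandomVector X
    module Y = RandomVector Y
    field
      isExpectation : IsExpectation E
      first         : ∀ f → E (λ z → f (proj₁ z)) ≈ X.𝔼 f
      second        : ∀ g → E (λ z → g (proj₂ z)) ≈ Y.𝔼 g
      independent   : ∀ j l f g → E (λ z → f (X.coordinate j (proj₁ z)) * g (Y.coordinate l (proj₂ z))) ≈ X.law f * Y.law g
    open IsExpectation isExpectation public

    marginal₁ : ∀ j h → E (λ z → h (X.coordinate j (proj₁ z))) ≈ X.law h
    marginal₁ j h = trans (first _) (X.marginal j h)

    marginal₂ : ∀ j h → E (λ z → h (Y.coordinate j (proj₂ z))) ≈ Y.law h
    marginal₂ j h = trans (second _) (Y.marginal j h)

    -- The one place where `independent` is used: expanding the product of sums leaves only terms
    -- that involve a single `xⱼ` and a single `yₗ`. It serves twice, for the product of the linear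
    -- parts and for the product of the squared deviations.
    E-sum*sum : ∀ (α : Fin k → B₁ → K) (β : Fin k → B₂ → K) →
      E (λ z → sum (λ j → α j (X.coordinate j (proj₁ z))) * sum (λ l → β l (Y.coordinate l (proj₂ z)))) ≈
      sum (λ j → X.law (α j)) * sum (λ l → Y.law (β l))
    E-sum*sum α β = begin-equality
      E (λ z → sum (a z) * sum (b z))                          ≈⟨ cong (λ z → trans (*-distribʳ-sum (sum (b z)) (a z)) (sum-cong-≋ {k} λ j → *-distribˡ-sum (a z j) (b z))) ⟩
      E (λ z → sum λ j → sum λ l → a z j * b z l)              ≈⟨ E-sum (λ j z → sum λ l → a z j * b z l) ⟩
      sum (λ j → E λ z → sum λ l → a z j * b z l)              ≈⟨ sum-cong-≋ {k} (λ j → E-sum λ l z → a z j * b z l) ⟩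
      sum (λ j → sum λ l → E λ z → a z j * b z l)              ≈⟨ sum-cong-≋ {k} (λ j → sum-cong-≋ {k} λ l → independent j l (α j) (β l)) ⟩
      sum (λ j → sum λ l → X.law (α j) * Y.law (β l))          ≈⟨ sum-cong-≋ {k} (λ j → *-distribˡ-sum (X.law (α j)) λ l → Y.law (β l)) ⟨
      sum (λ j → X.law (α j) * sum (λ l → Y.law (β l)))        ≈⟨ *-distribʳ-sum (sum λ l → Y.law (β l)) (λ j → X.law (α j)) ⟨
      sum (λ j → X.law (α j)) * sum (λ l → Y.law (β l))        ∎
      where
      a = λ z j → α j (X.coordinate j (proj₁ z))
      b = λ z l → β l (Y.coordinate l (proj₂ z))

    E-sum₁ : ∀ (α : Fin k → B₁ → K) → E (λ z → sum λ j → α j (X.coordinate j (proj₁ z))) ≈ sum λ j → X.law (α j)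
    E-sum₁ α = trans (E-sum λ j z → α j (X.coordinate j (proj₁ z))) (sum-cong-≋ {k} λ j → marginal₁ j (α j))

    E-sum₂ : ∀ (β : Fin k → B₂ → K) → E (λ z → sum λ l → β l (Y.coordinate l (proj₂ z))) ≈ sum λ l → Y.law (β l)
    E-sum₂ β = trans (E-sum λ l z → β l (Y.coordinate l (proj₂ z))) (sum-cong-≋ {k} λ l → marginal₂ l (β l))

  _⊗_ : ∀ {k B₁ B₂} (X : RandomVector k B₁) (Y : RandomVector k B₂) → Functional (Space X × Space Y)
  (X ⊗ Y) f = RandomVector.𝔼 X λ x → RandomVector.𝔼 Y λ y → f (x , y)

  ⊗-* : ∀ {k B₁ B₂} (X : RandomVector k B₁) (Y : RandomVector k B₂) f g →
        (X ⊗ Y) (λ z → f (proj₁ z) * g (proj₂ z)) ≈ RandomVector.𝔼 X f * RandomVector.𝔼 Y g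
  ⊗-* X Y f g = trans (X.cong λ x → Y.E-*ˡ (f x) g) (X.E-*ʳ f (Y.𝔼 g))
    where
    module X = RandomVector X
    module Y = RandomVector Y

  ⊗-coupling : ∀ {k B₁ B₂} (X : RandomVector k B₁) (Y : RandomVector k B₂) → Coupling X Y (X ⊗ Y)
  ⊗-coupling X Y = record
    { isExpectation = iterated-isExpectation _,_ X.isExpectation Y.isExpectation
    ; first         = λ f → X.cong λ x → Y.E-const (f x)
    ; second        = λ g → X.E-const (Y.𝔼 g)
    ; independent   = λ j l f g → trans (⊗-* X Y _ _) (*-cong (X.marginal j f) (Y.marginal l g))
    }
    where
    module X = RandomVector X
    module Y = RandomVector Y

  -- Each row has its own function: once a column is fixed, the function of row `j` is restricted at
  -- the `j`-th entry of that column, so the induction over columns leaves the case of a common `F`.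
  jointExpectation : ∀ {k B₁ B₂} (X : RandomVector k B₁) (Y : RandomVector k B₂) → Functional (Space X × Space Y) →
                     ∀ L → (Fin k → Vec B₁ L → K) → (Fin k → Vec B₂ L → K) → K
  jointExpectation X Y E L F G = power E L λ Z →
    product λ j → F j (Vec.map (coordinate X j) (Vec.map proj₁ Z)) * G j (Vec.map (coordinate Y j) (Vec.map proj₂ Z))

  -- The passage from point masses to functionals. The kernels `δ₁`, `δ₂` stand for indicators of
  -- the value of a coordinate; through `pushforward`, the identities between point masses become
  -- the fields `marginal` and `independent` for arbitrary functions.
  module Joint {k : ℕ} {P₁ P₂ B₁ B₂ : Set}
    {S₁ : Functional P₁} {S₂ : Functional P₂} {T₁ : Functional B₁} {T₂ : Functional B₂}
    (s₁ : IsSummation S₁) (s₂ : IsSummation S₂) (t₁ : IsSummation T₁) (t₂ : IsSummation T₂)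
    (ξ : Fin k → P₁ → B₁) (δ₁ : Fin k → P₁ → B₁ → K)
    (T-δ₁ : ∀ j x (h : B₁ → K) → T₁ (λ a → δ₁ j x a * h a) ≈ h (ξ j x))
    (η : Fin k → P₂ → B₂) (δ₂ : Fin k → P₂ → B₂ → K)
    (T-δ₂ : ∀ l y (h : B₂ → K) → T₂ (λ b → δ₂ l y b * h b) ≈ h (η l y))
    (μ : P₁ × P₂ → K) (0≤μ : ∀ z → 0# ≤ μ z) (total : S₁ (λ x → S₂ λ y → μ (x , y)) ≈ 1#)
    (ν₁ : B₁ → K) (ν₁-law : ∀ j a → S₁ (λ x → δ₁ j x a * S₂ (λ y → μ (x , y))) ≈ ν₁ a)
    (ν₂ : B₂ → K) (ν₂-law : ∀ l b → S₂ (λ y → δ₂ l y b * S₁ (λ x → μ (x , y))) ≈ ν₂ b)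
    (pairs : ∀ j l a b → S₁ (λ x → S₂ λ y → (δ₁ j x a * δ₂ l y b) * μ (x , y)) ≈ ν₁ a * ν₂ b)
    where

    private
      module S₁ = IsSummation s₁
      module S₂ = IsSummation s₂
      module T₁ = IsSummation t₁
      module T₂ = IsSummation t₂

    μ₁ : P₁ → K
    μ₁ x = S₂ λ y → μ (x , y)

    μ₂ : P₂ → K
    μ₂ y = S₁ λ x → μ (x , y)

    X : RandomVector k B₁
    X = record
      { 𝔼             = λ f → S₁ λ x → μ₁ x * f x
      ; isExpectation = weighted-isExpectation s₁ μ₁ (λ x → S₂.nonneg λ y → 0≤μ (x , y)) total
      ; coordinate    = ξ
      ; law           = λ h → T₁ λ a → ν₁ a * h a
      ; marginal      = λ j → pushforward s₁ t₁ (ξ j) (δ₁ j) (T-δ₁ j) μ₁ ν₁ (ν₁-law j)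
      }

    Y : RandomVector k B₂
    Y = record
      { 𝔼             = λ g → S₂ λ y → μ₂ y * g y
      ; isExpectation = weighted-isExpectation s₂ μ₂ (λ y → S₁.nonneg λ x → 0≤μ (x , y))
                          (trans (S₁.swap S₂.isLinear λ y x → μ (x , y)) total)
      ; coordinate    = η
      ; law           = λ h → T₂ λ b → ν₂ b * h b
      ; marginal      = λ l → pushforward s₂ t₂ (η l) (δ₂ l) (T-δ₂ l) μ₂ ν₂ (ν₂-law l)
      }

    joint : Functional (P₁ × P₂)
    joint f = S₁ λ x → S₂ λ y → μ (x , y) * f (x , y)

    private
      δ-pair : ∀ j l z (h : B₁ × B₂ → K) →
        T₁ (λ a → T₂ λ b → (δ₁ j (proj₁ z) a * δ₂ l (proj₂ z) b) * h (a , b)) ≈ h (ξ j (proj₁ z) , η l (proj₂ z))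
      δ-pair j l (x , y) h = begin-equality
        T₁ (λ a → T₂ λ b → (δ₁ j x a * δ₂ l y b) * h (a , b))   ≈⟨ T₁.cong (λ a → T₂.cong λ b → *-assoc (δ₁ j x a) (δ₂ l y b) (h (a , b))) ⟩
        T₁ (λ a → T₂ λ b → δ₁ j x a * (δ₂ l y b * h (a , b)))   ≈⟨ T₁.cong (λ a → T₂.E-*ˡ (δ₁ j x a) λ b → δ₂ l y b * h (a , b)) ⟩
        T₁ (λ a → δ₁ j x a * T₂ (λ b → δ₂ l y b * h (a , b)))   ≈⟨ T-δ₁ j x (λ a → T₂ λ b → δ₂ l y b * h (a , b)) ⟩
        T₂ (λ b → δ₂ l y b * h (ξ j x , b))                     ≈⟨ T-δ₂ l y (λ b → h (ξ j x , b)) ⟩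
        h (ξ j x , η l y)                                       ∎

      split : ∀ (f : B₁ → K) (g : B₂ → K) → T₁ (λ a → T₂ λ b → (ν₁ a * ν₂ b) * (f a * g b)) ≈ T₁ (λ a → ν₁ a * f a) * T₂ (λ b → ν₂ b * g b)
      split f g = begin-equality
        T₁ (λ a → T₂ λ b → (ν₁ a * ν₂ b) * (f a * g b))    ≈⟨ T₁.cong (λ a → T₂.cong λ b → solve 4 (λ p q x y → (p :* q) :* (x :* y) := (p :* x) :* (q :* y)) refl (ν₁ a) (ν₂ b) (f a) (g b)) ⟩
        T₁ (λ a → T₂ λ b → (ν₁ a * f a) * (ν₂ b * g b))    ≈⟨ T₁.cong (λ a → T₂.E-*ˡ (ν₁ a * f a) λ b → ν₂ b * g b) ⟩
        T₁ (λ a → (ν₁ a * f a) * T₂ (λ b → ν₂ b * g b))    ≈⟨ T₁.E-*ʳ (λ a → ν₁ a * f a) _ ⟩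
        T₁ (λ a → ν₁ a * f a) * T₂ (λ b → ν₂ b * g b)      ∎

    coupling : Coupling X Y joint
    coupling = record
      { isExpectation = weighted-isExpectation (iterated-isSummation _,_ s₁ s₂) μ 0≤μ total
      ; first         = λ f → S₁.cong λ x → S₂.E-*ʳ (λ y → μ (x , y)) (f x)
      ; second        = λ g → trans (S₂.swap S₁.isLinear λ x y → μ (x , y) * g y)
                                    (S₂.cong λ y → S₁.E-*ʳ (λ x → μ (x , y)) (g y))
      ; independent   = λ j l f g → trans
          (pushforward (iterated-isSummation _,_ s₁ s₂) (iterated-isSummation _,_ t₁ t₂)
            (λ z → ξ j (proj₁ z) , η l (proj₂ z)) (λ z c → δ₁ j (proj₁ z) (proj₁ c) * δ₂ l (proj₂ z) (proj₂ c))
            (δ-pair j l) μ (λ c → ν₁ (proj₁ c) * ν₂ (proj₂ c)) (λ c → pairs j l (proj₁ c) (proj₂ c))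
            (λ c → f (proj₁ c) * g (proj₂ c)))
          (split f g)
      }

  -- The effect of decoupling one column, then of all columns

  module _ {k : ℕ} {B : Set} (X : RandomVector k B) where
    private module X = RandomVector X

    -- `law` is a bare functional and inherits its properties from `𝔼` by way of a coordinate; `j`
    -- supplies that coordinate.
    ∣law∣≤ : ∀ (j : Fin k) {f c} → (∀ a → ∣ f a ∣ ≤ c) → ∣ X.law f ∣ ≤ c
    ∣law∣≤ j {f} h = ≤-trans (∣∣-resp-≈ (sym (X.marginal j f))) (X.∣E∣≤c λ x → h (X.coordinate j x))

    law-centred : ∀ (j : Fin k) c f → X.law (λ a → c * (f a - X.law f)) ≈ 0#
    law-centred j c f = begin-equality
      X.law (λ a → c * (f a - X.law f))                   ≈⟨ X.marginal j _ ⟨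
      X.𝔼 (λ x → c * (f (X.coordinate j x) - X.law f))    ≈⟨ X.E-*ˡ c _ ⟩
      c * X.𝔼 (λ x → f (X.coordinate j x) - X.law f)      ≈⟨ *-congˡ (X.E-- _ _) ⟩
      c * (X.𝔼 (λ x → f (X.coordinate j x)) - X.𝔼 (λ _ → X.law f))
                                                          ≈⟨ *-congˡ (+-cong (X.marginal j f) (-‿cong (X.E-const _))) ⟩
      c * (X.law f - X.law f)                             ≈⟨ *-congˡ (-‿inverseʳ _) ⟩
      c * 0#                                              ≈⟨ zeroʳ c ⟩
      0#                                                  ∎

    rowProduct : (Fin k → B → K) → X.Space → K
    rowProduct f x = product λ j → f j (X.coordinate j x)

    lawProduct : (Fin k → B → K) → K
    lawProduct f = product λ j → X.law (f j)

    totalVariance : (Fin k → B → K) → K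
    totalVariance f = sum λ j → Variance X.law (f j)

  -- The parameters s and t of the weighted inequality 2 (s x) (t y) ≤ (s x)² + (t y)² are kept free,
  -- so that the error stays linear in expectations; they are optimised at the very end.
  module Bound (s t : K) (0≤s : 0# ≤ s) (0≤t : 0# ≤ t) where

    2st : K
    2st = s * t + s * t

    0≤2st : 0# ≤ 2st
    0≤2st = +-nonneg (*-nonneg 0≤s 0≤t) (*-nonneg 0≤s 0≤t)

    -- `U` and `V` enter only through `U * V` and `U + V`, whose expectations are known, so
    -- `E-bound` is an equality. The weights are balanced: summed over the columns, `U * V` will be
    -- of order `t * t` and `U + V` of order `s * s`, so that both summands are of order
    -- `(s * t) * (s * t)`.
    bound : ℕ → K → K → K
    bound k U V = (s * s + s * s) * ((cardinal k * cardinal k) * (U * V)) + (t * t) * (cardinal k * (U + V))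

    bound-cong : ∀ k {U U′ V V′} → U ≈ U′ → V ≈ V′ → bound k U V ≈ bound k U′ V′
    bound-cong k p q = +-cong (*-congˡ (*-congˡ (*-cong p q))) (*-congˡ (*-congˡ (+-cong p q)))

    young : ∀ k {D D′ U V Z} → D * D ≤ cardinal k * U → D′ * D′ ≤ cardinal k * V →
            ∣ Z ∣ ≤ D * (D′ * D′) + (D * D) * D′ → 2st * ∣ Z ∣ ≤ bound k U V
    young k {D} {D′} {U} {V} {Z} hD hD′ hZ = begin
      2st * ∣ Z ∣                                ≲⟨ *-monoʳ-≤ 2st 0≤2st hZ ⟩
      2st * (D * (D′ * D′) + (D * D) * D′)       ≈⟨ solve 4 (λ s t D D′ → (s :* t :+ s :* t) :* (D :* (D′ :* D′) :+ (D :* D) :* D′)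
                                                      := ((s :* (D :* D′)) :* (t :* D′) :+ (s :* (D :* D′)) :* (t :* D′))
                                                      :+ ((s :* (D :* D′)) :* (t :* D) :+ (s :* (D :* D′)) :* (t :* D))) refl s t D D′ ⟩
      (x * (t * D′) + x * (t * D′)) + (x * (t * D) + x * (t * D))
                                                 ≲⟨ +-mono-≤ (2xy≤x²+y² x (t * D′)) (2xy≤x²+y² x (t * D)) ⟩
      (x * x + (t * D′) * (t * D′)) + (x * x + (t * D) * (t * D))
                                                 ≈⟨ solve 4 (λ s t D D′ → ((s :* (D :* D′)) :* (s :* (D :* D′)) :+ (t :* D′) :* (t :* D′))
                                                      :+ ((s :* (D :* D′)) :* (s :* (D :* D′)) :+ (t :* D) :* (t :* D))
                                                      := (s :* s :+ s :* s) :* ((D :* D) :* (D′ :* D′)) :+ (t :* t) :* (D :* D :+ D′ :* D′)) refl s t D D′ ⟩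
      (s * s + s * s) * ((D * D) * (D′ * D′)) + (t * t) * (D * D + D′ * D′)
                                                 ≲⟨ +-mono-≤
                                                      (*-monoʳ-≤ _ (+-nonneg (0≤x² s) (0≤x² s))
                                                        (*-mono-≤ (≤-trans (0≤x² D) hD) (0≤x² D′) hD hD′))
                                                      (*-monoʳ-≤ _ (0≤x² t) (+-mono-≤ hD hD′)) ⟩
      (s * s + s * s) * ((κ * U) * (κ * V)) + (t * t) * (κ * U + κ * V)
                                                 ≈⟨ solve 5 (λ a b κ U V → a :* ((κ :* U) :* (κ :* V)) :+ b :* (κ :* U :+ κ :* V)
                                                      := a :* ((κ :* κ) :* (U :* V)) :+ b :* (κ :* (U :+ V))) refl (s * s + s * s) (t * t) κ U V ⟩
      bound k U V                                ∎
      where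
      x = s * (D * D′)
      κ = cardinal k

    module _ {k : ℕ} {B₁ B₂ : Set} {X : RandomVector k B₁} {Y : RandomVector k B₂}
             {E : Functional (Space X × Space Y)} (c : Coupling X Y E) where
      open Coupling c

      E-bound : ∀ (α : Fin k → B₁ → K) (β : Fin k → B₂ → K) →
        E (λ z → bound k (sum λ j → α j (X.coordinate j (proj₁ z))) (sum λ l → β l (Y.coordinate l (proj₂ z)))) ≈
        bound k (sum λ j → X.law (α j)) (sum λ l → Y.law (β l))
      E-bound α β = trans (E-+ _ _) (+-cong
        (trans (E-*ˡ _ _) (*-congˡ (trans (E-*ˡ _ _) (*-congˡ (E-sum*sum α β)))))
        (trans (E-*ˡ _ _) (*-congˡ (trans (E-*ˡ _ _) (*-congˡ (trans (E-+ _ _) (+-cong (E-sum₁ α) (E-sum₂ β))))))))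

      module _ (f : Fin k → B₁ → K) (g : Fin k → B₂ → K)
               (∣f∣≤1 : ∀ j a → ∣ f j a ∣ ≤ 1#) (∣g∣≤1 : ∀ l b → ∣ g l b ∣ ≤ 1#) where

        -- The products of the linear parts have mean zero by independence of each pair of
        -- coordinates; every other term is of degree at least three in the deviations.
        centred-bound :
          2st * ∣ E (λ z → (rowProduct X f (proj₁ z) - lawProduct X f) * (rowProduct Y g (proj₂ z) - lawProduct Y g)) ∣ ≤
          bound k (totalVariance X f) (totalVariance Y g)
        centred-bound = begin
          2st * ∣ E (λ z → a z * b z) ∣                     ≲⟨ *-monoʳ-≤ 2st 0≤2st (∣∣-resp-≈ E-Z) ⟩
          2st * ∣ E Z ∣                                     ≲⟨ *-monoʳ-≤ 2st 0≤2st (∣E∣≤ Z) ⟩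
          2st * E (λ z → ∣ Z z ∣)                           ≈⟨ E-*ˡ 2st _ ⟨
          E (λ z → 2st * ∣ Z z ∣)                           ≲⟨ mono (λ z → young k (deviation²≤ (u z) m) (deviation²≤ (v z) n) (∣Z∣≤ z)) ⟩
          E (λ z → bound k (squaredDeviation (u z) m) (squaredDeviation (v z) n))
                                                            ≈⟨ E-bound (λ j a → (f j a - m j) * (f j a - m j)) (λ l b → (g l b - n l) * (g l b - n l)) ⟩
          bound k (totalVariance X f) (totalVariance Y g)   ∎
          where
          m = λ j → X.law (f j)
          n = λ l → Y.law (g l)
          u = λ (z : X.Space × Y.Space) j → f j (X.coordinate j (proj₁ z))
          v = λ (z : X.Space × Y.Space) l → g l (Y.coordinate l (proj₂ z))
          a = λ z → product (u z) - product m
          b = λ z → product (v z) - product n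
          ℓ = λ z → linearPart (u z) m
          ℓ′ = λ z → linearPart (v z) n
          -- This is `a b - ℓ ℓ′`, split so that each summand has one factor of second order and one
          -- of first order; keeping `b` whole in the second summand avoids a product of two
          -- remainders.
          Z = λ z → ℓ z * remainder (v z) n + remainder (u z) m * b z
          ∣m∣≤1 : ∀ j → ∣ m j ∣ ≤ 1#
          ∣m∣≤1 j = ∣law∣≤ X j (∣f∣≤1 j)
          ∣n∣≤1 : ∀ l → ∣ n l ∣ ≤ 1#
          ∣n∣≤1 l = ∣law∣≤ Y l (∣g∣≤1 l)
          E-ℓℓ′ : E (λ z → ℓ z * ℓ′ z) ≈ 0#
          E-ℓℓ′ = begin-equality
            E (λ z → ℓ z * ℓ′ z)            ≈⟨ E-sum*sum (λ j a → productOthers m j * (f j a - m j)) (λ l b → productOthers n l * (g l b - n l)) ⟩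
            sum (λ j → X.law (λ a → productOthers m j * (f j a - m j))) * S
                                            ≈⟨ *-congʳ (sum-cong-≋ {k} λ j → law-centred X j (productOthers m j) (f j)) ⟩
            sum {k} (λ _ → 0#) * S          ≈⟨ *-congʳ (trans (sum-const k 0#) (zeroʳ _)) ⟩
            0# * S                          ≈⟨ zeroˡ S ⟩
            0#                              ∎
            where S = sum λ l → Y.law (λ b → productOthers n l * (g l b - n l))
          E-Z : E (λ z → a z * b z) ≈ E Z
          E-Z = begin-equality
            E (λ z → a z * b z)              ≈⟨ cong (λ z → solve 4 (λ a b ℓ ℓ′ → a :* b := ℓ :* ℓ′ :+ (ℓ :* (b :- ℓ′) :+ (a :- ℓ) :* b)) refl (a z) (b z) (ℓ z) (ℓ′ z)) ⟩
            E (λ z → ℓ z * ℓ′ z + Z z)       ≈⟨ E-+ _ _ ⟩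
            E (λ z → ℓ z * ℓ′ z) + E Z       ≈⟨ +-congʳ E-ℓℓ′ ⟩
            0# + E Z                         ≈⟨ +-identityˡ _ ⟩
            E Z                              ∎
          ∣Z∣≤ : ∀ z → ∣ Z z ∣ ≤ deviation (u z) m * (deviation (v z) n * deviation (v z) n)
                                + (deviation (u z) m * deviation (u z) m) * deviation (v z) n
          ∣Z∣≤ z = ∣x+y∣≤
            (∣x*y∣≤ (∣linearPart∣≤deviation (u z) m ∣m∣≤1) (∣remainder∣≤deviation² (v z) n (λ l → ∣g∣≤1 l _) ∣n∣≤1))
            (∣x*y∣≤ (∣remainder∣≤deviation² (u z) m (λ j → ∣f∣≤1 j _) ∣m∣≤1) (∣Δproduct∣≤deviation (v z) n (λ l → ∣g∣≤1 l _) ∣n∣≤1))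

      -- The correction term depends on the two marginals only, so it is the same for every coupling
      -- of `X` and `Y`.
      E-centre : ∀ P Q M N → E (λ z → (P (proj₁ z) - M) * (Q (proj₂ z) - N)) ≈
        E (λ z → P (proj₁ z) * Q (proj₂ z)) + ((- N * X.𝔼 P + - M * Y.𝔼 Q) + M * N)
      E-centre P Q M N = begin-equality
        E (λ z → (P (proj₁ z) - M) * (Q (proj₂ z) - N))
          ≈⟨ cong (λ z → solve 4 (λ p q M N → (p :- M) :* (q :- N) := p :* q :+ ((:- N :* p :+ :- M :* q) :+ M :* N)) refl (P (proj₁ z)) (Q (proj₂ z)) M N) ⟩
        E (λ z → P (proj₁ z) * Q (proj₂ z) + ((- N * P (proj₁ z) + - M * Q (proj₂ z)) + M * N))
          ≈⟨ trans (E-+ _ _) (+-congˡ (trans (E-+ _ _) (+-cong (trans (E-+ _ _) (+-cong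
               (trans (E-*ˡ _ _) (*-congˡ (first P))) (trans (E-*ˡ _ _) (*-congˡ (second Q))))) (E-const _)))) ⟩
        E (λ z → P (proj₁ z) * Q (proj₂ z)) + ((- N * X.𝔼 P + - M * Y.𝔼 Q) + M * N) ∎

    module _ {k : ℕ} {B₁ B₂ : Set} {X : RandomVector k B₁} {Y : RandomVector k B₂}
             {E : Functional (Space X × Space Y)} (c : Coupling X Y E) where
      open Coupling c

      -- `M` and `N` are products of means and in general differ from the means of `P` and `Q`,
      -- because the coordinates of `X` may be dependent. Thus `E cent` is not yet the covariance,
      -- but its excess equals `(X ⊗ Y) cent`. The product coupling satisfies `centred-bound` as
      -- well, whence the doubled bound.
      covariance-bound : ∀ (f : Fin k → B₁ → K) (g : Fin k → B₂ → K) →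
        (∀ j a → ∣ f j a ∣ ≤ 1#) → (∀ l b → ∣ g l b ∣ ≤ 1#) →
        2st * ∣ E (λ z → rowProduct X f (proj₁ z) * rowProduct Y g (proj₂ z)) - X.𝔼 (rowProduct X f) * Y.𝔼 (rowProduct Y g) ∣ ≤
        bound k (totalVariance X f) (totalVariance Y g) + bound k (totalVariance X f) (totalVariance Y g)
      covariance-bound f g ∣f∣≤1 ∣g∣≤1 = begin
        2st * ∣ E PQ - X.𝔼 P * Y.𝔼 Q ∣             ≲⟨ *-monoʳ-≤ 2st 0≤2st (∣∣-resp-≈ expand) ⟩
        2st * ∣ E cent - (X ⊗ Y) cent ∣            ≲⟨ *-monoʳ-≤ 2st 0≤2st (∣x-y∣≤∣x∣+∣y∣ _ _) ⟩
        2st * (∣ E cent ∣ + ∣ (X ⊗ Y) cent ∣)      ≈⟨ distribˡ _ _ _ ⟩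
        2st * ∣ E cent ∣ + 2st * ∣ (X ⊗ Y) cent ∣  ≲⟨ +-mono-≤ (centred-bound c f g ∣f∣≤1 ∣g∣≤1) (centred-bound (⊗-coupling X Y) f g ∣f∣≤1 ∣g∣≤1) ⟩
        bound k U V + bound k U V                  ∎
        where
        P = rowProduct X f
        Q = rowProduct Y g
        PQ = λ (z : X.Space × Y.Space) → P (proj₁ z) * Q (proj₂ z)
        M = lawProduct X f
        N = lawProduct Y g
        U = totalVariance X f
        V = totalVariance Y g
        cent = λ (z : X.Space × Y.Space) → (P (proj₁ z) - M) * (Q (proj₂ z) - N)
        C = (- N * X.𝔼 P + - M * Y.𝔼 Q) + M * N
        expand : E PQ - X.𝔼 P * Y.𝔼 Q ≈ E cent - (X ⊗ Y) cent
        expand = begin-equality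
          E PQ - X.𝔼 P * Y.𝔼 Q               ≈⟨ solve 3 (λ a b C → a :- b := (a :+ C) :- (b :+ C)) refl (E PQ) (X.𝔼 P * Y.𝔼 Q) C ⟩
          (E PQ + C) - (X.𝔼 P * Y.𝔼 Q + C)   ≈⟨ +-cong (E-centre c P Q M N) (-‿cong (trans (E-centre (⊗-coupling X Y) P Q M N) (+-congʳ (⊗-* X Y P Q)))) ⟨
          E cent - (X ⊗ Y) cent              ∎

      totalInfluence : ∀ {B L} → Functional B → (Fin k → Vec B L → K) → Fin L → K
      totalInfluence N F i = sum λ j → Influence N (F j) i

      error : ∀ {L} → (Fin k → Vec B₁ L → K) → (Fin k → Vec B₂ L → K) → Fin L → K
      error F G i = bound k (totalInfluence X.law F i) (totalInfluence Y.law G i)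
                  + bound k (totalInfluence X.law F i) (totalInfluence Y.law G i)

      -- Columns are decoupled one at a time, the first one last.
      decoupling : ∀ L (F : Fin k → Vec B₁ L → K) (G : Fin k → Vec B₂ L → K) →
        (∀ j v → ∣ F j v ∣ ≤ 1#) → (∀ l v → ∣ G l v ∣ ≤ 1#) →
        2st * ∣ jointExpectation X Y E L F G - RandomVector.𝔼 (X ^ L) (rowProduct (X ^ L) F) * RandomVector.𝔼 (Y ^ L) (rowProduct (Y ^ L) G) ∣ ≤
        sum (error F G)
      decoupling zero F G ∣F∣≤1 ∣G∣≤1 = begin
        2st * ∣ product (λ j → F j [] * G j []) - PF * PG ∣  ≲⟨ *-monoʳ-≤ 2st 0≤2st (∣∣-lub
          (≤-reflexive (trans (+-congʳ (product-* {k} (λ j → F j []) (λ j → G j []))) (-‿inverseʳ _)))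
          (≤-reflexive (trans (-‿cong (+-congʳ (product-* {k} (λ j → F j []) (λ j → G j []))))
            (trans (solve 1 (λ x → :- (x :- x) := con 0ℚ) refl (PF * PG)) 0-homo)))) ⟩
        2st * 0#                                             ≈⟨ zeroʳ 2st ⟩
        0#                                                   ∎
        where
        PF = product λ j → F j []
        PG = product λ j → G j []
      decoupling (suc L) F G ∣F∣≤1 ∣G∣≤1 = begin
        2st * ∣ E A - RX * RY ∣                                        ≲⟨ *-monoʳ-≤ 2st 0≤2st (∣∣-resp-≈
                                                                            (solve 3 (λ a b c → a :- c := (b :- c) :+ (a :- b)) refl (E A) (E B) (RX * RY))) ⟩
        2st * ∣ (E B - RX * RY) + (E A - E B) ∣                        ≲⟨ *-monoʳ-≤ 2st 0≤2st (∣x+y∣≤∣x∣+∣y∣ _ _) ⟩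
        2st * (∣ E B - RX * RY ∣ + ∣ E A - E B ∣)                      ≈⟨ distribˡ _ _ _ ⟩
        2st * ∣ E B - RX * RY ∣ + 2st * ∣ E A - E B ∣                  ≲⟨ +-mono-≤ firstColumn otherColumns ⟩
        error F G zero + sum (λ i → error F G (suc i))                 ∎
        where
        module X^L = RandomVector (X ^ L)
        module Y^L = RandomVector (Y ^ L)
        open Coupling (⊗-coupling (X ^ L) (Y ^ L)) using ()
          renaming (∣E∣≤ to ∣H∣≤; mono to H-mono; E-*ˡ to H-*ˡ; E-+ to H-+; swap to H-swap; E-- to H--)
        H = (X ^ L) ⊗ (Y ^ L)
        F⟨_⟩ : X.Space → Fin k → Vec B₁ L → K
        F⟨ x ⟩ j v = F j (X.coordinate j x ∷ v)
        G⟨_⟩ : Y.Space → Fin k → Vec B₂ L → K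
        G⟨ y ⟩ l v = G l (Y.coordinate l y ∷ v)
        φ : X.Space → K
        φ x = X^L.𝔼 (rowProduct (X ^ L) F⟨ x ⟩)
        ψ : Y.Space → K
        ψ y = Y^L.𝔼 (rowProduct (Y ^ L) G⟨ y ⟩)
        RX = X.𝔼 φ
        RY = Y.𝔼 ψ
        -- `E A` is the fully coupled expectation. In the intermediate `E B` only the first column
        -- is still coupled, and in `RX * RY` no column is.
        A B : X.Space × Y.Space → K
        A z = jointExpectation X Y E L F⟨ proj₁ z ⟩ G⟨ proj₂ z ⟩
        B z = φ (proj₁ z) * ψ (proj₂ z)

        -- The induction hypothesis is applied with each value `z` of the first column frozen. Its
        -- error is then averaged over the coupled first column, where pairwise independence again
        -- makes `E-bound` exact.
        otherColumns : 2st * ∣ E A - E B ∣ ≤ sum (λ i → error F G (suc i))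
        otherColumns = begin
          2st * ∣ E A - E B ∣                              ≲⟨ *-monoʳ-≤ 2st 0≤2st (∣∣-resp-≈ (sym (E-- A B))) ⟩
          2st * ∣ E (λ z → A z - B z) ∣                    ≲⟨ *-monoʳ-≤ 2st 0≤2st (∣E∣≤ _) ⟩
          2st * E (λ z → ∣ A z - B z ∣)                    ≈⟨ E-*ˡ 2st _ ⟨
          E (λ z → 2st * ∣ A z - B z ∣)                    ≲⟨ mono (λ z → decoupling L F⟨ proj₁ z ⟩ G⟨ proj₂ z ⟩ (λ j v → ∣F∣≤1 j _) (λ l v → ∣G∣≤1 l _)) ⟩
          E (λ z → sum (error F⟨ proj₁ z ⟩ G⟨ proj₂ z ⟩))  ≈⟨ E-sum (λ i z → error F⟨ proj₁ z ⟩ G⟨ proj₂ z ⟩ i) ⟩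
          sum (λ i → E (λ z → error F⟨ proj₁ z ⟩ G⟨ proj₂ z ⟩ i))
                                                           ≈⟨ sum-cong-≋ {L} (λ i → trans (E-+ _ _) (+-cong (E-bound-suc i) (E-bound-suc i))) ⟩
          sum (λ i → error F G (suc i))                    ∎
          where
          E-bound-suc : ∀ i →
            E (λ z → bound k (totalInfluence X.law F⟨ proj₁ z ⟩ i) (totalInfluence Y.law G⟨ proj₂ z ⟩ i)) ≈
            bound k (totalInfluence X.law F (suc i)) (totalInfluence Y.law G (suc i))
          E-bound-suc i = trans
            (E-bound c (λ j a → Influence X.law (λ v → F j (a ∷ v)) i) (λ l b → Influence Y.law (λ v → G l (b ∷ v)) i))
            (bound-cong k (sum-cong-≋ {k} λ j → reflexive (Influence-suc X.law (F j) i))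
                          (sum-cong-≋ {k} λ l → reflexive (Influence-suc Y.law (G l) i)))

        -- Here the remaining columns `m` are frozen instead, which requires exchanging `E` and `H`;
        -- for each `m` the difference is a covariance in the first column alone.
        firstColumn : 2st * ∣ E B - RX * RY ∣ ≤ error F G zero
        firstColumn = begin
          2st * ∣ E B - RX * RY ∣                          ≲⟨ *-monoʳ-≤ 2st 0≤2st (∣∣-resp-≈ rearrange) ⟩
          2st * ∣ H Δ ∣                                    ≲⟨ *-monoʳ-≤ 2st 0≤2st (∣H∣≤ Δ) ⟩
          2st * H (λ m → ∣ Δ m ∣)                          ≈⟨ H-*ˡ 2st _ ⟨
          H (λ m → 2st * ∣ Δ m ∣)                          ≲⟨ H-mono (λ m → covariance-bound (f m) (g m) (λ j a → ∣F∣≤1 j _) (λ l b → ∣G∣≤1 l _)) ⟩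
          H (λ m → β m + β m)                              ≈⟨ H-+ β β ⟩
          H β + H β                                        ≈⟨ +-cong H-bound H-bound ⟩
          error F G zero                                   ∎
          where
          f : X^L.Space × Y^L.Space → Fin k → B₁ → K
          f m j a = F j (a ∷ X^L.coordinate j (proj₁ m))
          g : X^L.Space × Y^L.Space → Fin k → B₂ → K
          g m l b = G l (b ∷ Y^L.coordinate l (proj₂ m))
          PX : X.Space → X^L.Space → K
          PX x = rowProduct (X ^ L) F⟨ x ⟩
          PY : Y.Space → Y^L.Space → K
          PY y = rowProduct (Y ^ L) G⟨ y ⟩
          Δ β : X^L.Space × Y^L.Space → K
          Δ m = E (λ z → PX (proj₁ z) (proj₁ m) * PY (proj₂ z) (proj₂ m))
              - X.𝔼 (λ x → PX x (proj₁ m)) * Y.𝔼 (λ y → PY y (proj₂ m))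
          β m = bound k (totalVariance X (f m)) (totalVariance Y (g m))
          -- The variance in the first entry, averaged over the rest of a row, is the influence at
          -- `zero` by unfolding, as `insertAt` at `zero` is `_∷_`.
          H-bound : H β ≈ bound k (totalInfluence X.law F zero) (totalInfluence Y.law G zero)
          H-bound = E-bound (⊗-coupling (X ^ L) (Y ^ L))
            (λ j v → Variance X.law λ a → F j (a ∷ v)) (λ l v → Variance Y.law λ b → G l (b ∷ v))
          rearrange : E B - RX * RY ≈ H Δ
          rearrange = begin-equality
            E B - RX * RY
              ≈⟨ +-cong (cong λ z → sym (⊗-* (X ^ L) (Y ^ L) (PX (proj₁ z)) (PY (proj₂ z))))
                        (-‿cong (*-cong (X^L.swap X.isLinear PX) (Y^L.swap Y.isLinear PY))) ⟩
            E (λ z → H λ m → PX (proj₁ z) (proj₁ m) * PY (proj₂ z) (proj₂ m))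
              - X^L.𝔼 (λ M → X.𝔼 λ x → PX x M) * Y^L.𝔼 (λ M → Y.𝔼 λ y → PY y M)
              ≈⟨ +-cong (H-swap isLinear (λ z m → PX (proj₁ z) (proj₁ m) * PY (proj₂ z) (proj₂ m)))
                        (-‿cong (sym (⊗-* (X ^ L) (Y ^ L) (λ M → X.𝔼 λ x → PX x M) (λ M → Y.𝔼 λ y → PY y M)))) ⟩
            H (λ m → E λ z → PX (proj₁ z) (proj₁ m) * PY (proj₂ z) (proj₂ m))
              - H (λ m → X.𝔼 (λ x → PX x (proj₁ m)) * Y.𝔼 (λ y → PY y (proj₂ m)))
              ≈⟨ H-- _ _ ⟨
            H Δ ∎

      -- With one function for all rows, `totalInfluence` is `k` times an influence. The doubled
      -- `bound` of column `i` is then `4 k⁴ s² IF i IG i + 2 k² t² (IF i + IG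
      -- i)`, and the sum over `i` is at most `(4 k⁴ + 4 k²) (s
      -- t)²`; this explains the condition on `C + C`. The factor `s * t + s * t` remains on both
      -- sides for lack of inverses. The reals of the application enter as variables tied by
      -- equations.
      decoupling-same : ∀ L (F : Vec B₁ L → K) (G : Vec B₂ L → K) C →
        (∀ v → ∣ F v ∣ ≤ 1#) → (∀ v → ∣ G v ∣ ≤ 1#) →
        (IF IG : Fin L → K) → (∀ i → IF i ≈ Influence X.law F i) → (∀ i → IG i ≈ Influence Y.law G i) →
        sum (λ i → IF i * IG i) ≤ t * t → sum IF ≤ s * s → sum IG ≤ s * s →
        ⟦ fromℕℚ 4 ⟧ * ((⟦ fromℕℚ k ⟧ * ⟦ fromℕℚ k ⟧) * (⟦ fromℕℚ k ⟧ * ⟦ fromℕℚ k ⟧))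
          + ⟦ fromℕℚ 4 ⟧ * (⟦ fromℕℚ k ⟧ * ⟦ fromℕℚ k ⟧) ≤ C + C →
        (h : Vec (X.Space × Y.Space) L → K) →
        (∀ Z → h Z ≈ product λ j → F (Vec.map (X.coordinate j) (Vec.map proj₁ Z)) * G (Vec.map (Y.coordinate j) (Vec.map proj₂ Z))) →
        (J R₁ R₂ : K) → J ≈ power E L h →
        R₁ ≈ RandomVector.𝔼 (X ^ L) (rowProduct (X ^ L) λ _ → F) → R₂ ≈ RandomVector.𝔼 (Y ^ L) (rowProduct (Y ^ L) λ _ → G) →
        ∀ D → D ≤ ∣ J + - (R₁ * R₂) ∣ → D * (s * t + s * t) ≤ C * (s * t) * (s * t + s * t)
      decoupling-same L F G C ∣F∣≤1 ∣G∣≤1 IF IG IF≈ IG≈ hFG hF hG hC h h≈ J R₁ R₂ J≈ R₁≈ R₂≈ D D≤ = begin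
        D * 2st                             ≈⟨ *-comm _ _ ⟩
        2st * D                             ≲⟨ *-monoʳ-≤ 2st 0≤2st D≤ ⟩
        2st * ∣ J + - (R₁ * R₂) ∣           ≲⟨ *-monoʳ-≤ 2st 0≤2st (∣∣-resp-≈ (+-cong (trans J≈ (power-cong isLinear L h≈)) (-‿cong (*-cong R₁≈ R₂≈)))) ⟩
        2st * _                             ≲⟨ decoupling L (λ _ → F) (λ _ → G) (λ _ → ∣F∣≤1) (λ _ → ∣G∣≤1) ⟩
        sum (error {L} (λ _ → F) (λ _ → G)) ≈⟨ sum-cong-≋ {L} (λ i → trans
                                                 (+-cong (bound-cong k (influences (IF≈ i)) (influences (IG≈ i))) (bound-cong k (influences (IF≈ i)) (influences (IG≈ i))))
                                                 (solve 5 (λ s t κ u v →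
                                                   let β = (s :* s :+ s :* s) :* ((κ :* κ) :* ((κ :* u) :* (κ :* v))) :+ (t :* t) :* (κ :* (κ :* u :+ κ :* v)) in
                                                   β :+ β := con (fromℕℚ 4) :* ((κ :* κ) :* (κ :* κ)) :* (s :* s) :* (u :* v) :+ con (fromℕℚ 2) :* (κ :* κ) :* (t :* t) :* (u :+ v))
                                                   refl s t κ (IF i) (IG i))) ⟩
        sum (λ i → C₁ * (IF i * IG i) + C₂ * (IF i + IG i))
                                            ≈⟨ trans (∑-distrib-+ {L} _ _) (+-cong (sym (*-distribˡ-sum {L} C₁ _))
                                                 (trans (sym (*-distribˡ-sum {L} C₂ _)) (*-congˡ (∑-distrib-+ {L} IF IG)))) ⟩
        C₁ * sum (λ i → IF i * IG i) + C₂ * (sum IF + sum IG)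
                                            ≲⟨ +-mono-≤ (*-monoʳ-≤ C₁ 0≤C₁ hFG) (*-monoʳ-≤ C₂ 0≤C₂ (+-mono-≤ hF hG)) ⟩
        C₁ * (t * t) + C₂ * (s * s + s * s) ≈⟨ solve 3 (λ s t κ → con (fromℕℚ 4) :* ((κ :* κ) :* (κ :* κ)) :* (s :* s) :* (t :* t)
                                                   :+ con (fromℕℚ 2) :* (κ :* κ) :* (t :* t) :* (s :* s :+ s :* s)
                                                 := (con (fromℕℚ 4) :* ((κ :* κ) :* (κ :* κ)) :+ con (fromℕℚ 4) :* (κ :* κ)) :* ((s :* t) :* (s :* t))) refl s t κ ⟩
        (cardinal 4 * ((κ * κ) * (κ * κ)) + cardinal 4 * (κ * κ)) * ((s * t) * (s * t))
                                            ≲⟨ *-monoˡ-≤ _ (0≤x² (s * t)) hC ⟩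
        (C + C) * ((s * t) * (s * t))       ≈⟨ solve 2 (λ C x → (C :+ C) :* (x :* x) := C :* x :* (x :+ x)) refl C (s * t) ⟩
        C * (s * t) * 2st                   ∎
        where
        κ = cardinal k
        influences : ∀ {x y} → x ≈ y → sum {k} (λ _ → y) ≈ κ * x
        influences {x} {y} x≈y = trans (sum-const k y) (*-congˡ (sym x≈y))
        C₁ = cardinal 4 * ((κ * κ) * (κ * κ)) * (s * s)
        C₂ = cardinal 2 * (κ * κ) * (t * t)
        0≤C₁ : 0# ≤ C₁
        0≤C₁ = *-nonneg (*-nonneg (0≤cardinal 4) (0≤x² (κ * κ))) (0≤x² s)
        0≤C₂ : 0# ≤ C₂
        0≤C₂ = *-nonneg (*-nonneg (0≤cardinal 2) (0≤x² κ)) (0≤x² t)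

  -- Estimates for the limit of the two parameters

  x²≤[x+e]² : ∀ {x e} → 0# ≤ x → 0# ≤ e → x * x ≤ (x + e) * (x + e)
  x²≤[x+e]² {x} {e} 0≤x 0≤e = *-mono-≤ (+-nonneg 0≤x 0≤e) 0≤x x≤x+e x≤x+e
    where
    x≤x+e : x ≤ x + e
    x≤x+e = x≤-by-nonneg e 0≤e refl

  -- Provides the positive lower bound that cancelling `2 s t` requires, even where `Γ` or `τ`
  -- vanishes.
  e²≤2st : ∀ {Γ τ e} → 0# ≤ Γ → 0# ≤ τ → 0# ≤ e → e * e ≤ (Γ + e) * (τ + e) + (Γ + e) * (τ + e)
  e²≤2st {Γ} {τ} {e} 0≤Γ 0≤τ 0≤e = x≤-by-nonneg
    ((Γ * τ + (Γ * e + e * τ)) + (Γ + e) * (τ + e))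
    (+-nonneg (+-nonneg (*-nonneg 0≤Γ 0≤τ) (+-nonneg (*-nonneg 0≤Γ 0≤e) (*-nonneg 0≤e 0≤τ)))
              (*-nonneg (+-nonneg 0≤Γ 0≤e) (+-nonneg 0≤τ 0≤e)))
    (solve 3 (λ Γ τ e → e :* e :+ ((Γ :* τ :+ (Γ :* e :+ e :* τ)) :+ (Γ :+ e) :* (τ :+ e))
      := (Γ :+ e) :* (τ :+ e) :+ (Γ :+ e) :* (τ :+ e)) refl Γ τ e)

  -- The excess is `e C (Γ + τ + e)`; by `e ≤ 1#` it is at most `e` times a quantity free of `e`,
  -- the form that `squeeze` takes.
  perturbed-product : ∀ {C Γ τ e} → 0# ≤ C → 0# ≤ e → e ≤ 1# →
    C * ((Γ + e) * (τ + e)) ≤ C * Γ * τ + e * (C * ((Γ + τ) + 1#))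
  perturbed-product {C} {Γ} {τ} {e} 0≤C 0≤e e≤1 = x≤-by-nonneg (e * (C * (1# - e)))
    (*-nonneg 0≤e (*-nonneg 0≤C (0≤y-x e≤1)))
    (solve 5 (λ C Γ τ e o → C :* ((Γ :+ e) :* (τ :+ e)) :+ e :* (C :* (o :- e))
      := C :* Γ :* τ :+ e :* (C :* ((Γ :+ τ) :+ o))) refl C Γ τ e 1#)

open import Defs
open ≡ using (refl; cong; cong₂; subst; subst₂)
open +-*-Solver using (solve; _:+_; _:*_; _:-_; :-_; _:=_; con)
module ℕ-Solver = ℕ-Solvers.+-*-Solver

-- The reals as an ordered ℚ-algebra

Eventually : (ℕ → Set) → Set
Eventually P = ∃ λ N → ∀ n → N ℕ.≤ n → P n

eventually₂ : {P Q R : ℕ → Set} → (∀ n → P n → Q n → R n) → Eventually P → Eventually Q → Eventually R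
eventually₂ f (M , p) (N , q) = M ℕ.⊔ N , λ n h → f n (p n (ℕ.m⊔n≤o⇒m≤o M N h)) (q n (ℕ.m⊔n≤o⇒n≤o M N h))

eventually : {P R : ℕ → Set} → (∀ n → P n → R n) → Eventually P → Eventually R
eventually f (M , p) = M , λ n h → f n (p n h)

pointwise-≈ : ∀ x y → (∀ n → seq x n ≡ seq y n) → x ≈ y
pointwise-≈ x y eq ε 0<ε = 0 , λ n _ → ℚ.≤-trans (ℚ.≤-reflexive (cong ℚ.∣_∣
  (≡.trans (cong (ℚ._- seq y n) (eq n)) (ℚ.+-inverseʳ (seq y n))))) (ℚ.<⇒≤ 0<ε)

pointwise-≤ : ∀ x y → (∀ n → seq x n ℚ.≤ seq y n) → x ≤ y
pointwise-≤ x y h ε 0<ε = 0 , λ n _ → subst (ℚ._≤ seq y n ℚ.+ ε) (ℚ.+-identityʳ (seq x n))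
  (ℚ.+-mono-≤ (h n) (ℚ.<⇒≤ 0<ε))

≈-sym : ∀ {x y} → x ≈ y → y ≈ x
≈-sym {x} {y} h ε 0<ε = eventually (λ n → subst (ℚ._≤ ε) (∣p-q∣≡∣q-p∣ (seq x n) (seq y n))) (h ε 0<ε)

+-cong : ∀ {x y u v} → x ≈ y → u ≈ v → x + u ≈ y + v
+-cong {x} {y} {u} {v} h k ε 0<ε = eventually₂
  (λ n p q → subst₂ ℚ._≤_
    (cong ℚ.∣_∣ (solve 4 (λ a b c d → (a :- b) :+ (c :- d) := (a :+ c) :- (b :+ d)) refl
      (seq x n) (seq y n) (seq u n) (seq v n)))
    (½+½ ε) (∣∣-+-≤ p q))
  (h (½ ℚ.* ε) (½-pos 0<ε)) (k (½ ℚ.* ε) (½-pos 0<ε))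

≈-trans : ∀ {x y z} → x ≈ y → y ≈ z → x ≈ z
≈-trans {x} {y} {z} h k ε 0<ε = eventually₂
  (λ n p q → subst₂ ℚ._≤_
    (cong ℚ.∣_∣ (solve 3 (λ a b c → (a :- b) :+ (b :- c) := a :- c) refl (seq x n) (seq y n) (seq z n)))
    (½+½ ε) (∣∣-+-≤ p q))
  (h (½ ℚ.* ε) (½-pos 0<ε)) (k (½ ℚ.* ε) (½-pos 0<ε))

neg-cong : ∀ {x y} → x ≈ y → - x ≈ - y
neg-cong {x} {y} h ε 0<ε = eventually (λ n p → subst (ℚ._≤ ε)
  (cong ℚ.∣_∣ (solve 2 (λ a b → b :- a := :- a :- :- b) refl (seq x n) (seq y n)))
  (subst (ℚ._≤ ε) (∣p-q∣≡∣q-p∣ (seq x n) (seq y n)) p)) (h ε 0<ε)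

*-congˡ : ∀ {x y} z → x ≈ y → z * x ≈ z * y
*-congˡ {x} {y} z h ε 0<ε =
  let (B , 0<B , K , b) = bounded z
      (δ , 0<δ , eδ)    = divide 0<B 0<ε
  in eventually₂ (λ n p q → subst₂ ℚ._≤_
       (≡.trans (≡.sym (ℚ.∣p*q∣≡∣p∣*∣q∣ (seq z n) (seq x n ℚ.- seq y n)))
         (cong ℚ.∣_∣ (solve 3 (λ z a b → z :* (a :- b) := z :* a :- z :* b) refl (seq z n) (seq x n) (seq y n))))
       eδ (*-mono (ℚ.0≤∣p∣ _) (ℚ.<⇒≤ 0<B) p q)) (K , b) (h δ 0<δ)

*-comm : ∀ x y → x * y ≈ y * x
*-comm x y = pointwise-≈ (x * y) (y * x) λ n → ℚ.*-comm (seq x n) (seq y n)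

*-cong : ∀ {x y u v} → x ≈ y → u ≈ v → x * u ≈ y * v
*-cong {x} {y} {u} {v} h k = ≈-trans {x * u} {x * v} {y * v} (*-congˡ {u} {v} x k)
  (≈-trans {x * v} {v * x} {y * v} (*-comm x v)
    (≈-trans {v * x} {v * y} {y * v} (*-congˡ {x} {y} v h) (*-comm v y)))

≈⇒≤ : ∀ {x y} → x ≈ y → x ≤ y
≈⇒≤ {x} {y} h ε 0<ε = eventually (λ n → p≤q+∣p-q∣ (seq x n) (seq y n)) (h ε 0<ε)

≤-trans : ∀ {x y z} → x ≤ y → y ≤ z → x ≤ z
≤-trans {x} {y} {z} h k ε 0<ε = eventually₂
  (λ n p q → ℚ.≤-trans p (ℚ.≤-trans (ℚ.+-monoˡ-≤ (½ ℚ.* ε) q)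
    (ℚ.≤-reflexive (≡.trans (ℚ.+-assoc (seq z n) _ _) (cong (seq z n ℚ.+_) (½+½ ε))))))
  (h (½ ℚ.* ε) (½-pos 0<ε)) (k (½ ℚ.* ε) (½-pos 0<ε))

+-mono-≤ : ∀ {x y u v} → x ≤ y → u ≤ v → x + u ≤ y + v
+-mono-≤ {x} {y} {u} {v} h k ε 0<ε = eventually₂
  (λ n p q → ℚ.≤-trans (ℚ.+-mono-≤ p q) (ℚ.≤-reflexive (≡.trans
    (solve 3 (λ a b c → (a :+ c) :+ (b :+ c) := (a :+ b) :+ (c :+ c)) refl (seq y n) (seq v n) (½ ℚ.* ε))
    (cong ((seq y n ℚ.+ seq v n) ℚ.+_) (½+½ ε)))))
  (h (½ ℚ.* ε) (½-pos 0<ε)) (k (½ ℚ.* ε) (½-pos 0<ε))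

0<⊓ : ∀ {p q} → 0ℚ ℚ.< p → 0ℚ ℚ.< q → 0ℚ ℚ.< p ℚ.⊓ q
0<⊓ {p} {q} 0<p 0<q with ℚ.⊓-sel p q
... | inj₁ e = subst (0ℚ ℚ.<_) (≡.sym e) 0<p
... | inj₂ e = subst (0ℚ ℚ.<_) (≡.sym e) 0<q

-- A fixed `z` is eventually bounded by a rational `B`, so its small multiples fall below any
-- tolerance. Half of `ε` goes to `η z`, the other half to the slack in the hypothesis itself.
squeeze : ∀ x y z → (∀ ε → 0ℚ ℚ.< ε → ε ℚ.≤ 1ℚ → x ≤ y + fromℚ ε * z) → x ≤ y
squeeze x y z h ε 0<ε =
  let (B , 0<B , K , b) = bounded z
      (δ , 0<δ , eδ)    = divide 0<B (½-pos 0<ε)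
      η = δ ℚ.⊓ 1ℚ
      0<η = 0<⊓ 0<δ (ℚ.positive⁻¹ 1ℚ)
  in eventually₂ (λ n ∣z∣≤B p → ℚ.≤-trans p (ℚ.≤-trans
       (ℚ.+-monoˡ-≤ (½ ℚ.* ε) (ℚ.+-monoʳ-≤ (seq y n) (ℚ.≤-trans
         (ℚ.*-monoˡ-≤-nonNeg η {{ℚ.nonNegative (ℚ.<⇒≤ 0<η)}} (ℚ.≤-trans (p≤∣p∣ (seq z n)) ∣z∣≤B))
         (ℚ.≤-trans (ℚ.*-monoʳ-≤-nonNeg B {{ℚ.nonNegative (ℚ.<⇒≤ 0<B)}} (ℚ.p⊓q≤p δ 1ℚ))
           (ℚ.≤-reflexive (≡.trans (ℚ.*-comm δ B) eδ))))))
       (ℚ.≤-reflexive (≡.trans (ℚ.+-assoc (seq y n) _ _) (cong (seq y n ℚ.+_) (½+½ ε))))))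
     (K , b) (h η 0<η (ℚ.p⊓q≤q δ 1ℚ) (½ ℚ.* ε) (½-pos 0<ε))

-- The hypotheses only say that the terms eventually exceed `- ε`, so it is `(x + ε) (y + ε)` that
-- is nonnegative. Adding `ε (1 - ε)` makes the error the multiple `ε (x + y + 1)`, which `squeeze`
-- removes.
0≤*-ℝ : ∀ {x y} → 0ℝ ≤ x → 0ℝ ≤ y → 0ℝ ≤ x * y
0≤*-ℝ {x} {y} h k = squeeze 0ℝ (x * y) (x + y + 1ℝ) λ ε 0<ε ε≤1 γ 0<γ → eventually₂
  (λ n p q →
    let a = seq x n
        b = seq y n
    in ℚ.≤-trans (0≤+ (0≤* p q) (0≤* (ℚ.<⇒≤ 0<ε) (p≤q⇒0≤q-p ε≤1)))
      (ℚ.≤-trans (ℚ.≤-reflexive (solve 3 (λ a b ε →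
          (a :+ ε) :* (b :+ ε) :+ ε :* (con 1ℚ :- ε) := a :* b :+ ε :* (a :+ b :+ con 1ℚ) :+ con 0ℚ) refl a b ε))
        (ℚ.+-monoʳ-≤ (a ℚ.* b ℚ.+ ε ℚ.* (a ℚ.+ b ℚ.+ 1ℚ)) (ℚ.<⇒≤ 0<γ))))
  (h ε 0<ε) (k ε 0<ε)

-- Constructively, cancelling c requires a positive rational lower bound δ on it.
*-cancelʳ-≤ : ∀ x y c {δ} → 0ℚ ℚ.< δ → fromℚ δ ≤ c → x * c ≤ y * c → x ≤ y
*-cancelʳ-≤ x y c {δ} 0<δ δ≤c h ε 0<ε = eventually₂ conclude
  -- Eventually `c` is at least `½ δ`. A violation of `x ≤ y` by more than `ε` would therefore
  -- exceed the tolerance `½ δ ε` after multiplication by `c`.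
  (δ≤c (½ ℚ.* δ) (½-pos 0<δ)) (h (½ ℚ.* δ ℚ.* ε) 0<½δε)
  where
  0<½δε : 0ℚ ℚ.< ½ ℚ.* δ ℚ.* ε
  0<½δε = subst (ℚ._< ½ ℚ.* δ ℚ.* ε) (ℚ.*-zeroʳ (½ ℚ.* δ))
    (ℚ.*-monoʳ-<-pos (½ ℚ.* δ) {{ℚ.positive (½-pos 0<δ)}} 0<ε)
  conclude : ∀ n → δ ℚ.≤ seq c n ℚ.+ ½ ℚ.* δ → seq x n ℚ.* seq c n ℚ.≤ seq y n ℚ.* seq c n ℚ.+ ½ ℚ.* δ ℚ.* ε →
             seq x n ℚ.≤ seq y n ℚ.+ ε
  conclude n δ≤ p with seq x n ℚ.≤? seq y n ℚ.+ ε
  ... | yes q = q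
  ... | no ¬q = ⊥-elim (ℚ.<-irrefl refl (ℚ.<-≤-trans strict (ℚ.≤-trans p
      (ℚ.≤-trans (ℚ.+-monoʳ-≤ (b ℚ.* d) (ℚ.*-monoʳ-≤-nonNeg ε {{ℚ.nonNegative (ℚ.<⇒≤ 0<ε)}} ½δ≤d))
        (ℚ.≤-reflexive (solve 3 (λ b d ε → b :* d :+ d :* ε := (b :+ ε) :* d) refl b d ε))))))
    where
    b = seq y n
    d = seq c n
    ½δ≤d : ½ ℚ.* δ ℚ.≤ d
    ½δ≤d = subst₂ ℚ._≤_
      (≡.trans (cong (ℚ._- ½ ℚ.* δ) (≡.sym (½+½ δ))) (solve 1 (λ a → (a :+ a) :- a := a) refl (½ ℚ.* δ)))
      (solve 2 (λ d a → (d :+ a) :- a := d) refl d (½ ℚ.* δ))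
      (ℚ.+-monoˡ-≤ (ℚ.- (½ ℚ.* δ)) δ≤)
    strict : (b ℚ.+ ε) ℚ.* d ℚ.< seq x n ℚ.* d
    strict = ℚ.*-monoˡ-<-pos d {{ℚ.positive (ℚ.<-≤-trans (½-pos 0<δ) ½δ≤d)}} (ℚ.≰⇒> ¬q)

⊔-lub-ℝ : ∀ {x y z} → x ≤ z → y ≤ z → x ⊔ y ≤ z
⊔-lub-ℝ h k ε 0<ε = eventually₂ (λ n → ℚ.⊔-lub) (h ε 0<ε) (k ε 0<ε)

x≤x⊔y : ∀ x y → x ≤ x ⊔ y
x≤x⊔y x y = pointwise-≤ x (x ⊔ y) λ n → ℚ.p≤p⊔q (seq x n) (seq y n)

y≤x⊔y : ∀ x y → y ≤ x ⊔ y
y≤x⊔y x y = pointwise-≤ y (x ⊔ y) λ n → ℚ.p≤q⊔p (seq x n) (seq y n)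

∣x∣²≤x² : ∀ x → ∣ x ∣ * ∣ x ∣ ≤ x * x
∣x∣²≤x² x = pointwise-≤ (∣ x ∣ * ∣ x ∣) (x * x) λ n → ℚ.≤-reflexive (⊔-square (seq x n))
  where
  ⊔-square : ∀ q → (q ℚ.⊔ ℚ.- q) ℚ.* (q ℚ.⊔ ℚ.- q) ≡ q ℚ.* q
  ⊔-square q with ℚ.⊔-sel q (ℚ.- q)
  ... | inj₁ e = cong₂ ℚ._*_ e e
  ... | inj₂ e = ≡.trans (cong₂ ℚ._*_ e e) (solve 1 (λ q → :- q :* :- q := q :* q) refl q)

-- `√ x` and `√ (0ℝ ⊔ x)` are the same sequence, so `√-square` applies to the positive part, which
-- dominates `x`. In this form the bound fits sums of influences as they stand.
x≤√x*√x : ∀ x → x ≤ √ x * √ x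
x≤√x*√x x = ≤-trans {x} {0ℝ ⊔ x} {√ x * √ x} (y≤x⊔y 0ℝ x)
  (≈⇒≤ {0ℝ ⊔ x} {√ x * √ x} (≈-sym {√ x * √ x} {0ℝ ⊔ x}
    (≈-trans {√ x * √ x} {√ (0ℝ ⊔ x) * √ (0ℝ ⊔ x)} {0ℝ ⊔ x}
      (pointwise-≈ (√ x * √ x) (√ (0ℝ ⊔ x) * √ (0ℝ ⊔ x)) λ n →
        cong (λ q → approx n q ℚ.* approx n q) (≡.sym (ℚ.p≤q⇒p⊔q≡q (ℚ.p≤p⊔q 0ℚ (seq x n)))))
      (√-square (0ℝ ⊔ x) (x≤x⊔y 0ℝ x)))))

infix 4 _≃_ _≼_

-- As records, the relations determine their endpoints, so that these can be inferred; _≈_ and _≤_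
-- unfold to statements about sequences.
record _≃_ (x y : ℝ) : Set where
  constructor ≃-intro
  field ≃⇒≈ : x ≈ y

record _≼_ (x y : ℝ) : Set where
  constructor ≼-intro
  field ≼⇒≤ : x ≤ y

open _≃_
open _≼_

pointwise-≃ : ∀ {x y} → (∀ n → seq x n ≡ seq y n) → x ≃ y
pointwise-≃ {x} {y} h = ≃-intro (pointwise-≈ x y h)

≃-refl : ∀ {x} → x ≃ x
≃-refl = pointwise-≃ λ _ → refl

≃-trans : ∀ {x y z} → x ≃ y → y ≃ z → x ≃ z
≃-trans {x} {y} {z} (≃-intro p) (≃-intro q) = ≃-intro (≈-trans {x} {y} {z} p q)

≃-sym : ∀ {x y} → x ≃ y → y ≃ x
≃-sym {x} {y} (≃-intro p) = ≃-intro (≈-sym {x} {y} p)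

*-cong-≃ : ∀ {x y u v} → x ≃ y → u ≃ v → x * u ≃ y * v
*-cong-≃ {x} {y} {u} {v} (≃-intro p) (≃-intro q) = ≃-intro (*-cong {x} {y} {u} {v} p q)

*-congˡ-≃ : ∀ {z x y} → x ≃ y → z * x ≃ z * y
*-congˡ-≃ {z} {x} {y} (≃-intro p) = ≃-intro (*-congˡ {x} {y} z p)

*-congʳ-≃ : ∀ {z x y} → x ≃ y → x * z ≃ y * z
*-congʳ-≃ {z} {x} {y} p = *-cong-≃ {x} {y} {z} {z} p (pointwise-≃ λ _ → refl)

ℝ-isCommutativeRing : IsCommutativeRing _≃_ _+_ _*_ -_ 0ℝ 1ℝ
ℝ-isCommutativeRing = record
  { isRing = record
    { +-isAbelianGroup = record
      { isGroup = record
        { isMonoid = record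
          { isSemigroup = record
            { isMagma = record
              { isEquivalence = record
                { refl  = pointwise-≃ λ _ → refl
                ; sym   = λ {x} {y} (≃-intro h) → ≃-intro (≈-sym {x} {y} h)
                ; trans = λ {x} {y} {z} (≃-intro h) (≃-intro k) → ≃-intro (≈-trans {x} {y} {z} h k) }
              ; ∙-cong = λ {x} {y} {u} {v} (≃-intro h) (≃-intro k) → ≃-intro (+-cong {x} {y} {u} {v} h k) }
            ; assoc = λ x y z → pointwise-≃ λ n → ℚ.+-assoc (seq x n) (seq y n) (seq z n) }
          ; identity = (λ x → pointwise-≃ λ n → ℚ.+-identityˡ (seq x n))
                     , (λ x → pointwise-≃ λ n → ℚ.+-identityʳ (seq x n)) }
        ; inverse = (λ x → pointwise-≃ λ n → ℚ.+-inverseˡ (seq x n))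
                  , (λ x → pointwise-≃ λ n → ℚ.+-inverseʳ (seq x n))
        ; ⁻¹-cong = λ {x} {y} (≃-intro h) → ≃-intro (neg-cong {x} {y} h) }
      ; comm = λ x y → pointwise-≃ λ n → ℚ.+-comm (seq x n) (seq y n) }
    ; *-cong = λ {x} {y} {u} {v} (≃-intro h) (≃-intro k) → ≃-intro (*-cong {x} {y} {u} {v} h k)
    ; *-assoc = λ x y z → pointwise-≃ λ n → ℚ.*-assoc (seq x n) (seq y n) (seq z n)
    ; *-identity = (λ x → pointwise-≃ λ n → ℚ.*-identityˡ (seq x n))
                 , (λ x → pointwise-≃ λ n → ℚ.*-identityʳ (seq x n))
    ; distrib = (λ x y z → pointwise-≃ λ n → ℚ.*-distribˡ-+ (seq x n) (seq y n) (seq z n))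
              , (λ x y z → pointwise-≃ λ n → ℚ.*-distribʳ-+ (seq x n) (seq y n) (seq z n)) }
  ; *-comm = λ x y → ≃-intro (*-comm x y) }

≃⇒≼ : ∀ {x y} → x ≃ y → x ≼ y
≃⇒≼ {x} {y} (≃-intro h) = ≼-intro (≈⇒≤ {x} {y} h)

≼-trans : ∀ {x y z} → x ≼ y → y ≼ z → x ≼ z
≼-trans {x} {y} {z} (≼-intro h) (≼-intro k) = ≼-intro (≤-trans {x} {y} {z} h k)

+-mono-≼ : ∀ {x y u v} → x ≼ y → u ≼ v → x + u ≼ y + v
+-mono-≼ {x} {y} {u} {v} (≼-intro h) (≼-intro k) = ≼-intro (+-mono-≤ {x} {y} {u} {v} h k)

*-nonneg-≼ : ∀ {x y} → 0ℝ ≼ x → 0ℝ ≼ y → 0ℝ ≼ x * y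
*-nonneg-≼ {x} {y} (≼-intro h) (≼-intro k) = ≼-intro (0≤*-ℝ {x} {y} h k)

⊔-lub-≼ : ∀ {x y z} → x ≼ z → y ≼ z → x ⊔ y ≼ z
⊔-lub-≼ {x} {y} {z} (≼-intro h) (≼-intro k) = ≼-intro (⊔-lub-ℝ {x} {y} {z} h k)

private
  module T = OrderedAlgebraTheory (orderedAlgebra ℝ _≃_ _≼_ _+_ _*_ -_ ∣_∣ 0ℝ 1ℝ fromℚ ℝ-isCommutativeRing
    (λ p q → pointwise-≃ λ _ → refl) (λ p q → pointwise-≃ λ _ → refl) (λ p → pointwise-≃ λ _ → refl)
    (pointwise-≃ λ _ → refl) (pointwise-≃ λ _ → refl)
    (λ {q} 0≤q → ≼-intro (pointwise-≤ 0ℝ (fromℚ q) λ _ → 0≤q))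
    ≃⇒≼ ≼-trans +-mono-≼ *-nonneg-≼
    (λ x → ≼-intro (x≤x⊔y x (- x))) (λ x → ≼-intro (y≤x⊔y x (- x))) ⊔-lub-≼ (λ x → ≼-intro (∣x∣²≤x² x)))

-- Sums and laws on finite sets

𝟙-true : {P : Set} (d : Dec P) → P → 𝟙 d ≃ 1ℝ
𝟙-true (yes _) p = ≃-refl
𝟙-true (no ¬p) p = ⊥-elim (¬p p)

𝟙-false : {P : Set} (d : Dec P) → ¬ P → 𝟙 d ≃ 0ℝ
𝟙-false (yes p) ¬p = ⊥-elim (¬p p)
𝟙-false (no _)  ¬p = ≃-refl

∑-isSummation : ∀ Ω → T.IsSummation (∑ Ω)
∑-isSummation Ω = T.sum-isSummation (Inverse.from (FiniteSet.enum Ω))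

∑-Vec-isSummation : {A : Set} {S : Summation A} → T.IsSummation S → ∀ n → T.IsSummation (∑-Vec S n)
∑-Vec-isSummation s zero    = T.IsExpectation.isSummation (T.point-isExpectation [])
∑-Vec-isSummation s (suc n) = T.iterated-isSummation _∷_ s (∑-Vec-isSummation s n)

∑-𝟙 : ∀ Ω (b : Carrier Ω) (h : Carrier Ω → ℝ) → ∑ Ω (λ a → 𝟙 (FiniteSet._≟_ Ω b a) * h a) ≃ h b
∑-𝟙 Ω b h = ≃-trans {∑ Ω (λ a → 𝟙 (b ≟ a) * h a)} {h (from (to b))} {h b}
  (T.sum-δ (to b) (λ i → 𝟙 (b ≟ from i)) (λ i → h (from i))
    (𝟙-true (b ≟ from (to b)) (≡.sym (strictlyInverseʳ b)))
    λ i i≢ → 𝟙-false (b ≟ from i) λ { refl → i≢ (≡.sym (strictlyInverseˡ i)) })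
  (subst (λ a → h (from (to b)) ≃ h a) (strictlyInverseʳ b) ≃-refl)
  where
  open FiniteSet Ω using (_≟_; enum)
  open Inverse enum

-- Connects the product measure of the statement, a sum against product weights, with the weightless
-- `power` of the abstract theory.
𝔼-^⊗ : {A : Set} {S E : Summation A} → T.IsSummation S → (p : A → ℝ) → (∀ f → 𝔼 S p f ≃ E f) →
        ∀ n (f : Vec A n → ℝ) → 𝔼 (∑-Vec S n) (p ^⊗ n) f ≃ power E n f
𝔼-^⊗ s p E≃ zero    f = pointwise-≃ λ n → ℚ.*-identityˡ (seq (f []) n)
𝔼-^⊗ {S = S} {E} s p E≃ (suc n) f = T.weighted-∷ {S = S} {E} {V = ∑-Vec S n} {power E n}
  (T.IsSummation.isLinear s) (T.IsSummation.isLinear (∑-Vec-isSummation s n))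
  p (p ^⊗ n) (p ^⊗ suc n) (λ a v → pointwise-≃ {(p ^⊗ suc n) (a ∷ v)} {p a * (p ^⊗ n) v} λ _ → refl) E≃ (𝔼-^⊗ s p E≃ n) f

∣∣≤1 : ∀ x → ∈[-1,1] x → ∣ x ∣ ≼ 1ℝ
∣∣≤1 x (-1≤x , x≤1) = ≼-intro (⊔-lub-ℝ {x} { - x} {1ℝ} x≤1 λ ε 0<ε → eventually (λ n p → subst₂ ℚ._≤_
  (solve 2 (λ a e → con (ℚ.- 1ℚ) :+ (con 1ℚ :- a) := :- a) refl (seq x n) ε)
  (solve 2 (λ a e → (a :+ e) :+ (con 1ℚ :- a) := con 1ℚ :+ e) refl (seq x n) ε)
  (ℚ.+-monoˡ-≤ (1ℚ ℚ.- seq x n) p)) (-1≤x ε 0<ε))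

law-isLinear : ∀ Ω (ν : Carrier Ω → ℝ) → T.IsLinear (𝔼 (∑ Ω) ν)
law-isLinear Ω ν = T.weighted-isLinear (∑-isSummation Ω) ν

Var≃Variance : {A : Set} {S : Summation A} → T.IsLinear S → ∀ p f → Var S p f ≃ T.Variance (𝔼 S p) f
Var≃Variance s p f = T.IsLinear.cong s λ a → pointwise-≃ λ _ → refl

Inf≃Influence : ∀ Ω (ν : Carrier Ω → ℝ) {L} (F : Vec (Carrier Ω) L → ℝ) i → Inf Ω ν F i ≃ T.Influence (𝔼 (∑ Ω) ν) F i
Inf≃Influence Ω ν {suc n} F i = ≃-trans
  (𝔼-^⊗ {S = ∑ Ω} {E = 𝔼 (∑ Ω) ν} (∑-isSummation Ω) ν (λ f → ≃-refl {𝔼 (∑ Ω) ν f}) n λ x → Var (∑ Ω) ν λ a → F (insertAt x i a))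
  (T.power-cong (law-isLinear Ω ν) n λ x → Var≃Variance (T.IsSummation.isLinear (∑-isSummation Ω)) ν λ a → F (insertAt x i a))

-- The numerical constant

multiple-1 : ∀ n → multiple n 1ℚ ≡ fromℕℚ n
multiple-1 n = ≡.trans (multiple-fromℕ n 1ℚ) (ℚ.*-identityʳ (fromℕℚ n))

-- The detour through the recursive `multiple` avoids normalising fractions.
fromℕℚ-+ : ∀ m n → fromℕℚ (m ℕ.+ n) ≡ fromℕℚ m ℚ.+ fromℕℚ n
fromℕℚ-+ m n = ≡.trans (≡.sym (multiple-1 (m ℕ.+ n))) (≡.trans (multiple-+ m n 1ℚ) (cong₂ ℚ._+_ (multiple-1 m) (multiple-1 n)))

fromℕℚ-* : ∀ m n → fromℕℚ (m ℕ.* n) ≡ fromℕℚ m ℚ.* fromℕℚ n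
fromℕℚ-* m n = ≡.trans (≡.sym (multiple-1 (m ℕ.* n))) (≡.trans (multiple-* m n 1ℚ)
  (≡.trans (multiple-fromℕ m (multiple n 1ℚ)) (cong (fromℕℚ m ℚ.*_) (multiple-1 n))))

fromℕℚ-mono : ∀ {m n} → m ℕ.≤ n → fromℕℚ m ℚ.≤ fromℕℚ n
fromℕℚ-mono {m} {n} m≤n = subst₂ ℚ._≤_ (ℚ.+-identityʳ (fromℕℚ m))
  (≡.trans (≡.sym (fromℕℚ-+ m (n ℕ.∸ m))) (cong fromℕℚ (ℕ.m+[n∸m]≡n m≤n)))
  (ℚ.+-monoʳ-≤ (fromℕℚ m) (ℚ.nonNegative⁻¹ (fromℕℚ (n ℕ.∸ m))))

n<2^n : ∀ n → n ℕ.< 2 ℕ.^ n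
n<2^n zero    = ℕ.s≤s ℕ.z≤n
n<2^n (suc n) = ℕ.+-mono-≤ (ℕ.m^n>0 2 n) (ℕ.≤-trans (n<2^n n) (ℕ.m≤m+n (2 ℕ.^ n) 0))

-- Each summand is at most `2 · 2 · k · k · k · k`, a product of six factors that are all at most
-- `2 ^ k`. For the factors `2` this fails at `k = 0`, where the left side vanishes.
4k⁴+4k²≤2·2^6k : ∀ k → 4 ℕ.* ((k ℕ.* k) ℕ.* (k ℕ.* k)) ℕ.+ 4 ℕ.* (k ℕ.* k) ℕ.≤ 2 ℕ.^ (6 ℕ.* k) ℕ.+ 2 ℕ.^ (6 ℕ.* k)
4k⁴+4k²≤2·2^6k zero      = ℕ.z≤n
4k⁴+4k²≤2·2^6k k@(suc _) = ℕ.+-mono-≤ quartic (ℕ.≤-trans (ℕ.*-monoʳ-≤ 4 (ℕ.m≤m*n (k ℕ.* k) (k ℕ.* k))) quartic)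
  where
  p = 2 ℕ.^ k
  k≤p : k ℕ.≤ p
  k≤p = ℕ.<⇒≤ (n<2^n k)
  2≤p : 2 ℕ.≤ p
  2≤p = ℕ.^-monoʳ-≤ 2 {1} {k} (ℕ.s≤s ℕ.z≤n)
  quartic : 4 ℕ.* ((k ℕ.* k) ℕ.* (k ℕ.* k)) ℕ.≤ 2 ℕ.^ (6 ℕ.* k)
  quartic = ℕ.≤-trans
    (ℕ.*-mono-≤ (ℕ.*-mono-≤ 2≤p 2≤p) (ℕ.*-mono-≤ (ℕ.*-mono-≤ k≤p k≤p) (ℕ.*-mono-≤ k≤p k≤p)))
    (ℕ.≤-reflexive (≡.trans (six p) (≡.trans (ℕ.^-*-assoc 2 k 6) (cong (2 ℕ.^_) (ℕ.*-comm k 6)))))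
    where
    six : ∀ p → (p ℕ.* p) ℕ.* ((p ℕ.* p) ℕ.* (p ℕ.* p)) ≡ p ℕ.^ 6
    six = ℕ-Solver.solve 1 (λ p → (p ℕ-Solver.:* p) ℕ-Solver.:* ((p ℕ-Solver.:* p) ℕ-Solver.:* (p ℕ-Solver.:* p)) ℕ-Solver.:= p ℕ-Solver.:^ 6) refl

constant-bound : ∀ k →
  fromℚ (fromℕℚ 4) * ((fromℚ (fromℕℚ k) * fromℚ (fromℕℚ k)) * (fromℚ (fromℕℚ k) * fromℚ (fromℕℚ k)))
    + fromℚ (fromℕℚ 4) * (fromℚ (fromℕℚ k) * fromℚ (fromℕℚ k)) ≼
  fromℕ (2 ℕ.^ (6 ℕ.* k)) + fromℕ (2 ℕ.^ (6 ℕ.* k))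
constant-bound k = ≼-intro (pointwise-≤
  (fromℚ (fromℕℚ 4) * ((fromℚ (fromℕℚ k) * fromℚ (fromℕℚ k)) * (fromℚ (fromℕℚ k) * fromℚ (fromℕℚ k)))
    + fromℚ (fromℕℚ 4) * (fromℚ (fromℕℚ k) * fromℚ (fromℕℚ k)))
  (fromℕ (2 ℕ.^ (6 ℕ.* k)) + fromℕ (2 ℕ.^ (6 ℕ.* k)))
  λ _ → subst₂ ℚ._≤_
    (≡.trans (fromℕℚ-+ (4 ℕ.* ((k ℕ.* k) ℕ.* (k ℕ.* k))) (4 ℕ.* (k ℕ.* k))) (cong₂ ℚ._+_
      (≡.trans (fromℕℚ-* 4 ((k ℕ.* k) ℕ.* (k ℕ.* k))) (cong (fromℕℚ 4 ℚ.*_)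
        (≡.trans (fromℕℚ-* (k ℕ.* k) (k ℕ.* k)) (cong₂ ℚ._*_ (fromℕℚ-* k k) (fromℕℚ-* k k)))))
      (≡.trans (fromℕℚ-* 4 (k ℕ.* k)) (cong (fromℕℚ 4 ℚ.*_) (fromℕℚ-* k k)))))
    (fromℕℚ-+ (2 ℕ.^ (6 ℕ.* k)) (2 ℕ.^ (6 ℕ.* k)))
    (fromℕℚ-mono (4k⁴+4k²≤2·2^6k k)))

-- Congruence of marginals and expectations

∑-cong : {A : Set} {S : Summation A} → T.IsSummation S → {f g : A → ℝ} → (∀ a → f a ≃ g a) → S f ≃ S g
∑-cong s = T.IsSummation.cong s

seq-product-cong : ∀ {k} {f g : Fin k → ℝ} n → (∀ j → seq (f j) n ≡ seq (g j) n) → seq (product f) n ≡ seq (product g) n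
seq-product-cong {zero}  n h = refl
seq-product-cong {suc k} n h = cong₂ ℚ._*_ (h zero) (seq-product-cong n λ j → h (suc j))

coordinateMarginal-def : ∀ Ω k p j a →
  ∑-Vec (∑ Ω) k (λ x → 𝟙 (FiniteSet._≟_ Ω (lookup x j) a) * p x) ≃ coordinateMarginal Ω p j a
coordinateMarginal-def Ω k p j a = ∑-cong (∑-Vec-isSummation (∑-isSummation Ω) k) λ x → pointwise-≃ λ _ → refl

weighted-congʳ : {A : Set} {S : Summation A} → T.IsSummation S → (w p q : A → ℝ) → (∀ x → p x ≃ q x) →
                 S (λ x → w x * p x) ≃ S (λ x → w x * q x)
weighted-congʳ s w p q p≃q = ∑-cong s λ x → *-congˡ-≃ {w x} {p x} {q x} (p≃q x)

weighted-congˡ : {A : Set} {S : Summation A} → T.IsSummation S → (f p q : A → ℝ) → (∀ x → p x ≃ q x) →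
                 S (λ x → p x * f x) ≃ S (λ x → q x * f x)
weighted-congˡ s f p q p≃q = ∑-cong s λ x → *-congʳ-≃ {f x} {p x} {q x} (p≃q x)

rowsExpectation≃ : ∀ Ω k L (p : Vec (Carrier Ω) k → ℝ) (F : Vec (Carrier Ω) L → ℝ) (E : Summation (Vec (Carrier Ω) k)) →
  (∀ f → 𝔼 (∑-Vec (∑ Ω) k) p f ≃ E f) → rowsExpectation Ω k L p F ≃ power E L (λ M → product λ j → F (row j M))
rowsExpectation≃ Ω k L p F E E≃ = 𝔼-^⊗ {S = ∑-Vec (∑ Ω) k} {E} (∑-Vec-isSummation (∑-isSummation Ω) k) p E≃ L
  (λ M → product λ j → F (row j M))

coordinateMarginal≃ : ∀ Ω k (p q : Vec (Carrier Ω) k → ℝ) → (∀ x → p x ≃ q x) → ∀ j a →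
  ∑-Vec (∑ Ω) k (λ x → 𝟙 (FiniteSet._≟_ Ω (lookup x j) a) * p x) ≃ coordinateMarginal Ω q j a
coordinateMarginal≃ Ω k p q p≃q j a = ≃-trans
  (weighted-congʳ (∑-Vec-isSummation (∑-isSummation Ω) k) (λ x → 𝟙 (FiniteSet._≟_ Ω (lookup x j) a)) p q p≃q)
  (coordinateMarginal-def Ω k q j a)

coordinateMarginal-cong : ∀ Ω k (p q : Vec (Carrier Ω) k → ℝ) → (∀ x → p x ≃ q x) → ∀ j a →
  coordinateMarginal Ω p j a ≃ coordinateMarginal Ω q j a
coordinateMarginal-cong Ω k p q p≃q j a = ≃-trans (≃-sym (coordinateMarginal-def Ω k p j a)) (coordinateMarginal≃ Ω k p q p≃q j a)

marginal-law : ∀ Ω k (p q : Vec (Carrier Ω) k → ℝ) → (∀ x → p x ≃ q x) → (ν : Carrier Ω → ℝ) →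
  (∀ j a → coordinateMarginal Ω q j a ≃ ν a) → ∀ j a → coordinateMarginal Ω p j a ≃ ν a
marginal-law Ω k p q p≃q ν h j a = ≃-trans (coordinateMarginal-cong Ω k p q p≃q j a) (h j a)

pairwise≃ : ∀ Ω₁ Ω₂ k μ → CorrelatedSpace.PairwiseProduct Ω₁ Ω₂ k μ → ∀ j l a b →
  CorrelatedSpace.pairMarginal Ω₁ Ω₂ k μ j l (a , b) ≃
  coordinateMarginal Ω₁ (CorrelatedSpace.marginal₁ Ω₁ Ω₂ k μ) j a * coordinateMarginal Ω₂ (CorrelatedSpace.marginal₂ Ω₁ Ω₂ k μ) l b
pairwise≃ Ω₁ Ω₂ k μ pairwise j l a b = ≃-intro (pairwise j l a b)

-- Square roots and the choice of the parameters

fromℚ-nonneg : ∀ {ε} → 0ℚ ℚ.≤ ε → 0ℝ ≼ fromℚ ε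
fromℚ-nonneg {ε} 0≤ε = ≼-intro (pointwise-≤ 0ℝ (fromℚ ε) λ _ → 0≤ε)

fromℕ-nonneg : ∀ n → 0ℝ ≼ fromℕ n
fromℕ-nonneg n = ≼-intro (pointwise-≤ 0ℝ (fromℕ n) λ _ → ℚ.nonNegative⁻¹ (fromℕℚ n))

√-nonneg-≼ : ∀ x → 0ℝ ≼ √ x
√-nonneg-≼ x = ≼-intro (√-nonneg x)

√≤Γ⇒≤Γ² : ∀ {x Γ} → √ x ≼ Γ → x ≼ Γ * Γ
√≤Γ⇒≤Γ² {x} {Γ} h = ≼-trans {x} {√ x * √ x} {Γ * Γ} (≼-intro (x≤√x*√x x))
  (T.*-mono-≤ {√ x} {Γ} {√ x} {Γ} (≼-trans {0ℝ} {√ x} {Γ} (√-nonneg-≼ x) h) (√-nonneg-≼ x) h h)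

0<ε² : ∀ {ε} → 0ℚ ℚ.< ε → 0ℚ ℚ.< ε ℚ.* ε
0<ε² {ε} 0<ε = subst (ℚ._< ε ℚ.* ε) (ℚ.*-zeroʳ ε) (ℚ.*-monoʳ-<-pos ε {{ℚ.positive 0<ε}} 0<ε)

cancel-2st : ∀ D C Γ τ {ε} → 0ℝ ≼ Γ → 0ℝ ≼ τ → 0ℚ ℚ.< ε →
  D * ((Γ + fromℚ ε) * (τ + fromℚ ε) + (Γ + fromℚ ε) * (τ + fromℚ ε)) ≼
  C * ((Γ + fromℚ ε) * (τ + fromℚ ε)) * ((Γ + fromℚ ε) * (τ + fromℚ ε) + (Γ + fromℚ ε) * (τ + fromℚ ε)) →
  D ≼ C * ((Γ + fromℚ ε) * (τ + fromℚ ε))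
cancel-2st D C Γ τ {ε} 0≤Γ 0≤τ 0<ε (≼-intro h) = ≼-intro (*-cancelʳ-≤ D (C * ((Γ + fromℚ ε) * (τ + fromℚ ε)))
  ((Γ + fromℚ ε) * (τ + fromℚ ε) + (Γ + fromℚ ε) * (τ + fromℚ ε)) (0<ε² 0<ε) (≼⇒≤ ε²≤2st) h)
  where
  ε²≤2st : fromℚ (ε ℚ.* ε) ≼ (Γ + fromℚ ε) * (τ + fromℚ ε) + (Γ + fromℚ ε) * (τ + fromℚ ε)
  ε²≤2st = ≼-trans {fromℚ (ε ℚ.* ε)} {fromℚ ε * fromℚ ε}
    {(Γ + fromℚ ε) * (τ + fromℚ ε) + (Γ + fromℚ ε) * (τ + fromℚ ε)}
    (≼-intro (pointwise-≤ (fromℚ (ε ℚ.* ε)) (fromℚ ε * fromℚ ε) λ _ → ℚ.≤-refl))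
    (T.e²≤2st {Γ} {τ} {fromℚ ε} 0≤Γ 0≤τ (fromℚ-nonneg (ℚ.<⇒≤ 0<ε)))

-- Taking s = Γ + ε and t = τ + ε makes s t invertible; then ε tends to 0.
optimise : ∀ D C Γ τ → 0ℝ ≼ C → 0ℝ ≼ Γ → 0ℝ ≼ τ →
  (∀ s t → 0ℝ ≼ s → 0ℝ ≼ t → Γ * Γ ≼ s * s → τ * τ ≼ t * t →
    D * (s * t + s * t) ≼ C * (s * t) * (s * t + s * t)) →
  D ≤ C * Γ * τ
optimise D C Γ τ 0≤C 0≤Γ 0≤τ h = squeeze D (C * Γ * τ) (C * ((Γ + τ) + 1ℝ)) λ ε 0<ε ε≤1 → ≼⇒≤ (perturbed ε 0<ε ε≤1)
  where
  perturbed : ∀ ε → 0ℚ ℚ.< ε → ε ℚ.≤ 1ℚ → D ≼ C * Γ * τ + fromℚ ε * (C * ((Γ + τ) + 1ℝ))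
  perturbed ε 0<ε ε≤1 = ≼-trans {D} {C * ((Γ + fromℚ ε) * (τ + fromℚ ε))} {C * Γ * τ + fromℚ ε * (C * ((Γ + τ) + 1ℝ))}
    (cancel-2st D C Γ τ 0≤Γ 0≤τ 0<ε (h (Γ + fromℚ ε) (τ + fromℚ ε)
      (T.+-nonneg {Γ} {fromℚ ε} 0≤Γ 0≤ε) (T.+-nonneg {τ} {fromℚ ε} 0≤τ 0≤ε)
      (T.x²≤[x+e]² {Γ} {fromℚ ε} 0≤Γ 0≤ε) (T.x²≤[x+e]² {τ} {fromℚ ε} 0≤τ 0≤ε)))
    (T.perturbed-product {C} {Γ} {τ} {fromℚ ε} 0≤C 0≤ε (≼-intro (pointwise-≤ (fromℚ ε) 1ℝ λ _ → ε≤1)))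
    where
    0≤ε : 0ℝ ≼ fromℚ ε
    0≤ε = fromℚ-nonneg (ℚ.<⇒≤ 0<ε)

-- Since `Γ` dominates both roots, `f` and `g` are at most `Γ * Γ`; conditions on the three sums, as
-- `decoupling-same` has them, thus follow from those on `Γ` and `τ`.
limit : ∀ D C f g fg → 0ℝ ≼ C →
  (∀ s t → 0ℝ ≼ s → 0ℝ ≼ t → f ≼ s * s → g ≼ s * s → fg ≼ t * t →
    D * (s * t + s * t) ≼ C * (s * t) * (s * t + s * t)) →
  D ≤ C * (√ f ⊔ √ g) * √ fg
limit D C f g fg 0≤C h = optimise D C (√ f ⊔ √ g) (√ fg) 0≤C
  (≼-trans {0ℝ} {√ f} {√ f ⊔ √ g} (√-nonneg-≼ f) (≼-intro (x≤x⊔y (√ f) (√ g)))) (√-nonneg-≼ fg)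
  λ s t 0≤s 0≤t Γ²≤s² τ²≤t² → h s t 0≤s 0≤t
    (≼-trans {f} {(√ f ⊔ √ g) * (√ f ⊔ √ g)} {s * s} (√≤Γ⇒≤Γ² {f} {√ f ⊔ √ g} (≼-intro (x≤x⊔y (√ f) (√ g)))) Γ²≤s²)
    (≼-trans {g} {(√ f ⊔ √ g) * (√ f ⊔ √ g)} {s * s} (√≤Γ⇒≤Γ² {g} {√ f ⊔ √ g} (≼-intro (y≤x⊔y (√ f) (√ g)))) Γ²≤s²)
    (≼-trans {fg} {√ fg * √ fg} {t * t} (≼-intro (x≤√x*√x fg)) τ²≤t²)

∣x-y∣≼∣x+-y∣ : ∀ x y → ∣ x - y ∣ ≼ ∣ x + - y ∣
∣x-y∣≼∣x+-y∣ x y = ≼-intro (pointwise-≤ ∣ x - y ∣ ∣ x + - y ∣ λ _ → ℚ.≤-refl)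

-- The correlated space as a coupling

module Columns (Ω₁ Ω₂ : FiniteSet) (k : ℕ)
  (μ : Vec (Carrier Ω₁) k × Vec (Carrier Ω₂) k → ℝ) (isProbability : IsProbability (CorrelatedSpace.∑₁₂ Ω₁ Ω₂ k) μ)
  (pairwise : CorrelatedSpace.PairwiseProduct Ω₁ Ω₂ k μ)
  -- The marginals are variables known up to `_≃_`, so the expectations over rows are compared by
  -- rewriting weights.
  (μ₁ : Vec (Carrier Ω₁) k → ℝ) (μ₁≃ : ∀ x → ∑-Vec (∑ Ω₂) k (λ y → μ (x , y)) ≃ μ₁ x)
  (μ₂ : Vec (Carrier Ω₂) k → ℝ) (μ₂≃ : ∀ y → ∑-Vec (∑ Ω₁) k (λ x → μ (x , y)) ≃ μ₂ y)
  (ν₁ : Carrier Ω₁ → ℝ) (ν₁-law : ∀ j a → coordinateMarginal Ω₁ μ₁ j a ≃ ν₁ a)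
  (ν₂ : Carrier Ω₂ → ℝ) (ν₂-law : ∀ j b → coordinateMarginal Ω₂ μ₂ j b ≃ ν₂ b)
  where

  private
    S₁ : T.IsSummation (∑-Vec (∑ Ω₁) k)
    S₁ = ∑-Vec-isSummation (∑-isSummation Ω₁) k

    S₂ : T.IsSummation (∑-Vec (∑ Ω₂) k)
    S₂ = ∑-Vec-isSummation (∑-isSummation Ω₂) k

    ∑₁₂ : Summation (Vec (Carrier Ω₁) k × Vec (Carrier Ω₂) k)
    ∑₁₂ = ∑-× (∑-Vec (∑ Ω₁) k) (∑-Vec (∑ Ω₂) k)

    S₁₂ : T.IsSummation ∑₁₂
    S₁₂ = T.iterated-isSummation _,_ S₁ S₂

    pair≃ : ∀ j l a b → ∑-Vec (∑ Ω₁) k (λ x → ∑-Vec (∑ Ω₂) k λ y →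
              (𝟙 (FiniteSet._≟_ Ω₁ (lookup x j) a) * 𝟙 (FiniteSet._≟_ Ω₂ (lookup y l) b)) * μ (x , y)) ≃
            CorrelatedSpace.pairMarginal Ω₁ Ω₂ k μ j l (a , b)
    pair≃ j l a b = ∑-cong S₁ λ x → ∑-cong S₂ λ y → pointwise-≃ λ _ → refl

  law₁ : ∀ j a → ∑-Vec (∑ Ω₁) k (λ x → 𝟙 (FiniteSet._≟_ Ω₁ (lookup x j) a) * ∑-Vec (∑ Ω₂) k (λ y → μ (x , y))) ≃ ν₁ a
  law₁ j a = ≃-trans (coordinateMarginal≃ Ω₁ k (λ x → ∑-Vec (∑ Ω₂) k (λ y → μ (x , y))) μ₁ μ₁≃ j a) (ν₁-law j a)

  law₂ : ∀ l b → ∑-Vec (∑ Ω₂) k (λ y → 𝟙 (FiniteSet._≟_ Ω₂ (lookup y l) b) * ∑-Vec (∑ Ω₁) k (λ x → μ (x , y))) ≃ ν₂ b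
  law₂ l b = ≃-trans (coordinateMarginal≃ Ω₂ k (λ y → ∑-Vec (∑ Ω₁) k (λ x → μ (x , y))) μ₂ μ₂≃ l b) (ν₂-law l b)

  pairs : ∀ j l a b → ∑-Vec (∑ Ω₁) k (λ x → ∑-Vec (∑ Ω₂) k λ y →
            (𝟙 (FiniteSet._≟_ Ω₁ (lookup x j) a) * 𝟙 (FiniteSet._≟_ Ω₂ (lookup y l) b)) * μ (x , y)) ≃
          ν₁ a * ν₂ b
  pairs j l a b = ≃-trans (pair≃ j l a b) (≃-trans (pairwise≃ Ω₁ Ω₂ k μ pairwise j l a b)
    (*-cong-≃ {coordinateMarginal Ω₁ (CorrelatedSpace.marginal₁ Ω₁ Ω₂ k μ) j a} {ν₁ a}
              {coordinateMarginal Ω₂ (CorrelatedSpace.marginal₂ Ω₁ Ω₂ k μ) l b} {ν₂ b}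
      (marginal-law Ω₁ k (CorrelatedSpace.marginal₁ Ω₁ Ω₂ k μ) μ₁ μ₁≃ ν₁ ν₁-law j a)
      (marginal-law Ω₂ k (CorrelatedSpace.marginal₂ Ω₁ Ω₂ k μ) μ₂ μ₂≃ ν₂ ν₂-law l b)))

  module J = T.Joint {k} S₁ S₂ (∑-isSummation Ω₁) (∑-isSummation Ω₂)
    (λ j x → lookup x j) (λ j x a → 𝟙 (FiniteSet._≟_ Ω₁ (lookup x j) a)) (λ j x → ∑-𝟙 Ω₁ (lookup x j))
    (λ l y → lookup y l) (λ l y b → 𝟙 (FiniteSet._≟_ Ω₂ (lookup y l) b)) (λ l y → ∑-𝟙 Ω₂ (lookup y l))
    μ (λ z → ≼-intro (IsProbability.nonNegative isProbability z)) (≃-intro (IsProbability.total isProbability))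
    ν₁ law₁ ν₂ law₂ pairs

  module _ (L : ℕ) (F : Vec (Carrier Ω₁) L → ℝ) (G : Vec (Carrier Ω₂) L → ℝ) where

    joint≃ : ∀ f → 𝔼 ∑₁₂ μ f ≃ J.joint f
    joint≃ f = ∑-cong S₁ λ x → ∑-cong S₂ λ y → pointwise-≃ λ _ → refl

    private
      rowsProduct : Vec (Vec (Carrier Ω₁) k × Vec (Carrier Ω₂) k) L → ℝ
      rowsProduct Z = product λ j → F (Vec.map (λ x → lookup x j) (Vec.map proj₁ Z)) * G (Vec.map (λ y → lookup y j) (Vec.map proj₂ Z))

    joint-def : CorrelatedSpace.jointExpectation Ω₁ Ω₂ k L μ F G ≃
      𝔼 (∑-Vec ∑₁₂ L) (μ ^⊗ L) rowsProduct
    joint-def = ∑-cong (∑-Vec-isSummation S₁₂ L) λ Z → pointwise-≃ λ n →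
      cong (seq ((μ ^⊗ L) Z) n ℚ.*_) (seq-product-cong {k} n λ j → refl)

    joint-power : 𝔼 (∑-Vec ∑₁₂ L) (μ ^⊗ L) rowsProduct ≃ power J.joint L rowsProduct
    joint-power = 𝔼-^⊗ {A = Vec (Carrier Ω₁) k × Vec (Carrier Ω₂) k} {S = ∑₁₂} {J.joint} S₁₂ μ joint≃ L rowsProduct

    weights₁≃ : ∀ f → 𝔼 (∑-Vec (∑ Ω₁) k) μ₁ f ≃ ∑-Vec (∑ Ω₁) k (λ x → ∑-Vec (∑ Ω₂) k (λ y → μ (x , y)) * f x)
    weights₁≃ f = weighted-congˡ S₁ f μ₁ (λ x → ∑-Vec (∑ Ω₂) k (λ y → μ (x , y))) λ x → ≃-sym (μ₁≃ x)

    law₁≃ : ∀ f → ∑-Vec (∑ Ω₁) k (λ x → ∑-Vec (∑ Ω₂) k (λ y → μ (x , y)) * f x) ≃ T.RandomVector.𝔼 J.X f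
    law₁≃ f = ∑-cong S₁ λ x → pointwise-≃ λ _ → refl

    rows-power₁ : rowsExpectation Ω₁ k L μ₁ F ≃ power (T.RandomVector.𝔼 J.X) L (λ M → product λ j → F (row j M))
    rows-power₁ = rowsExpectation≃ Ω₁ k L μ₁ F (T.RandomVector.𝔼 J.X) λ f → ≃-trans (weights₁≃ f) (law₁≃ f)

    rowProduct₁≃ : power (T.RandomVector.𝔼 J.X) L (λ M → product λ j → F (row j M)) ≃
      T.RandomVector.𝔼 (J.X T.^ L) (T.rowProduct (J.X T.^ L) λ _ → F)
    rowProduct₁≃ = T.power-cong (T.RandomVector.isLinear J.X) L λ M → pointwise-≃ λ n → seq-product-cong {k} n λ j → refl

    rows₁≃ : rowsExpectation Ω₁ k L μ₁ F ≃ T.RandomVector.𝔼 (J.X T.^ L) (T.rowProduct (J.X T.^ L) λ _ → F)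
    rows₁≃ = ≃-trans rows-power₁ rowProduct₁≃

    weights₂≃ : ∀ f → 𝔼 (∑-Vec (∑ Ω₂) k) μ₂ f ≃ ∑-Vec (∑ Ω₂) k (λ x → ∑-Vec (∑ Ω₁) k (λ y → μ (y , x)) * f x)
    weights₂≃ f = weighted-congˡ S₂ f μ₂ (λ x → ∑-Vec (∑ Ω₁) k (λ y → μ (y , x))) λ x → ≃-sym (μ₂≃ x)

    law₂≃ : ∀ f → ∑-Vec (∑ Ω₂) k (λ x → ∑-Vec (∑ Ω₁) k (λ y → μ (y , x)) * f x) ≃ T.RandomVector.𝔼 J.Y f
    law₂≃ f = ∑-cong S₂ λ x → pointwise-≃ λ _ → refl

    rows-power₂ : rowsExpectation Ω₂ k L μ₂ G ≃ power (T.RandomVector.𝔼 J.Y) L (λ M → product λ j → G (row j M))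
    rows-power₂ = rowsExpectation≃ Ω₂ k L μ₂ G (T.RandomVector.𝔼 J.Y) λ f → ≃-trans (weights₂≃ f) (law₂≃ f)

    rowProduct₂≃ : power (T.RandomVector.𝔼 J.Y) L (λ M → product λ j → G (row j M)) ≃
      T.RandomVector.𝔼 (J.Y T.^ L) (T.rowProduct (J.Y T.^ L) λ _ → G)
    rowProduct₂≃ = T.power-cong (T.RandomVector.isLinear J.Y) L λ M → pointwise-≃ λ n → seq-product-cong {k} n λ j → refl

    rows₂≃ : rowsExpectation Ω₂ k L μ₂ G ≃ T.RandomVector.𝔼 (J.Y T.^ L) (T.rowProduct (J.Y T.^ L) λ _ → G)
    rows₂≃ = ≃-trans rows-power₂ rowProduct₂≃

    core : (∀ x → ∣ F x ∣ ≼ 1ℝ) → (∀ y → ∣ G y ∣ ≼ 1ℝ) →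
      (IF IG : Fin L → ℝ) → (∀ i → IF i ≃ T.Influence (𝔼 (∑ Ω₁) ν₁) F i) → (∀ i → IG i ≃ T.Influence (𝔼 (∑ Ω₂) ν₂) G i) →
      ∀ J₀ → J₀ ≃ CorrelatedSpace.jointExpectation Ω₁ Ω₂ k L μ F G →
      ∣ J₀ - rowsExpectation Ω₁ k L μ₁ F * rowsExpectation Ω₂ k L μ₂ G ∣ ≤
      fromℕ (2 ℕ.^ (6 ℕ.* k)) * (√ (sum IF) ⊔ √ (sum IG)) * √ (sum λ i → IF i * IG i)
    core ∣F∣≤1 ∣G∣≤1 IF IG IF≃ IG≃ J₀ J₀≃ = limit ∣ J₀ - rowsExpectation Ω₁ k L μ₁ F * rowsExpectation Ω₂ k L μ₂ G ∣
      (fromℕ (2 ℕ.^ (6 ℕ.* k))) (sum IF) (sum IG) (sum λ i → IF i * IG i) (fromℕ-nonneg (2 ℕ.^ (6 ℕ.* k)))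
      λ s t 0≤s 0≤t hF hG hFG → T.Bound.decoupling-same s t 0≤s 0≤t J.coupling L F G (fromℕ (2 ℕ.^ (6 ℕ.* k))) ∣F∣≤1 ∣G∣≤1
        IF IG IF≃ IG≃ hFG hF hG (constant-bound k)
        rowsProduct (λ Z → pointwise-≃ λ n → seq-product-cong {k} n λ j → refl) J₀ (rowsExpectation Ω₁ k L μ₁ F) (rowsExpectation Ω₂ k L μ₂ G)
        (≃-trans J₀≃ (≃-trans joint-def joint-power)) rows₁≃ rows₂≃
        ∣ J₀ - rowsExpectation Ω₁ k L μ₁ F * rowsExpectation Ω₂ k L μ₂ G ∣
        (∣x-y∣≼∣x+-y∣ J₀ (rowsExpectation Ω₁ k L μ₁ F * rowsExpectation Ω₂ k L μ₂ G))

-- Transfer to the form of the statement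

-- Two reals with different but convertible definitions are compared through their sequences:
-- deciding the convertibility of the accompanying Cauchy proofs is not feasible.
record SeqCong {A : Set} (S : Summation A) : Set where
  constructor seqCong
  field
    seq-cong : ∀ {f g : A → ℝ} n → (∀ a → seq (f a) n ≡ seq (g a) n) → seq (S f) n ≡ seq (S g) n

open SeqCong

seq-sum-cong : ∀ m {f g : Fin m → ℝ} n → (∀ i → seq (f i) n ≡ seq (g i) n) → seq (sum f) n ≡ seq (sum g) n
seq-sum-cong zero    n h = refl
seq-sum-cong (suc m) n h = cong₂ ℚ._+_ (h zero) (seq-sum-cong m n λ i → h (suc i))

∑-SeqCong : ∀ Ω → SeqCong (∑ Ω)
∑-SeqCong Ω = seqCong λ n h → seq-sum-cong (FiniteSet.size Ω) n λ i → h (Inverse.from (FiniteSet.enum Ω) i)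

∑-Vec-SeqCong : {A : Set} {S : Summation A} → SeqCong S → ∀ m → SeqCong (∑-Vec S m)
∑-Vec-SeqCong s zero    = seqCong λ n h → h []
∑-Vec-SeqCong s (suc m) = seqCong λ n h → seq-cong s n λ a → seq-cong (∑-Vec-SeqCong s m) n λ v → h (a ∷ v)

-- `_≤_` looks at sequences only, so the new left side is given as a bare sequence and fits any real
-- that has it, whatever its Cauchy proof.
≤-seq-congˡ : ∀ x y (b : ℕ → ℚ) → (∀ n → seq x n ≡ b n) → x ≤ y →
              ∀ ε → 0ℚ ℚ.< ε → ∃ λ N → ∀ n → N ℕ.≤ n → b n ℚ.≤ seq y n ℚ.+ ε
≤-seq-congˡ x y b h x≤y ε 0<ε = eventually (λ n → subst (ℚ._≤ seq y n ℚ.+ ε) (h n)) (x≤y ε 0<ε)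

≈-seq-congˡ : ∀ x y (b : ℕ → ℚ) →
              (∀ ε → 0ℚ ℚ.< ε → ∃ λ N → ∀ n → N ℕ.≤ n → ℚ.∣ b n ℚ.- seq y n ∣ ℚ.≤ ε) →
              (∀ n → b n ≡ seq x n) → x ≈ y
≈-seq-congˡ x y b b≈y h ε 0<ε = eventually (λ n → subst (λ q → ℚ.∣ q ℚ.- seq y n ∣ ℚ.≤ ε) (h n)) (b≈y ε 0<ε)

decoupled : (Ω₁ Ω₂ : FiniteSet) (k L : ℕ) →
    (μ : Vec (Carrier Ω₁) k × Vec (Carrier Ω₂) k → ℝ) →
    IsProbability (CorrelatedSpace.∑₁₂ Ω₁ Ω₂ k) μ → CorrelatedSpace.PairwiseProduct Ω₁ Ω₂ k μ →
    (ν₁ : Carrier Ω₁ → ℝ) → (∀ j a → coordinateMarginal Ω₁ (CorrelatedSpace.marginal₁ Ω₁ Ω₂ k μ) j a ≈ ν₁ a) →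
    (ν₂ : Carrier Ω₂ → ℝ) → (∀ j b → coordinateMarginal Ω₂ (CorrelatedSpace.marginal₂ Ω₁ Ω₂ k μ) j b ≈ ν₂ b) →
    (F : Vec (Carrier Ω₁) L → ℝ) → (∀ x → ∈[-1,1] (F x)) →
    (G : Vec (Carrier Ω₂) L → ℝ) → (∀ y → ∈[-1,1] (G y)) →
    ∣ CorrelatedSpace.jointExpectation Ω₁ Ω₂ k L μ F G
         - rowsExpectation Ω₁ k L (CorrelatedSpace.marginal₁ Ω₁ Ω₂ k μ) F
           * rowsExpectation Ω₂ k L (CorrelatedSpace.marginal₂ Ω₁ Ω₂ k μ) G ∣
       ≤ fromℕ (2 ℕ.^ (6 ℕ.* k)) * (√ (sum λ i → Inf Ω₁ ν₁ F i) ⊔ √ (sum λ i → Inf Ω₂ ν₂ G i)) * √ (sum λ i → Inf Ω₁ ν₁ F i * Inf Ω₂ ν₂ G i)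
decoupled Ω₁ Ω₂ k L μ isProbability pairwise ν₁ ν₁-law ν₂ ν₂-law F F-bounded G G-bounded =
  Columns.core Ω₁ Ω₂ k μ isProbability pairwise
    (CorrelatedSpace.marginal₁ Ω₁ Ω₂ k μ) (λ x → pointwise-≃ λ _ → refl)
    (CorrelatedSpace.marginal₂ Ω₁ Ω₂ k μ) (λ y → pointwise-≃ λ _ → refl)
    ν₁ (λ j a → ≃-intro (ν₁-law j a)) ν₂ (λ j b → ≃-intro (ν₂-law j b))
    L F G (λ x → ∣∣≤1 (F x) (F-bounded x)) (λ y → ∣∣≤1 (G y) (G-bounded y))
    (Inf Ω₁ ν₁ F) (Inf Ω₂ ν₂ G) (Inf≃Influence Ω₁ ν₁ F) (Inf≃Influence Ω₂ ν₂ G)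
    (CorrelatedSpace.jointExpectation Ω₁ Ω₂ k L μ F G) (pointwise-≃ λ _ → refl)

-- The names that the statement gets from opening CorrelatedSpace are copies of the qualified ones
-- in decoupled, hence the detour through the sequences.
theorem2p8 :
  ∃ λ (C : ℕ) →
  (Ω₁ Ω₂ : FiniteSet) (k L : ℕ) →
  let open CorrelatedSpace Ω₁ Ω₂ k in
  (μ : Point → ℝ) → IsProbability ∑₁₂ μ → PairwiseProduct μ →
  (ν₁ : A₁ → ℝ) → (∀ j a → coordinateMarginal Ω₁ (marginal₁ μ) j a ≈ ν₁ a) →
  (ν₂ : A₂ → ℝ) → (∀ j b → coordinateMarginal Ω₂ (marginal₂ μ) j b ≈ ν₂ b) →
  (F : Vec A₁ L → ℝ) → (∀ x → ∈[-1,1] (F x)) →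
  (G : Vec A₂ L → ℝ) → (∀ y → ∈[-1,1] (G y)) →
  let τ = √ (sum λ i → Inf Ω₁ ν₁ F i * Inf Ω₂ ν₂ G i)
      Γ = √ (sum λ i → Inf Ω₁ ν₁ F i) ⊔ √ (sum λ i → Inf Ω₂ ν₂ G i)
  in ∣ jointExpectation L μ F G
       - rowsExpectation Ω₁ k L (marginal₁ μ) F * rowsExpectation Ω₂ k L (marginal₂ μ) G ∣
     ≤ fromℕ (2 ℕ.^ (C ℕ.* k)) * Γ * τ
-- The witness `6` is the exponent in `4k⁴+4k²≤2·2^6k`.
theorem2p8 = 6 , λ Ω₁ Ω₂ k L μ isProbability pairwise ν₁ ν₁-law ν₂ ν₂-law F F-bounded G G-bounded → ≤-seq-congˡ
  ∣ CorrelatedSpace.jointExpectation Ω₁ Ω₂ k L μ F G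
    - rowsExpectation Ω₁ k L (CorrelatedSpace.marginal₁ Ω₁ Ω₂ k μ) F
           * rowsExpectation Ω₂ k L (CorrelatedSpace.marginal₂ Ω₁ Ω₂ k μ) G ∣
  (fromℕ (2 ℕ.^ (6 ℕ.* k)) * (√ (sum λ i → Inf Ω₁ ν₁ F i) ⊔ √ (sum λ i → Inf Ω₂ ν₂ G i)) * √ (sum λ i → Inf Ω₁ ν₁ F i * Inf Ω₂ ν₂ G i)) _
  (λ n → cong₂ (λ p q → (seq (CorrelatedSpace.jointExpectation Ω₁ Ω₂ k L μ F G) n ℚ.+ ℚ.- (p ℚ.* q))
                  ℚ.⊔ ℚ.- (seq (CorrelatedSpace.jointExpectation Ω₁ Ω₂ k L μ F G) n ℚ.+ ℚ.- (p ℚ.* q)))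
    -- The marginals occur only in the weights, so the comparison descends into the product of the
    -- `L` column masses and nowhere else.
    (seq-cong (∑-Vec-SeqCong (∑-Vec-SeqCong (∑-SeqCong Ω₁) k) L) n λ X → cong₂ ℚ._*_ (seq-product-cong {L} n λ i → refl) refl)
    (seq-cong (∑-Vec-SeqCong (∑-Vec-SeqCong (∑-SeqCong Ω₂) k) L) n λ Y → cong₂ ℚ._*_ (seq-product-cong {L} n λ i → refl) refl))
  (decoupled Ω₁ Ω₂ k L μ isProbability pairwise
    ν₁ (λ j a → ≈-seq-congˡ (coordinateMarginal Ω₁ (CorrelatedSpace.marginal₁ Ω₁ Ω₂ k μ) j a) (ν₁ a) _
          (ν₁-law j a) λ n → seq-cong (∑-Vec-SeqCong (∑-SeqCong Ω₁) k) n λ x → refl)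
    ν₂ (λ j b → ≈-seq-congˡ (coordinateMarginal Ω₂ (CorrelatedSpace.marginal₂ Ω₁ Ω₂ k μ) j b) (ν₂ b) _
          (ν₂-law j b) λ n → seq-cong (∑-Vec-SeqCong (∑-SeqCong Ω₂) k) n λ y → refl)
    F F-bounded G G-bounded)
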